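{- Let $I,J\subseteq N$ with $|I|=|J|=k$, and put $r=q-k$. Then the minor of the superport response matrix $L$ with rows $I$ and columns $J$ satisfies $$\det L[I,J]=\frac{1}{\Phi_{\mathrm{valid}}}\sum_{F\in\mathcal F_{r+1}}\widehat\chi_F(I)\,\widehat\chi_F(J)\,w(F).$$ For every forest $F\in\mathcal F_{r+1}$, $$\alpha_F(I,J):=\widehat\chi_F(I)\,\widehat\chi_F(J)\in\{0,+1,-1\}.$$ The coefficient $\alpha_F(I,J)$ is nonzero exactly when both complementary port-edge sets $N\setminus I$ and $N\setminus J$ are spanning trees of $H_F$.
   Context: Network. $G=(V,E)$ is a finite connected simple undirected graph; each edge $e$ has a conductance $c_e\in\mathbb R_{>0}$. The weighted Laplacian $L_c$ is the $V\times V$ matrix with $(L_c)_{uu}=\sum_{e\ni u}c_e$, $(L_c)_{uv}=-c_{uv}$ if $uv\in E$, and $0$ otherwise. A spanning forest $F$ of $G$ is an acyclic subgraph with vertex set $V$ (isolated vertices allowed); $w(F)=\prod_{e\in F}c_e$; $\mathcal F_m$ is the set of spanning forests with exactly $m$ connected components. Matrix conventions. $A[S,T]$ is the submatrix with rows $S$ and columns $T$ in inherited order; empty determinants equal $1$. Superports. The boundary $M\subseteq V$ is nonempty and partitioned into nonempty superports $M=A_1\sqcup\cdots\sqcup A_p$. Choose a root $r_a\in A_a$ for each $a$; $R=\{r_1,\dots,r_p\}$, $N=M\setminus R$, $q=|N|$, $N=(x_1,\dots,x_q)$ in a fixed order; $r(x)$ is the root of the superport containing $x$. Fix a ground root $g\in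 R$. In $\mathbb R^{V\setminus\{g\}}$ with standard basis $(e_v)$ and the convention $e_g=0$, let $D$ be the matrix whose columns are $d_x=e_x-e_{r(x)}$, $x\in N$, in the fixed order. Superport response. Given $y\in\mathbb R^N$, consider voltages $U\in\mathbb R^V$ with $U_x-U_{r(x)}=y_x$ for all $x\in N$ whose incoming-current vector $\iota=L_cU$ satisfies $\iota_v=0$ for $v\notin M$ and $\sum_{v\in A_a}\iota_v=0$ for every $a$. Put $j_x=\iota_x$ for $x\in N$ (the independent incoming currents). The linear map $y\mapsto j$ is the superport response and $L$ is its $q\times q$ matrix: $j=Ly$. Valid forests. A spanning forest is valid if identifying all boundary vertices within each superport (one vertex per superport) turns it into a spanning tree of the quotient network (loops and parallel edges count as cycles). $\Phi_{\mathrm{valid}}=\sum_{F\text{ valid}}w(F)$. Quotient port graph. For a spanning forest $F$ with $s\ge1$ components, let $C_0(F)$ be the component containing $g$ and order the others as $C_1(F),\dots,C_{s-1}(F)$. The quotient port multigraph $H_F$ has the components of $F$ as vertices, and each $x\in N$ gives a directed edge from the component containing $r(x)$ to the component containing $x$ (a loop if these coincide). Let $Q_F$ be the $(s-1)\times(|V|-1)$ matrix with columns indexed by $V\setminus\{g\}$ and $(Q_F)_{a,v}=1$ if $v\in C_a(F)$, $0$ otherwise ($1\le a\le s-1$), and $B_F=Q_FD$. Completed determinant. For $I\subseteq N$, $|I|=k$, let $E_I$ be the $q\times k$ matrix whose columns are the standard basis vectors of $\mathbb R^N$ indexed by $I$, in inherited order. For $F\in\mathcal F_{q-k+1}$, $\widehat\chi_F(I)=\det\begin{pmatrix}B_F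 \\ E_I^T\end{pmatrix}$, a $q\times q$ determinant. -}

module Defs where

open import Algebra.Apartness.Bundles using (HeytingField)
open import Algebra.Bundles using (CommutativeRing)
import Algebra.Definitions.RawMonoid as RawMonoidDefinitions
import Algebra.Properties.Semiring.Sum as SemiringSum
import Algebra.Properties.CommutativeMonoid.Sum as MonoidSum
open import Data.Bool.Base using (if_then_else_)
open import Data.Fin.Base using (Fin; zero; suc; cast; punchIn)
import Data.Fin.Properties as Fin
open import Data.Fin.Subset using (Subset; inside; outside; _∈_; ∣_∣; ⊤)
open import Data.Fin.Subset.Properties using (_∈?_)
open import Data.List.Base as List using (List; []; _∷_; length; allFin; deduplicate)
open import Data.List.Membership.Propositional using () renaming (_∈_ to _∈ˡ_)
open import Data.List.Membership.Propositional.Properties using (∈-filter⁺; ∈-filter⁻; ∈-allFin; ∈-lookup)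
open import Data.List.Relation.Unary.All as All using (All)
open import Data.List.Relation.Unary.AllPairs using (_∷_)
open import Data.List.Relation.Unary.Any using (here; there)
open import Data.List.Relation.Unary.Unique.Propositional using (Unique)
import Data.List.Relation.Unary.Unique.DecPropositional as DecUnique
open import Data.Maybe.Base using (Maybe; just; nothing; maybe′)
import Data.Maybe.Properties as Maybe
open import Data.Nat.Base as ℕ using (ℕ; zero; suc; z≤n; s≤s)
import Data.Nat.Properties as ℕ
open import Data.Product.Base using (Σ-syntax; ∃; ∃-syntax; _×_; _,_; proj₁; proj₂; map; map₂)
open import Data.Product.Properties using (≡-dec)
open import Data.Sum.Base using (_⊎_; inj₁; inj₂; [_,_])
open import Data.Vec.Base using (tabulate; []; _∷_)
open import Data.Vec.Functional using (Vector; _++_)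
open import Function.Base using (_∘_; id; flip)
open import Function.Bundles using (_⇔_)
open import Level using (Level; 0ℓ; _⊔_) renaming (suc to lsuc)
open import Relation.Binary.Construct.Closure.ReflexiveTransitive using (Star; ε; _◅_; _◅◅_; gmap)
open import Relation.Binary.Core using (Rel)
open import Relation.Binary.Structures using (IsStrictPartialOrder)
open import Relation.Binary.PropositionalEquality.Core using (_≡_; _≢_; refl; sym; cong; subst)
open import Relation.Nullary using (Dec; yes; no; does; ¬_; ¬?; contradiction)
open import Relation.Nullary.Decidable using (map′; _×-dec_; _⊎-dec_; _→-dec_)
open import Relation.Unary using (Pred; Decidable)

-- The real numbers, characterised as the Archimedean, Cauchy complete
-- ordered field.  The order is the strict one and "nonzero" is the
-- apartness _# 0#, so that constructive models of ℝ are included as well.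
record RealNumbers (a ℓ₁ ℓ₂ ℓ₃ : Level) : Set (lsuc (a ⊔ ℓ₁ ⊔ ℓ₂ ⊔ ℓ₃)) where
  infix 4 _<_
  field
    heytingField : HeytingField a ℓ₁ ℓ₂

  open HeytingField heytingField public

  commutativeRing : CommutativeRing a ℓ₁
  commutativeRing = record { isCommutativeRing = isCommutativeRing }

  open RawMonoidDefinitions (CommutativeRing.+-rawMonoid commutativeRing)
    using () renaming (_×_ to _·_)

  field
    _<_                  : Rel Carrier ℓ₃
    isStrictPartialOrder : IsStrictPartialOrder _≈_ _<_
    #⇒<⊎>                : ∀ {x y} → x # y → x < y ⊎ y < x
    <⇒#                  : ∀ {x y} → x < y → x # y
    +-monoˡ-<            : ∀ {x y} z → x < y → x + z < y + z
    *-pos                : ∀ {x y} → 0# < x → 0# < y → 0# < x * y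
    archimedean          : ∀ x → ∃[ n ] x < n · 1#
    complete             :
      (s : ℕ → Carrier) →
      (∀ ε → 0# < ε → ∃[ N ] (∀ i j → N ℕ.≤ i → N ℕ.≤ j → s i - s j < ε)) →
      ∃[ l ] (∀ ε → 0# < ε → ∃[ N ] (∀ i → N ℕ.≤ i → s i - l < ε × l - s i < ε))

  -- #⇒invertible returns an inverse of x - 0#.
  recip : ∀ x → x # 0# → Carrier
  recip x x#0 = proj₁ (#⇒invertible x#0)

-- Loops and parallel edges are allowed.  The pair ends e gives e a
-- direction, which walks and cycles ignore.
record Multigraph (n m : ℕ) : Set where
  field
    vertices : Subset n
    ends     : Fin m → Fin n × Fin n

module _ {n m : ℕ} (H : Multigraph n m) where
  open Multigraph H

  Joins : Fin m → Fin n → Fin n → Set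
  Joins e u v = ends e ≡ (u , v) ⊎ ends e ≡ (v , u)

  Step : Pred (Fin m) 0ℓ → Rel (Fin n) 0ℓ
  Step P u v = ∃[ e ] P e × Joins e u v

  Walk : Pred (Fin m) 0ℓ → Rel (Fin n) 0ℓ
  Walk P = Star (Step P)

  -- A set of edges stands for the spanning subgraph with these edges.
  Linked : Subset m → Rel (Fin n) 0ℓ
  Linked F = Walk (_∈ F)

  module _ {P : Pred (Fin m) 0ℓ} where

    walkEdges : ∀ {u v} → Walk P u v → List (Fin m)
    walkEdges ε             = []
    walkEdges ((e , _) ◅ w) = e ∷ walkEdges w

    -- All vertices visited except the last one.
    walkVertices : ∀ {u v} → Walk P u v → List (Fin n)
    walkVertices ε           = []
    walkVertices {u} (_ ◅ w) = u ∷ walkVertices w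

    -- Loops are cycles of length 1, pairs of parallel edges of length 2.
    IsCycle : ∀ {v} → Walk P v v → Set
    IsCycle w = walkEdges w ≢ [] × Unique (walkEdges w) × Unique (walkVertices w)

  Acyclic : Subset m → Set
  Acyclic F = ¬ (∃[ v ] Σ[ w ∈ Linked F v v ] IsCycle w)

  IsSpanningTree : Subset m → Set
  IsSpanningTree T = Acyclic T × (∀ u v → u ∈ vertices → v ∈ vertices → Linked T u v)

  joins? : ∀ e u v → Dec (Joins e u v)
  joins? e u v = (ends e ≟ (u , v)) ⊎-dec (ends e ≟ (v , u))
    where _≟_ = ≡-dec Fin._≟_ Fin._≟_

  private
    JoinedVia : List (Fin m) → Rel (Fin n) 0ℓ
    JoinedVia es = Walk (_∈ˡ es)

    weaken : ∀ {e es u v} → JoinedVia es u v → JoinedVia (e ∷ es) u v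
    weaken = gmap id λ (e , e∈ , j) → e , there e∈ , j

    Via : Fin m → List (Fin m) → Rel (Fin n) 0ℓ
    Via e es u v = JoinedVia es u v
                 ⊎ (JoinedVia es u a × JoinedVia es b v)
                 ⊎ (JoinedVia es u b × JoinedVia es a v)
      where a = proj₁ (ends e)
            b = proj₂ (ends e)

    via⇒joined : ∀ e {es u v} → Via e es u v → JoinedVia (e ∷ es) u v
    via⇒joined e (inj₁ w)               = weaken w
    via⇒joined e (inj₂ (inj₁ (w , w′))) = weaken w ◅◅ (e , here refl , inj₁ refl) ◅ weaken w′
    via⇒joined e (inj₂ (inj₂ (w , w′))) = weaken w ◅◅ (e , here refl , inj₂ refl) ◅ weaken w′

    joined⇒via : ∀ e {es u v} → JoinedVia (e ∷ es) u v → Via e es u v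
    joined⇒via e ε = inj₁ ε
    joined⇒via e ((_ , here refl , inj₁ refl) ◅ w) with joined⇒via e w
    ... | inj₁ x              = inj₂ (inj₁ (ε , x))
    ... | inj₂ (inj₁ (_ , y)) = inj₂ (inj₁ (ε , y))
    ... | inj₂ (inj₂ (_ , y)) = inj₁ y
    joined⇒via e ((_ , here refl , inj₂ refl) ◅ w) with joined⇒via e w
    ... | inj₁ x              = inj₂ (inj₂ (ε , x))
    ... | inj₂ (inj₁ (_ , y)) = inj₁ y
    ... | inj₂ (inj₂ (_ , y)) = inj₂ (inj₂ (ε , y))
    joined⇒via e ((f , there f∈ , j) ◅ w) with joined⇒via e w
    ... | inj₁ x              = inj₁ ((f , f∈ , j) ◅ x)
    ... | inj₂ (inj₁ (x , y)) = inj₂ (inj₁ ((f , f∈ , j) ◅ x , y))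
    ... | inj₂ (inj₂ (x , y)) = inj₂ (inj₂ ((f , f∈ , j) ◅ x , y))

    joinedVia? : ∀ es u v → Dec (JoinedVia es u v)
    joinedVia? []       u v = map′ (λ { refl → ε }) (λ { ε → refl ; ((_ , () , _) ◅ _) }) (u Fin.≟ v)
    joinedVia? (e ∷ es) u v = map′ (via⇒joined e) (joined⇒via e)
      (joinedVia? es u v ⊎-dec (joinedVia? es u a ×-dec joinedVia? es b v)
                         ⊎-dec (joinedVia? es u b ×-dec joinedVia? es a v))
      where a = proj₁ (ends e)
            b = proj₂ (ends e)

  linked? : ∀ F u v → Dec (Linked F u v)
  linked? F u v = map′
    (gmap id λ (e , e∈ , j) → e , proj₂ (∈-filter⁻ (_∈? F) {xs = allFin m} e∈) , j)
    (gmap id λ (e , e∈ , j) → e , ∈-filter⁺ (_∈? F) (∈-allFin e) e∈ , j)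
    (joinedVia? (List.filter (_∈? F) (allFin m)) u v)

  private
    BoundedWalk : Subset m → ℕ → Fin n → Fin n → (List (Fin m) → List (Fin n) → Set) → Set
    BoundedWalk F l u v Q =
      Σ[ w ∈ Linked F u v ] length (walkEdges w) ℕ.≤ l × Q (walkEdges w) (walkVertices w)

    boundedWalk? : ∀ F l u v {Q} → (∀ es us → Dec (Q es us)) → Dec (BoundedWalk F l u v Q)
    boundedWalk? F zero u v Q? = map′
      (λ { (refl , x) → ε , z≤n , x })
      (λ { (ε , _ , x) → refl , x ; (_ ◅ _ , () , _) })
      ((u Fin.≟ v) ×-dec Q? [] [])
    boundedWalk? F (suc l) u v Q? = map′
      (λ { (inj₁ (refl , x)) → ε , z≤n , x
         ; (inj₂ (e , t , (e∈ , j) , w , l≤ , x)) → (e , e∈ , j) ◅ w , s≤s l≤ , x })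
      (λ { (ε , _ , x) → inj₁ (refl , x)
         ; (_◅_ {j = t} (e , e∈ , j) w , s≤s l≤ , x) → inj₂ (e , t , (e∈ , j) , w , l≤ , x) })
      (((u Fin.≟ v) ×-dec Q? [] []) ⊎-dec
       Fin.any? λ e → Fin.any? λ t → ((e ∈? F) ×-dec joins? e u t) ×-dec
         boundedWalk? F l t v (λ es us → Q? (e ∷ es) (u ∷ us)))

    unique-lookup : ∀ {A : Set} {xs : List A} → Unique xs →
                    ∀ i j → List.lookup xs i ≡ List.lookup xs j → i ≡ j
    unique-lookup (x≢ ∷ u) zero    zero    eq = refl
    unique-lookup (x≢ ∷ u) zero    (suc j) eq = contradiction eq (All.lookup x≢ (∈-lookup j))
    unique-lookup (x≢ ∷ u) (suc i) zero    eq = contradiction (sym eq) (All.lookup x≢ (∈-lookup i))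
    unique-lookup (x≢ ∷ u) (suc i) (suc j) eq = cong suc (unique-lookup u i j eq)

    null? : ∀ {A : Set} (xs : List A) → Dec (xs ≡ [])
    null? []      = yes refl
    null? (_ ∷ _) = no λ ()

  acyclic? : ∀ F → Dec (Acyclic F)
  acyclic? F = ¬? (map′
    (map₂ λ (w , _ , c) → w , c)
    (map₂ λ (w , c) → w , Fin.injective⇒≤ (λ {i} {j} → unique-lookup (proj₁ (proj₂ c)) i j) , c)
    (Fin.any? λ v → boundedWalk? F m v v λ es us →
      ¬? (null? es) ×-dec DecUnique.unique? Fin._≟_ es ×-dec DecUnique.unique? Fin._≟_ us))

  isSpanningTree? : ∀ T → Dec (IsSpanningTree T)
  isSpanningTree? T = acyclic? T ×-dec Fin.all? λ u → Fin.all? λ v →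
    (u ∈? vertices) →-dec ((v ∈? vertices) →-dec linked? T u v)

record SimpleGraph (n m : ℕ) : Set where
  field
    ends : Fin m → Fin n × Fin n

  multigraph : Multigraph n m
  multigraph = record { vertices = ⊤ ; ends = ends }

  field
    loopless    : ∀ e v → ¬ Joins multigraph e v v
    no-parallel : ∀ e f u v → Joins multigraph e u v → Joins multigraph f u v → e ≡ f

  Connected : Set
  Connected = ∀ u v → Linked multigraph ⊤ u v

  -- The components are the classes of Linked multigraph F.
  componentCount : Subset m → ℕ
  componentCount F = length (deduplicate (linked? multigraph F) (allFin n))

-- port v ≡ just a means v ∈ A_a, and port v ≡ nothing means v ∉ M.
-- The roots make all superports nonempty, the ground makes M nonempty.
record Superports (n q : ℕ) : Set where
  field
    p         : ℕ
    port      : Fin n → Maybe (Fin p)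
    root      : Fin p → Fin n
    root-port : ∀ a → port (root a) ≡ just a
    ground    : Fin p
    -- The non-root boundary vertices x₁, …, x_q.
    N           : Fin q → Fin n
    N-injective : ∀ x y → N x ≡ N y → x ≡ y
    N-image     : ∀ v → (∃[ x ] N x ≡ v) ⇔ (∃[ a ] port v ≡ just a × v ≢ root a)

  g : Fin n
  g = root ground

  -- The root of the superport containing v, or v itself if v ∉ M.
  rootOf : Fin n → Fin n
  rootOf v = maybe′ root v (port v)

  -- Identified vertices are represented by their root.
  quotient : ∀ {m} → SimpleGraph n m → Multigraph n m
  quotient G = record
    { vertices = tabulate λ v → does (rootOf v Fin.≟ v)
    ; ends     = map rootOf rootOf ∘ SimpleGraph.ends G
    }

pick : ∀ {n} (I : Subset n) → Fin ∣ I ∣ → Fin n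
pick (inside  ∷ I) zero    = zero
pick (inside  ∷ I) (suc i) = suc (pick I i)
pick (outside ∷ I) i       = suc (pick I i)

pick′ : ∀ {n k} (I : Subset n) → ∣ I ∣ ≡ k → Fin k → Fin n
pick′ I ∣I∣≡k i = pick I (cast (sym ∣I∣≡k) i)

module LinearAlgebra {a ℓ} (R : CommutativeRing a ℓ) where
  open CommutativeRing R hiding (zero; refl; sym)
  open SemiringSum semiring public using (sum)
  open MonoidSum *-commutativeMonoid public using () renaming (sum to product)

  Matrix : ℕ → ℕ → Set a
  Matrix m n = Fin m → Fin n → Carrier

  δ : ∀ {n} → Fin n → Fin n → Carrier
  δ i j = if does (i Fin.≟ j) then 1# else 0#

  infixl 7 _∙_ _∙ᵥ_
  _∙_ : ∀ {l m n} → Matrix l m → Matrix m n → Matrix l n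
  (A ∙ B) i j = sum λ k → A i k * B k j

  _∙ᵥ_ : ∀ {m n} → Matrix m n → Vector Carrier n → Vector Carrier m
  (A ∙ᵥ x) i = sum λ j → A i j * x j

  sign : ∀ {n} → Fin n → Carrier
  sign zero    = 1#
  sign (suc i) = - sign i

  det : ∀ {n} → Matrix n n → Carrier
  det {zero}  A = 1#
  det {suc n} A = sum λ j → sign j * A zero j * det λ i l → A (suc i) (punchIn j l)

  minor : ∀ {m n k} → Matrix m n → (I : Subset m) (J : Subset n) →
          ∣ I ∣ ≡ k → ∣ J ∣ ≡ k → Carrier
  minor A I J ∣I∣≡k ∣J∣≡k = det λ i j → A (pick′ I ∣I∣≡k i) (pick′ J ∣J∣≡k j)

  sumSubsets : ∀ {m} → (Subset m → Carrier) → Carrier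
  sumSubsets {zero}  f = f []
  sumSubsets {suc m} f = sumSubsets (f ∘ (outside ∷_)) + sumSubsets (f ∘ (inside ∷_))

  sumOver : ∀ {m} {P : Pred (Subset m) 0ℓ} → Decidable P → (∀ F → P F → Carrier) → Carrier
  sumOver {P = P} P? f = sumSubsets λ F → term F (P? F)
    where
    term : ∀ F → Dec (P F) → Carrier
    term F (yes F∈P) = f F F∈P
    term F (no _)    = 0#

-- V = Fin (suc n) since V is nonempty; V ∖ {g} is enumerated by punchIn g.
module PortNetwork {a ℓ} (R : CommutativeRing a ℓ) {n m q : ℕ}
  (G : SimpleGraph (suc n) m) (c : Fin m → CommutativeRing.Carrier R)
  (S : Superports (suc n) q) where

  open CommutativeRing R hiding (zero; refl; sym)
  open LinearAlgebra R public
  open SimpleGraph G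
  open Superports S

  weight : Subset m → Carrier
  weight F = product λ e → if does (e ∈? F) then c e else 1#

  laplacian : Matrix (suc n) (suc n)
  laplacian u v with u Fin.≟ v
  ... | yes _ = sum λ e →
                  if does ((u Fin.≟ proj₁ (ends e)) ⊎-dec (u Fin.≟ proj₂ (ends e))) then c e else 0#
  ... | no  _ with Fin.any? (λ e → joins? multigraph e u v)
  ...   | yes (e , _) = - c e
  ...   | no  _       = 0#

  record Admissible (y : Vector Carrier q) (U : Vector Carrier (suc n)) : Set ℓ where
    field
      voltages : ∀ x → U (N x) - U (rootOf (N x)) ≈ y x
      interior : ∀ v → port v ≡ nothing → (laplacian ∙ᵥ U) v ≈ 0#
      balanced : ∀ a → sum (λ v → if does (Maybe.≡-dec Fin._≟_ (port v) (just a))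
                                  then (laplacian ∙ᵥ U) v else 0#) ≈ 0#

  -- L is the matrix of y ↦ j; that each y has an admissible U is not assumed.
  IsResponse : Matrix q q → Set (a ⊔ ℓ)
  IsResponse L = ∀ y U → Admissible y U → ∀ x → (laplacian ∙ᵥ U) (N x) ≈ (L ∙ᵥ y) x

  -- Subsets of Fin m are the spanning subgraphs of G.
  𝓕 : ℕ → Pred (Subset m) 0ℓ
  𝓕 s F = Acyclic multigraph F × componentCount F ≡ s

  𝓕? : ∀ s → Decidable (𝓕 s)
  𝓕? s F = acyclic? multigraph F ×-dec componentCount F ℕ.≟ s

  Valid : Pred (Subset m) 0ℓ
  Valid F = Acyclic multigraph F × IsSpanningTree (quotient G) F

  valid? : Decidable Valid
  valid? F = acyclic? multigraph F ×-dec isSpanningTree? (quotient G) F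

  Φ-valid : Carrier
  Φ-valid = sumOver valid? λ F _ → weight F

  -- An enumeration C₀(F), …, C_r(F) of the components of F with g ∈ C₀(F):
  -- component v is the index of the one containing v.
  record ComponentOrder (F : Subset m) (r : ℕ) : Set where
    field
      component  : Fin (suc n) → Fin (suc r)
      surjective : ∀ a → ∃[ v ] component v ≡ a
      separates  : ∀ u v → component u ≡ component v ⇔ Linked multigraph F u v
      ground≡0   : component g ≡ zero

  D : Matrix n q
  D w x = δ v (N x) - δ v (rootOf (N x))
    where v = punchIn g w

  E : ∀ {k} (I : Subset q) → ∣ I ∣ ≡ k → Matrix q k
  E I ∣I∣≡k x i = δ x (pick′ I ∣I∣≡k i)

  module _ {F : Subset m} {r : ℕ} (o : ComponentOrder F r) where
    open ComponentOrder o

    portGraph : Multigraph (suc r) q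
    portGraph = record
      { vertices = ⊤
      ; ends     = λ x → component (rootOf (N x)) , component (N x)
      }

    Q : Matrix r n
    Q a w = δ (component (punchIn g w)) (suc a)

    B : Matrix r q
    B = Q ∙ D

    χ̂ : ∀ {k} → r ℕ.+ k ≡ q → (I : Subset q) → ∣ I ∣ ≡ k → Carrier
    χ̂ r+k≡q I ∣I∣≡k = det λ i → (B ++ flip (E I ∣I∣≡k)) (cast (sym r+k≡q) i)

    α : ∀ {k} → r ℕ.+ k ≡ q → (I J : Subset q) → ∣ I ∣ ≡ k → ∣ J ∣ ≡ k → Carrier
    α r+k≡q I J ∣I∣≡k ∣J∣≡k = χ̂ r+k≡q I ∣I∣≡k * χ̂ r+k≡q J ∣J∣≡k

{-# OPTIONS --safe #-}

-- Put A = Σₑ cₑ ∂ₑ∂ₑᵀ for the Laplacian grounded at g.  Voltages U and response L solve the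
-- system A U = D L, Dᵀ U = 1, with matrix M = [[A, -D], [Dᵀ, O]].  Bordering M by the selections
-- of I and J gives a matrix W whose Schur complement is L[I,J], so det W = det M · det L[I,J].
-- On the other hand det W is multi-affine in c: the coefficient of w(F) is a bordered determinant
-- of bipartite shape, hence a product P_F(I) P_F(J) with P_F(I) = det [[∂_F, -D], [O, -E_Iᵀ]]
-- when |F| = |V| - 1 - r, and zero for every other size.
--
-- If F has a cycle, the rows ∂ₑ (e ∈ F) are dependent and P_F = 0.  If F is a forest with r + 1
-- components, then [∂_F | roots] is invertible over ℤ and reduces P_F(I) to ± χ̂_F(I), with a sign
-- not depending on I.  For k = 0 the square P_F² is 1 if F is valid and 0 otherwise, so det M = Φ.
--
-- Every determinant of incidence type is decided by connectivity: if the chosen edges connect the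
-- graph, walks express the unit vectors as integer combinations of edge vectors and the determinant
-- is ±1; if they do not, the indicator of a component is in the kernel; an edge bypassed by the
-- others makes the edge vectors dependent.

module Submission where

open import Algebra.Apartness.Properties.HeytingCommutativeRing as HeytingProperties using ()
open import Algebra.Bundles using (CommutativeRing)
import Algebra.Properties.AbelianGroup as AbelianGroupProperties
import Algebra.Properties.Ring as RingProperties
import Algebra.Properties.Semiring.Mult as SemiringMult
import Algebra.Properties.Semiring.Sum as SemiringSums
import Algebra.Solver.Ring as RingSolver
open import Algebra.Solver.Ring.AlmostCommutativeRing using (fromCommutativeRing; _-Raw-AlmostCommutative⟶_)
open import Data.Bool.Base using (if_then_else_; true)
open import Data.Fin.Base using (Fin; zero; suc; punchIn; punchOut; splitAt; _↑ˡ_; cast)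
open import Data.Fin.Permutation using (↔⇒≡)
import Data.Fin.Properties as Fin
open import Data.Fin.Subset using (Subset; inside; outside; ∣_∣; _∈_; _∉_; ∁; ⊤) renaming (_-_ to _∖_)
open import Data.Fin.Subset.Properties
  using (_∈?_; x∈p∧x≢y⇒x∈p-y; x∈p⇒∣p-x∣<∣p∣; p─q⊆p; drop-there; x∉p⇒x∈∁p; x∈∁p⇒x∉p; ∈⊤)
open import Data.Integer.Base as ℤ using (ℤ; +_; -[1+_]; _⊖_)
import Data.Integer.Properties as ℤ
open import Data.List.Base as List using (List; []; _∷_; length; allFin; deduplicate)
open import Data.List.Membership.DecPropositional as DecMembership using ()
open import Data.List.Membership.Propositional using () renaming (_∈_ to _∈ˡ_)
open import Data.List.Membership.Propositional.Properties using (∈-allFin; ∈-lookup)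
open import Data.List.Relation.Unary.All as All using (All; []; _∷_)
import Data.List.Relation.Unary.All.Properties as All
open import Data.List.Relation.Unary.AllPairs as AllPairs using (AllPairs; []; _∷_)
open import Data.List.Relation.Unary.Any as Any using (Any; here; there)
import Data.List.Relation.Unary.Any.Properties as Any
import Data.List.Relation.Unary.Unique.DecSetoid.Properties as UniqueDecSetoid
open import Data.List.Relation.Unary.Unique.Propositional using (Unique)
open import Data.Maybe.Base using (Maybe; just; nothing; maybe′)
import Data.Maybe.Properties as Maybe
open import Data.Nat.Base as ℕ using (ℕ; zero; suc)
open import Data.Nat.Induction using (<-wellFounded)
import Data.Nat.Properties as ℕ
open import Data.Product.Base as Product using (∃₂; _×_; _,_; ∃-syntax; proj₁; proj₂; Σ-syntax)
open import Data.Sum.Base as Sum using (_⊎_; inj₁; inj₂; [_,_])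
open import Data.Sum.Function.Propositional using (_⊎-↔_)
import Data.Sum.Properties as Sum
open import Data.Unit.Base using (tt) renaming (⊤ to Unit)
open import Data.Vec.Base as Vec using ([]; _∷_)
open import Data.Vec.Functional using (Vector; tail; insertAt; removeAt) renaming (_∷_ to _◂_)
open import Data.Vec.Functional.Properties using (insertAt-lookup; insertAt-punchIn)
open import Data.Vec.Properties using (lookup⇒[]=; []=⇒lookup; lookup∘tabulate)
open import Defs
open import Function.Base using (_∘_; flip; id)
open import Function.Bundles using (_↔_; Inverse; _⇔_; Equivalence; mk⇔)
open import Function.Construct.Composition using (_↔-∘_)
open import Function.Construct.Symmetry using (↔-sym)
open import Induction.WellFounded using (Acc; acc)
open import Level using (_⊔_; 0ℓ)
open import Relation.Binary.Bundles using (DecSetoid)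
open import Relation.Binary.Construct.Closure.ReflexiveTransitive as Star using (Star; ε; _◅_; _◅◅_)
open import Relation.Binary.Definitions using (Tri; tri<; tri≈; tri>)
open import Relation.Binary.PropositionalEquality.Core as ≡ using (_≡_; _≢_)
import Relation.Binary.Reasoning.Setoid as SetoidReasoning
open import Relation.Binary.Structures using (IsStrictPartialOrder)
open import Relation.Nullary using (yes; no; contradiction; Dec; does; ¬_)
open import Relation.Nullary.Decidable using (map′; _×-dec_; _⊎-dec_; dec-true; decidable-stable)
open import Relation.Unary using (Pred; Decidable)

-- Equality in `ℝ` need not be decidable, only the combinatorial facts are, so no step can pivot on
-- an entry being nonzero. Determinants are instead evaluated by explicit factorisations, by kernel
-- vectors with an entry equal to 1 (multiply by the adjugate), or by an integral one-sided inverse,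
-- whose determinant times the given one is 1 in ℤ. The last way needs the integer multiples of 1 to
-- be distinct, which follows from the order of `ℝ`. Signs are the second obstacle. Blocks are
-- indexed by disjoint sums, and the index set of a block matrix is reordered on rows and columns
-- simultaneously, so these permutations leave no sign; the signs of unimodular factors occur
-- squared. Finally, `IsResponse` gives information only where an admissible voltage exists. For
-- each unit port voltage one is therefore constructed from a column of the inverse of M, which is
-- available because det M = Φ is computed beforehand and is positive.

module IntegerMultiples {a ℓ} (R : CommutativeRing a ℓ) where
  open CommutativeRing R
  open RingProperties ring using (-0#≈0#; -‿distribˡ-*; -‿distribʳ-*; -‿involutive)
  open AbelianGroupProperties +-abelianGroup using () renaming (⁻¹-∙-comm to -‿+-comm)
  open SemiringMult semiring using (×-homo-+; ×1-homo-*) renaming (_×_ to _·_)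
  open SetoidReasoning setoid

  φ : ℤ → Carrier
  φ (+ n)    = n · 1#
  φ -[1+ n ] = - (suc n · 1#)

  φ-⊖ : ∀ m n → φ (m ⊖ n) ≈ m · 1# - n · 1#
  φ-⊖ m       zero    = sym (trans (+-congˡ -0#≈0#) (+-identityʳ _))
  φ-⊖ zero    (suc n) = sym (+-identityˡ _)
  φ-⊖ (suc m) (suc n) = begin
    φ (suc m ⊖ suc n)                ≡⟨ ≡.cong φ (ℤ.[1+m]⊖[1+n]≡m⊖n m n) ⟩
    φ (m ⊖ n)                        ≈⟨ φ-⊖ m n ⟩
    x - y                            ≈⟨ +-identityˡ _ ⟨
    0# + (x - y)                     ≈⟨ +-congʳ (-‿inverseʳ 1#) ⟨
    1# - 1# + (x - y)                ≈⟨ +-assoc _ _ _ ⟩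
    1# + (- 1# + (x - y))            ≈⟨ +-congˡ (+-assoc _ _ _) ⟨
    1# + (- 1# + x - y)              ≈⟨ +-congˡ (+-congʳ (+-comm _ _)) ⟩
    1# + (x - 1# - y)                ≈⟨ +-congˡ (+-assoc _ _ _) ⟩
    1# + (x + (- 1# - y))            ≈⟨ +-assoc _ _ _ ⟨
    1# + x + (- 1# - y)              ≈⟨ +-congˡ (-‿+-comm _ _) ⟩
    1# + x - (1# + y)                ∎
    where
    x = m · 1#
    y = n · 1#

  φ-+ : ∀ i j → φ (i ℤ.+ j) ≈ φ i + φ j
  φ-+ (+ m)    (+ n)    = ×-homo-+ 1# m n
  φ-+ (+ m)    -[1+ n ] = φ-⊖ m (suc n)
  φ-+ -[1+ m ] (+ n)    = trans (φ-⊖ n (suc m)) (+-comm _ _)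
  φ-+ -[1+ m ] -[1+ n ] = begin
    - (suc (suc (m ℕ.+ n)) · 1#)       ≡⟨ ≡.cong (λ k → - (suc k · 1#)) (ℕ.+-suc m n) ⟨
    - ((suc m ℕ.+ suc n) · 1#)         ≈⟨ -‿cong (×-homo-+ 1# (suc m) (suc n)) ⟩
    - (suc m · 1# + suc n · 1#)        ≈⟨ -‿+-comm _ _ ⟨
    - (suc m · 1#) - suc n · 1#        ∎

  φ-neg : ∀ i → φ (ℤ.- i) ≈ - φ i
  φ-neg (+ zero)  = sym -0#≈0#
  φ-neg (+ suc n) = refl
  φ-neg -[1+ n ]  = sym (-‿involutive _)

  -- Injectivity of `φ`, expressed through its kernel. It allows an identity between integral
  -- elements of the ring to be read back in ℤ.
  CharacteristicZero : Set ℓ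
  CharacteristicZero = ∀ i → φ i ≈ 0# → i ≡ + 0

  private
    φ-pos-* : ∀ m j → φ (+ m ℤ.* j) ≈ φ (+ m) * φ j
    φ-pos-* m (+ n)    = begin
      φ (+ m ℤ.* + n)      ≡⟨ ≡.cong φ (ℤ.pos-* m n) ⟨
      (m ℕ.* n) · 1#       ≈⟨ ×1-homo-* m n ⟩
      m · 1# * (n · 1#)    ∎
    φ-pos-* m -[1+ n ] = begin
      φ (+ m ℤ.* -[1+ n ])          ≡⟨ ≡.cong φ (ℤ.neg-distribʳ-* (+ m) (+ suc n)) ⟨
      φ (ℤ.- (+ m ℤ.* + suc n))     ≈⟨ φ-neg (+ m ℤ.* + suc n) ⟩
      - φ (+ m ℤ.* + suc n)         ≈⟨ -‿cong (φ-pos-* m (+ suc n)) ⟩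
      - (m · 1# * (suc n · 1#))     ≈⟨ -‿distribʳ-* _ _ ⟩
      m · 1# * - (suc n · 1#)       ∎

  φ-* : ∀ i j → φ (i ℤ.* j) ≈ φ i * φ j
  φ-* (+ m)    j = φ-pos-* m j
  φ-* -[1+ m ] j = begin
    φ (-[1+ m ] ℤ.* j)           ≡⟨ ≡.cong φ (ℤ.neg-distribˡ-* (+ suc m) j) ⟨
    φ (ℤ.- (+ suc m ℤ.* j))      ≈⟨ φ-neg (+ suc m ℤ.* j) ⟩
    - φ (+ suc m ℤ.* j)          ≈⟨ -‿cong (φ-pos-* (suc m) j) ⟩
    - (suc m · 1# * φ j)         ≈⟨ -‿distribˡ-* _ _ ⟩
    - (suc m · 1#) * φ j         ∎

  φ-1 : φ (+ 1) ≈ 1#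
  φ-1 = +-identityʳ 1#

  private
    morphism : CommutativeRing.rawRing ℤ.+-*-commutativeRing
               -Raw-AlmostCommutative⟶ fromCommutativeRing R
    morphism = record
      { ⟦_⟧ = φ ; +-homo = φ-+ ; *-homo = φ-* ; -‿homo = φ-neg ; 0-homo = refl ; 1-homo = φ-1 }

    -- The ring itself has no equality test; the solver compares the integer coefficients of normal
    -- forms, and equal integers have equal images.
    coeff≟ : ∀ i j → Maybe (φ i ≈ φ j)
    coeff≟ i j with i ℤ.≟ j
    ... | yes i≡j = just (reflexive (≡.cong φ i≡j))
    ... | no  _   = nothing

  module Solver = RingSolver (CommutativeRing.rawRing ℤ.+-*-commutativeRing)
                             (fromCommutativeRing R) morphism coeff≟

-- Determinants as alternating multilinear functions of the rows.

data Next : ∀ {n} → Fin n → Fin n → Set where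
  here  : ∀ {n} → Next {suc (suc n)} zero (suc zero)
  there : ∀ {n} {i j : Fin n} → Next i j → Next (suc i) (suc j)

-- The enumerations that skip `i` and `j` differ in a single place, where each passes through the
-- index that the other omits. Hence the minors at two equal neighbouring columns agree.
punchIn-next : ∀ {n} {i j : Fin (suc n)} → Next i j → ∀ l →
               punchIn i l ≡ punchIn j l ⊎ (punchIn i l ≡ j × punchIn j l ≡ i)
punchIn-next here        zero    = inj₂ (≡.refl , ≡.refl)
punchIn-next here        (suc l) = inj₁ ≡.refl
punchIn-next (there nxt) zero    = inj₁ ≡.refl
punchIn-next (there nxt) (suc l) with punchIn-next nxt l
... | inj₁ eq        = inj₁ (≡.cong suc eq)
... | inj₂ (eq , eq′) = inj₂ (≡.cong suc eq , ≡.cong suc eq′)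

next-punchIn : ∀ {n} {i j : Fin (suc n)} → Next i j → ∀ k → k ≢ i → k ≢ j →
               ∃₂ λ i′ j′ → Next i′ j′ × punchIn k i′ ≡ i × punchIn k j′ ≡ j
next-punchIn here zero k≢i k≢j = contradiction ≡.refl k≢i
next-punchIn here (suc zero) k≢i k≢j = contradiction ≡.refl k≢j
next-punchIn {suc (suc n)} here (suc (suc k)) k≢i k≢j = zero , suc zero , here , ≡.refl , ≡.refl
next-punchIn (there nxt) zero k≢i k≢j = _ , _ , nxt , ≡.refl , ≡.refl
next-punchIn {suc n} (there nxt) (suc k) k≢i k≢j
  with next-punchIn nxt k (k≢i ∘ ≡.cong suc) (k≢j ∘ ≡.cong suc)
... | _ , _ , nxt′ , eq , eq′ = _ , _ , there nxt′ , ≡.cong suc eq , ≡.cong suc eq′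

module Determinants {a ℓ} (R : CommutativeRing a ℓ) where
  open CommutativeRing R hiding (zero)
  open LinearAlgebra R
  open SemiringSums semiring using (sum-cong-≋; ∑-distrib-+; sum-replicate-zero; *-distribˡ-sum)
  open RingProperties ring using (-0#≈0#; -‿distribˡ-*)
  open IntegerMultiples R using (module Solver)
  open Solver using (solve; _:+_; _:*_; :-_; _:=_)
  open SetoidReasoning setoid

  annihilateˡ : ∀ {x y} → x ≈ 0# → x * y ≈ 0#
  annihilateˡ x≈0 = trans (*-congʳ x≈0) (zeroˡ _)

  annihilateʳ : ∀ {x y} → y ≈ 0# → x * y ≈ 0#
  annihilateʳ y≈0 = trans (*-congˡ y≈0) (zeroʳ _)

  +-dropˡ : ∀ {x y z} → x ≈ 0# → y ≈ z → x + y ≈ z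
  +-dropˡ x≈0 y≈z = trans (+-cong x≈0 y≈z) (+-identityˡ _)

  +-dropʳ : ∀ {x y z} → x ≈ z → y ≈ 0# → x + y ≈ z
  +-dropʳ x≈z y≈0 = trans (+-cong x≈z y≈0) (+-identityʳ _)

  -1*-1≈1 : - 1# * - 1# ≈ 1#
  -1*-1≈1 = trans (solve 1 (λ s → :- s :* :- s := s :* s) refl 1#) (*-identityˡ 1#)

  sum-zero : ∀ {n} {f : Vector Carrier n} → (∀ i → f i ≈ 0#) → sum f ≈ 0#
  sum-zero {n} f≈0 = trans (sum-cong-≋ f≈0) (sum-replicate-zero n)

  sum-next : ∀ {n} {f : Vector Carrier n} {i j} → Next i j → f i + f j ≈ 0# →
             (∀ k → k ≢ i → k ≢ j → f k ≈ 0#) → sum f ≈ 0#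
  sum-next {f = f} here fi+fj≈0 f≈0 = begin
    f zero + (f (suc zero) + rest)   ≈⟨ +-assoc _ _ _ ⟨
    f zero + f (suc zero) + rest     ≈⟨ +-cong fi+fj≈0 (sum-zero {f = λ k → f (suc (suc k))}
                                          λ k → f≈0 (suc (suc k)) (λ ()) λ ()) ⟩
    0# + 0#                          ≈⟨ +-identityˡ 0# ⟩
    0#                               ∎
    where rest = sum λ k → f (suc (suc k))
  sum-next (there nxt) fi+fj≈0 f≈0 =
    +-dropˡ (f≈0 zero (λ ()) (λ ()))
                  (sum-next nxt fi+fj≈0 λ k k≢i k≢j →
                     f≈0 (suc k) (k≢i ∘ Fin.suc-injective) (k≢j ∘ Fin.suc-injective))

  δ-diag : ∀ {n} (i : Fin n) → δ i i ≈ 1#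
  δ-diag zero    = refl
  δ-diag (suc i) = δ-diag i

  δ-off : ∀ {n} {i j : Fin n} → i ≢ j → δ i j ≈ 0#
  δ-off {i = i} {j} i≢j with i Fin.≟ j
  ... | yes i≡j = contradiction i≡j i≢j
  ... | no  _   = refl

  δ-injection : ∀ {m n} {f : Fin m → Fin n} → (∀ {i j} → f i ≡ f j → i ≡ j) → ∀ i j → δ (f i) (f j) ≈ δ i j
  δ-injection {f = f} f-injective i j with i Fin.≟ j
  ... | yes ≡.refl = δ-diag (f i)
  ... | no  i≢j    = δ-off (i≢j ∘ f-injective)

  δ-sym : ∀ {n} (i j : Fin n) → δ i j ≈ δ j i
  δ-sym zero    zero    = refl
  δ-sym zero    (suc j) = refl
  δ-sym (suc i) zero    = refl
  δ-sym (suc i) (suc j) = δ-sym i j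

  sum-δˡ : ∀ {n} (i : Fin n) (f : Vector Carrier n) → sum (λ j → δ i j * f j) ≈ f i
  sum-δˡ zero    f = begin
    1# * f zero + sum (λ j → 0# * f (suc j))
      ≈⟨ +-cong (*-identityˡ _) (sum-zero {f = λ j → 0# * f (suc j)} λ j → zeroˡ _) ⟩
    f zero + 0#                               ≈⟨ +-identityʳ _ ⟩
    f zero                                    ∎
  sum-δˡ (suc i) f = +-dropˡ (zeroˡ _) (sum-δˡ i (f ∘ suc))

  sum-δʳ : ∀ {n} (i : Fin n) (f : Vector Carrier n) → sum (λ j → f j * δ j i) ≈ f i
  sum-δʳ i f = trans (sum-cong-≋ λ j → trans (*-comm _ _) (*-congʳ (δ-sym j i))) (sum-δˡ i f)

  sum-linear : ∀ {n} s t (f g : Vector Carrier n) →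
               sum (λ i → s * f i + t * g i) ≈ s * sum f + t * sum g
  sum-linear s t f g = trans (∑-distrib-+ (λ i → s * f i) (λ i → t * g i))
                             (+-cong (sym (*-distribˡ-sum s f)) (sym (*-distribˡ-sum t g)))

  infix 4 _≈ₘ_
  _≈ₘ_ : ∀ {m n} → Matrix m n → Matrix m n → Set ℓ
  A ≈ₘ B = ∀ i j → A i j ≈ B i j

  det-cong : ∀ {n} {A B : Matrix n n} → A ≈ₘ B → det A ≈ det B
  det-cong {zero}  A≈B = refl
  det-cong {suc n} {A} {B} A≈B = sum-cong-≋ {suc n} λ j →
    *-cong (*-congˡ {sign j} (A≈B zero j)) (det-cong λ i l → A≈B (suc i) (punchIn j l))

  det-δ : ∀ n → det (δ {n}) ≈ 1#
  det-δ zero    = refl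
  det-δ (suc n) = begin
    1# * 1# * det (δ {n}) + sum rest
      ≈⟨ +-cong (trans (*-congʳ (*-identityˡ 1#)) (*-identityˡ _)) (sum-zero {f = rest} rest≈0) ⟩
    det (δ {n}) + 0#                  ≈⟨ +-identityʳ _ ⟩
    det (δ {n})                       ≈⟨ det-δ n ⟩
    1#                                ∎
    where
    rest : Vector Carrier n
    rest j = sign (suc j) * 0# * det (λ i l → δ (suc i) (punchIn (suc j) l))
    rest≈0 : ∀ j → rest j ≈ 0#
    rest≈0 j = annihilateˡ (zeroʳ _)

  -- In the expansion along the first row, the term `j = c` is linear through its entry and every
  -- other term through its minor, by induction.
  det-linear-column :
    ∀ {n} (A B C : Matrix n n) c s t →
    (∀ i j → j ≢ c → A i j ≈ B i j) → (∀ i j → j ≢ c → A i j ≈ C i j) →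
    (∀ i → A i c ≈ s * B i c + t * C i c) → det A ≈ s * det B + t * det C
  det-linear-column {suc n} A B C c s t A≈B A≈C Ac = begin
    det A                                        ≈⟨ sum-cong-≋ term ⟩
    sum (λ j → s * termOf B j + t * termOf C j)  ≈⟨ sum-linear s t (termOf B) (termOf C) ⟩
    s * det B + t * det C                        ∎
    where
    minorAt : Matrix (suc n) (suc n) → Fin (suc n) → Matrix n n
    minorAt M j i l = M (suc i) (punchIn j l)
    termOf : Matrix (suc n) (suc n) → Fin (suc n) → Carrier
    termOf M j = sign j * M zero j * det (minorAt M j)
    term : ∀ j → termOf A j ≈ s * termOf B j + t * termOf C j
    term j with j Fin.≟ c
    ... | yes ≡.refl = begin
      sign j * A zero j * det (minorAt A j)
        ≈⟨ *-congʳ (*-congˡ (Ac zero)) ⟩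
      sign j * (s * B zero j + t * C zero j) * det (minorAt A j)
        ≈⟨ solve 6 (λ σ s b t c d → σ :* (s :* b :+ t :* c) :* d := s :* (σ :* b :* d) :+ t :* (σ :* c :* d))
             refl (sign j) s (B zero j) t (C zero j) (det (minorAt A j)) ⟩
      s * (sign j * B zero j * det (minorAt A j)) + t * (sign j * C zero j * det (minorAt A j))
        ≈⟨ +-cong (*-congˡ (*-congˡ (det-cong λ i l → A≈B (suc i) _ (Fin.punchInᵢ≢i j l))))
                  (*-congˡ (*-congˡ (det-cong λ i l → A≈C (suc i) _ (Fin.punchInᵢ≢i j l)))) ⟩
      s * termOf B j + t * termOf C j ∎
    ... | no j≢c = begin
      sign j * A zero j * det (minorAt A j)
        ≈⟨ *-congˡ (det-linear-column (minorAt A j) (minorAt B j) (minorAt C j) c′ s t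
             (λ i l l≢c′ → A≈B (suc i) _ (l≢c′ ∘ back)) (λ i l l≢c′ → A≈C (suc i) _ (l≢c′ ∘ back))
             (λ i → ≡.subst (λ x → A (suc i) x ≈ s * B (suc i) x + t * C (suc i) x)
                      (≡.sym (Fin.punchIn-punchOut j≢c)) (Ac (suc i)))) ⟩
      sign j * A zero j * (s * det (minorAt B j) + t * det (minorAt C j))
        ≈⟨ solve 6 (λ σ a s b t c → σ :* a :* (s :* b :+ t :* c) := s :* (σ :* a :* b) :+ t :* (σ :* a :* c))
             refl (sign j) (A zero j) s (det (minorAt B j)) t (det (minorAt C j)) ⟩
      s * (sign j * A zero j * det (minorAt B j)) + t * (sign j * A zero j * det (minorAt C j))
        ≈⟨ +-cong (*-congˡ (*-congʳ (*-congˡ (A≈B zero j j≢c)))) (*-congˡ (*-congʳ (*-congˡ (A≈C zero j j≢c)))) ⟩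
      s * termOf B j + t * termOf C j ∎
      where
      c′ = punchOut j≢c
      back : ∀ {l} → punchIn j l ≡ c → l ≡ c′
      back eq = Fin.punchIn-injective j _ _ (≡.trans eq (≡.sym (Fin.punchIn-punchOut j≢c)))

  sign-next : ∀ {n} {i j : Fin n} → Next i j → sign j ≈ - sign i
  sign-next here        = refl
  sign-next (there nxt) = -‿cong (sign-next nxt)

  -- The terms of `c` and `d` have equal minors and opposite signs; each remaining minor still
  -- contains both columns, and they are still neighbours.
  det-equal-next-columns : ∀ {n} (A : Matrix n n) {c d} → Next c d → (∀ i → A i c ≈ A i d) → det A ≈ 0#
  det-equal-next-columns {suc n} A {c} {d} nxt Ac≈Ad = sum-next nxt cancel vanish
    where
    minorAt : Fin (suc n) → Matrix n n
    minorAt j i l = A (suc i) (punchIn j l)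
    minors : minorAt c ≈ₘ minorAt d
    minors i l with punchIn-next nxt l
    ... | inj₁ eq         = reflexive (≡.cong (A (suc i)) eq)
    ... | inj₂ (eq , eq′) = begin
      A (suc i) (punchIn c l)  ≡⟨ ≡.cong (A (suc i)) eq ⟩
      A (suc i) d              ≈⟨ Ac≈Ad (suc i) ⟨
      A (suc i) c              ≡⟨ ≡.cong (A (suc i)) eq′ ⟨
      A (suc i) (punchIn d l)  ∎
    cancel : sign c * A zero c * det (minorAt c) + sign d * A zero d * det (minorAt d) ≈ 0#
    cancel = begin
      σ * A zero c * det (minorAt c) + sign d * A zero d * det (minorAt d)
        ≈⟨ +-cong (*-cong (*-congˡ (Ac≈Ad zero)) (det-cong minors)) (*-congʳ (*-congʳ (sign-next nxt))) ⟩
      σ * x * y + - σ * x * y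
        ≈⟨ solve 3 (λ σ x y → σ :* x :* y :+ :- σ :* x :* y := σ :+ :- σ) refl σ x y ⟩
      σ - σ
        ≈⟨ -‿inverseʳ σ ⟩
      0# ∎
      where
      σ = sign c
      x = A zero d
      y = det (minorAt d)
    vanish : ∀ k → k ≢ c → k ≢ d → sign k * A zero k * det (minorAt k) ≈ 0#
    vanish k k≢c k≢d with next-punchIn nxt k k≢c k≢d
    ... | c′ , d′ , nxt′ , eq , eq′ =
      annihilateʳ (det-equal-next-columns (minorAt k) nxt′ λ i → begin
               A (suc i) (punchIn k c′)  ≡⟨ ≡.cong (A (suc i)) eq ⟩
               A (suc i) c               ≈⟨ Ac≈Ad (suc i) ⟩
               A (suc i) d               ≡⟨ ≡.cong (A (suc i)) eq′ ⟨
               A (suc i) (punchIn k d′)  ∎)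

  -- The number of rows and the width are independent, since fixing a row with `slice` lowers only
  -- the former. Vanishing is demanded for neighbouring rows alone; `vanish-head` recovers distant
  -- ones.
  record IsAlternating {n d} (f : Matrix n d → Carrier) : Set (a ⊔ ℓ) where
    field
      cong   : ∀ {A B} → A ≈ₘ B → f A ≈ f B
      linear : ∀ A B C i s t →
               (∀ i′ → i′ ≢ i → ∀ j → A i′ j ≈ B i′ j) → (∀ i′ → i′ ≢ i → ∀ j → A i′ j ≈ C i′ j) →
               (∀ j → A i j ≈ s * B i j + t * C i j) → f A ≈ s * f B + t * f C
      alternating : ∀ A {i i′} → Next i i′ → (∀ j → A i j ≈ A i′ j) → f A ≈ 0#

  open IsAlternating

  ◂-η : ∀ {n d} (A : Matrix (suc n) d) → A ≈ₘ (A zero ◂ tail A)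
  ◂-η A zero    j = refl
  ◂-η A (suc i) j = refl

  ◂-cong : ∀ {n d} {u v : Vector Carrier d} {A B : Matrix n d} →
           (∀ j → u j ≈ v j) → A ≈ₘ B → (u ◂ A) ≈ₘ (v ◂ B)
  ◂-cong u≈v A≈B zero    = u≈v
  ◂-cong u≈v A≈B (suc i) = A≈B i

  slice : ∀ {n d} {f : Matrix (suc n) d → Carrier} → IsAlternating f →
          ∀ v → IsAlternating (λ A → f (v ◂ A))
  slice alt v .cong A≈B = cong alt (◂-cong (λ _ → refl) A≈B)
  slice alt v .linear A B C i s t A≈B A≈C Ai =
    linear alt (v ◂ A) (v ◂ B) (v ◂ C) (suc i) s t
      (λ { zero _ j → refl ; (suc i′) i′≢i → A≈B i′ (i′≢i ∘ ≡.cong suc) })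
      (λ { zero _ j → refl ; (suc i′) i′≢i → A≈C i′ (i′≢i ∘ ≡.cong suc) })
      Ai
  slice alt v .alternating A nxt = alternating alt (v ◂ A) (there nxt)

  module _ {n d} {f : Matrix (suc n) d → Carrier} (alt : IsAlternating f) where

    linear-head : ∀ s t (u v : Vector Carrier d) (A : Matrix n d) →
                  f ((λ j → s * u j + t * v j) ◂ A) ≈ s * f (u ◂ A) + t * f (v ◂ A)
    linear-head s t u v A = linear alt _ _ _ zero s t
      (λ { zero 0≢0 → contradiction ≡.refl 0≢0 ; (suc i) _ j → refl })
      (λ { zero 0≢0 → contradiction ≡.refl 0≢0 ; (suc i) _ j → refl })
      (λ j → refl)

    head-zero : ∀ (A : Matrix n d) → f ((λ _ → 0#) ◂ A) ≈ 0#
    head-zero A = begin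
      f (o ◂ A)                          ≈⟨ cong alt (◂-cong (λ j → sym (+-dropˡ (zeroˡ 0#) (zeroˡ 0#))) λ _ _ → refl) ⟩
      f ((λ j → 0# * o j + 0# * o j) ◂ A)  ≈⟨ linear-head 0# 0# o o A ⟩
      0# * f (o ◂ A) + 0# * f (o ◂ A)    ≈⟨ +-cong (zeroˡ _) (zeroˡ _) ⟩
      0# + 0#                            ≈⟨ +-identityˡ 0# ⟩
      0#                                 ∎
      where
      o : Vector Carrier d
      o _ = 0#

    sum-head : ∀ {k} (x : Vector Carrier k) (b : Matrix k d) (A : Matrix n d) →
               f ((λ j → sum λ i → x i * b i j) ◂ A) ≈ sum λ i → x i * f (b i ◂ A)
    sum-head {zero}  x b A = head-zero A
    sum-head {suc k} x b A = begin
      f ((λ j → x zero * b zero j + rest j) ◂ A)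
        ≈⟨ cong alt (◂-cong (λ j → +-congˡ (sym (*-identityˡ _))) λ _ _ → refl) ⟩
      f ((λ j → x zero * b zero j + 1# * rest j) ◂ A)
        ≈⟨ linear-head (x zero) 1# (b zero) rest A ⟩
      x zero * f (b zero ◂ A) + 1# * f (rest ◂ A)
        ≈⟨ +-congˡ (trans (*-identityˡ _) (sum-head (x ∘ suc) (b ∘ suc) A)) ⟩
      x zero * f (b zero ◂ A) + sum (λ i → x (suc i) * f (b (suc i) ◂ A)) ∎
      where
      rest : Vector Carrier d
      rest j = sum λ i → x (suc i) * b (suc i) j

  -- Polarisation: expand the vanishing value of `f` at two leading rows `u + v`.
  swap-heads : ∀ {n d} {f : Matrix (suc (suc n)) d → Carrier} → IsAlternating f →
               ∀ u v A → f (u ◂ v ◂ A) ≈ - f (v ◂ u ◂ A)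
  swap-heads {n} {d} {f} alt u v A = begin
    f (u ◂ v ◂ A)
      ≈⟨ +-identityʳ _ ⟨
    p + 0#
      ≈⟨ +-congˡ (-‿inverseʳ q) ⟨
    p + (q - q)
      ≈⟨ +-assoc _ _ _ ⟨
    p + q - q
      ≈⟨ +-congʳ p+q≈0 ⟩
    0# - q
      ≈⟨ +-identityˡ _ ⟩
    - q ∎
    where
    p = f (u ◂ v ◂ A)
    q = f (v ◂ u ◂ A)
    w : Vector Carrier d
    w j = 1# * u j + 1# * v j
    expand : ∀ x → f (x ◂ w ◂ A) ≈ f (x ◂ u ◂ A) + f (x ◂ v ◂ A)
    expand x = trans (linear-head (slice alt x) 1# 1# u v A) (+-cong (*-identityˡ _) (*-identityˡ _))
    equal : ∀ x → f (x ◂ x ◂ A) ≈ 0#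
    equal x = alternating alt _ here λ j → refl
    p+q≈0 : p + q ≈ 0#
    p+q≈0 = begin
      p + q
        ≈⟨ +-cong (+-dropˡ (equal u) refl) (+-dropʳ refl (equal v)) ⟨
      f (u ◂ u ◂ A) + p + (q + f (v ◂ v ◂ A))
        ≈⟨ +-cong (expand u) (expand v) ⟨
      f (u ◂ w ◂ A) + f (v ◂ w ◂ A)
        ≈⟨ +-cong (*-identityˡ _) (*-identityˡ _) ⟨
      1# * f (u ◂ w ◂ A) + 1# * f (v ◂ w ◂ A)
        ≈⟨ linear-head alt 1# 1# u v (w ◂ A) ⟨
      f (w ◂ w ◂ A)
        ≈⟨ equal w ⟩
      0# ∎

  vanish-head : ∀ {n d} {f : Matrix (suc n) d → Carrier} → IsAlternating f →
                ∀ v A i → (∀ j → A i j ≈ v j) → f (v ◂ A) ≈ 0#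
  vanish-head {f = f} alt v A zero    Ai≈v = alternating alt _ here (sym ∘ Ai≈v)
  vanish-head {f = f} alt v A (suc i) Ai≈v = begin
    f (v ◂ A)                          ≈⟨ cong alt (◂-cong (λ _ → refl) (◂-η A)) ⟩
    f (v ◂ A zero ◂ tail A)           ≈⟨ swap-heads alt v (A zero) (tail A) ⟩
    - f (A zero ◂ v ◂ tail A)         ≈⟨ -‿cong (vanish-head (slice alt (A zero)) v (tail A) i Ai≈v) ⟩
    - 0#                               ≈⟨ -0#≈0# ⟩
    0#                                 ∎

  -- The vector `v` is not a row of `A`: it stands for a row already fixed by `slice`, and the third
  -- argument records that repeating it kills `f`.
  add-multiples : ∀ {n d} {f : Matrix n d → Carrier} → IsAlternating f → ∀ (v : Vector Carrier d) →
                  (∀ A i → (∀ j → A i j ≈ v j) → f A ≈ 0#) →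
                  ∀ A B (t : Vector Carrier n) → (∀ i j → B i j ≈ A i j + t i * v j) → f B ≈ f A
  add-multiples {zero}  alt v kill A B t B≈ = cong alt λ ()
  add-multiples {suc n} {f = f} alt v kill A B t B≈ = begin
    f B
      ≈⟨ cong alt (λ { zero j → trans (B≈ zero j) (+-congʳ (sym (*-identityˡ _))) ; (suc i) j → refl }) ⟩
    f ((λ j → 1# * A zero j + t zero * v j) ◂ tail B)
      ≈⟨ linear-head alt 1# (t zero) (A zero) v (tail B) ⟩
    1# * f (A zero ◂ tail B) + t zero * f (v ◂ tail B)
      ≈⟨ +-cong (*-identityˡ _) (annihilateʳ (kill _ zero λ _ → refl)) ⟩
    f (A zero ◂ tail B) + 0#
      ≈⟨ +-identityʳ _ ⟩
    f (A zero ◂ tail B)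
      ≈⟨ add-multiples (slice alt (A zero)) v (λ C i → kill _ (suc i)) (tail A) (tail B) (tail t) (λ i → B≈ (suc i)) ⟩
    f (A zero ◂ tail A)
      ≈⟨ cong alt (◂-η A) ⟨
    f A ∎

  move-head : ∀ {n d} {f : Matrix (suc n) d → Carrier} → IsAlternating f →
              ∀ A j → f (A j ◂ removeAt A j) ≈ sign j * f A
  move-head {n = n} {f = f} alt A zero = trans (sym (cong alt (◂-η A))) (sym (*-identityˡ _))
  move-head {n = suc n} {f = f} alt A (suc j) = begin
    f (A (suc j) ◂ removeAt A (suc j))
      ≈⟨ cong alt (◂-cong (λ _ → refl) (◂-η _)) ⟩
    f (A (suc j) ◂ A zero ◂ removeAt (tail A) j)
      ≈⟨ swap-heads alt _ _ _ ⟩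
    - f (A zero ◂ A (suc j) ◂ removeAt (tail A) j)
      ≈⟨ -‿cong (move-head (slice alt (A zero)) (tail A) j) ⟩
    - (sign j * f (A zero ◂ tail A))
      ≈⟨ -‿distribˡ-* _ _ ⟩
    - sign j * f (A zero ◂ tail A)
      ≈⟨ *-congˡ (cong alt (◂-η A)) ⟨
    - sign j * f A ∎

  insert-cases : ∀ {n p} (P : Fin (suc n) → Set p) j → P j → (∀ l → P (punchIn j l)) → ∀ l → P l
  insert-cases P j Pj Pin l with j Fin.≟ l
  ... | yes ≡.refl = Pj
  ... | no  j≢l    = ≡.subst P (Fin.punchIn-punchOut j≢l) (Pin (punchOut j≢l))

  insertColumn : ∀ {m n} → Fin (suc n) → Matrix m n → Matrix m (suc n)
  insertColumn j A i = insertAt (A i) j 0#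

  -- Supplies the induction step of `alternating-unique`: once the first row is a unit vector and
  -- its column is cleared elsewhere, `f` is an alternating function of the smaller minor.
  alternating-insertColumn : ∀ {m n} {f : Matrix m (suc n) → Carrier} j → IsAlternating f →
                             IsAlternating (f ∘ insertColumn j)
  alternating-insertColumn {n = n} {f} j alt = record
    { cong        = λ {A} {B} A≈B → cong alt λ i → lift₂ (A i) (B i) (A≈B i)
    ; linear      = λ A B C i s t A≈B A≈C Ai →
        linear alt (insertColumn j A) (insertColumn j B) (insertColumn j C) i s t
          (λ i′ i′≢i → lift₂ (A i′) (B i′) (A≈B i′ i′≢i)) (λ i′ i′≢i → lift₂ (A i′) (C i′) (A≈C i′ i′≢i))
          (λ l → insert-cases
            (λ l → insertAt (A i) j 0# l ≈ s * insertAt (B i) j 0# l + t * insertAt (C i) j 0# l) j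
            (trans (at-j (A i)) (sym (begin
              s * insertAt (B i) j 0# j + t * insertAt (C i) j 0# j
                ≈⟨ +-cong (*-congˡ (at-j (B i))) (*-congˡ (at-j (C i))) ⟩
              s * 0# + t * 0#
                ≈⟨ +-cong (zeroʳ s) (zeroʳ t) ⟩
              0# + 0#
                ≈⟨ +-identityˡ 0# ⟩
              0# ∎)))
            (λ k → trans (off-j (A i) k) (trans (Ai k)
              (+-cong (*-congˡ (sym (off-j (B i) k))) (*-congˡ (sym (off-j (C i) k)))))) l)
    ; alternating = λ A nxt Ai≈Ai′ → alternating alt _ nxt (lift₂ (A _) (A _) Ai≈Ai′)
    }
    where
    at-j : ∀ (v : Vector Carrier n) → insertAt v j 0# j ≈ 0#
    at-j v = reflexive (insertAt-lookup v j 0#)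
    off-j : ∀ (v : Vector Carrier n) l → insertAt v j 0# (punchIn j l) ≈ v l
    off-j v l = reflexive (insertAt-punchIn v j 0# l)
    lift₂ : ∀ (u v : Vector Carrier n) → (∀ l → u l ≈ v l) → ∀ l → insertAt u j 0# l ≈ insertAt v j 0# l
    lift₂ u v u≈v = insert-cases (λ l → insertAt u j 0# l ≈ insertAt v j 0# l) j
      (trans (at-j u) (sym (at-j v)))
      (λ l → trans (off-j u l) (trans (u≈v l) (sym (off-j v l))))

  -- Writing the first row in unit vectors reduces to a first row `δ k`. Multiples of it clear
  -- column `k` below, induction extracts the determinant of the minor, and the value left over is
  -- that of `δ` with row `k` moved to the front, which accounts for `sign k`. Transposition,
  -- products and block triangular determinants are all consequences.
  alternating-unique : ∀ {n} {f : Matrix n n → Carrier} → IsAlternating f → ∀ A → f A ≈ f δ * det A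
  alternating-unique {zero}  alt A = trans (cong alt λ ()) (sym (*-identityʳ _))
  alternating-unique {suc n} {f} alt A = begin
    f A
      ≈⟨ cong alt (◂-η A) ⟩
    f (A zero ◂ tail A)
      ≈⟨ cong alt (◂-cong (λ j → sym (sum-δʳ j (A zero))) λ _ _ → refl) ⟩
    f ((λ j → sum λ k → A zero k * δ k j) ◂ tail A)
      ≈⟨ sum-head alt (A zero) δ (tail A) ⟩
    sum (λ k → A zero k * f (δ k ◂ tail A))
      ≈⟨ sum-cong-≋ term ⟩
    sum (λ k → f δ * (sign k * A zero k * det (minorAt k)))
      ≈⟨ *-distribˡ-sum (f δ) (λ k → sign k * A zero k * det (minorAt k)) ⟨
    f δ * det A ∎
    where
    minorAt : Fin (suc n) → Matrix n n
    minorAt k i l = A (suc i) (punchIn k l)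

    clear : ∀ k → f (δ k ◂ tail A) ≈ f (δ k ◂ insertColumn k (minorAt k))
    clear k = add-multiples (slice alt (δ k)) (δ k)
      (λ B i → vanish-head alt (δ k) B i)
      (insertColumn k (minorAt k)) (tail A) (λ i → A (suc i) k)
      (λ i j → insert-cases
        (λ j → A (suc i) j ≈ insertColumn k (minorAt k) i j + A (suc i) k * δ k j) k
        (sym (+-dropˡ (reflexive (insertAt-lookup (minorAt k i) k 0#))
                            (trans (*-congˡ (δ-diag k)) (*-identityʳ _))))
        (λ l → sym (+-dropʳ (reflexive (insertAt-punchIn (minorAt k i) k 0# l))
                                  (annihilateʳ (δ-off (Fin.punchInᵢ≢i k l ∘ ≡.sym))))) j)

    identity : ∀ k → f (δ k ◂ insertColumn k δ) ≈ sign k * f δ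
    identity k = trans (cong alt (◂-cong (λ _ → refl) λ i j → insert-cases
        (λ j → insertColumn k δ i j ≈ δ (punchIn k i) j) k
        (trans (reflexive (insertAt-lookup (δ i) k 0#)) (sym (δ-off (Fin.punchInᵢ≢i k i))))
        (λ l → trans (reflexive (insertAt-punchIn (δ i) k 0# l))
                     (sym (δ-injection (Fin.punchIn-injective k _ _) i l))) j))
      (move-head alt δ k)

    term : ∀ k → A zero k * f (δ k ◂ tail A) ≈ f δ * (sign k * A zero k * det (minorAt k))
    term k = begin
      A zero k * f (δ k ◂ tail A)
        ≈⟨ *-congˡ (clear k) ⟩
      A zero k * f (δ k ◂ insertColumn k (minorAt k))
        ≈⟨ *-congˡ (alternating-unique (alternating-insertColumn k (slice alt (δ k))) (minorAt k)) ⟩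
      A zero k * (f (δ k ◂ insertColumn k δ) * det (minorAt k))
        ≈⟨ *-congˡ (*-congʳ (identity k)) ⟩
      A zero k * (sign k * f δ * det (minorAt k))
        ≈⟨ solve 4 (λ x σ y d → x :* (σ :* y :* d) := y :* (σ :* x :* d)) refl
             (A zero k) (sign k) (f δ) (det (minorAt k)) ⟩
      f δ * (sign k * A zero k * det (minorAt k)) ∎

  -- The column properties of `det` say that `det ∘ flip` is alternating in the rows, so uniqueness
  -- applies.
  det-transpose : ∀ {n} (A : Matrix n n) → det (flip A) ≈ det A
  det-transpose {n} A = begin
    det (flip A)                 ≈⟨ alternating-unique alt A ⟩
    det (flip (δ {n})) * det A   ≈⟨ *-congʳ (trans (det-cong {n} {flip δ} {δ} λ i j → δ-sym j i) (det-δ n)) ⟩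
    1# * det A                   ≈⟨ *-identityˡ _ ⟩
    det A                        ∎
    where
    alt : IsAlternating {n} {n} (det ∘ flip)
    alt = record
      { cong        = λ A≈B → det-cong λ i j → A≈B j i
      ; linear      = λ A B C c s t A≈B A≈C → det-linear-column (flip A) (flip B) (flip C) c s t
                        (λ i j j≢c → A≈B j j≢c i) (λ i j j≢c → A≈C j j≢c i)
      ; alternating = λ A → det-equal-next-columns (flip A)
      }

  det-alternating : ∀ {n} → IsAlternating (det {n})
  det-alternating = record
    { cong        = det-cong
    ; linear      = λ A B C r s t A≈B A≈C Ar → begin
        det A                                ≈⟨ det-transpose A ⟨
        det (flip A)                         ≈⟨ det-linear-column (flip A) (flip B) (flip C) r s t
                                                  (λ i j j≢r → A≈B j j≢r i) (λ i j j≢r → A≈C j j≢r i) Ar ⟩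
        s * det (flip B) + t * det (flip C)  ≈⟨ +-cong (*-congˡ (det-transpose B)) (*-congˡ (det-transpose C)) ⟩
        s * det B + t * det C                ∎
    ; alternating = λ A nxt Ai≈Ai′ → trans (sym (det-transpose A)) (det-equal-next-columns (flip A) nxt Ai≈Ai′)
    }

  det-∙ : ∀ {n} (A B : Matrix n n) → det (A ∙ B) ≈ det A * det B
  det-∙ {n} A B = begin
    det (A ∙ B)            ≈⟨ alternating-unique alt A ⟩
    det (δ ∙ B) * det A    ≈⟨ *-congʳ (det-cong λ i j → sum-δˡ i λ k → B k j) ⟩
    det B * det A          ≈⟨ *-comm _ _ ⟩
    det A * det B          ∎
    where
    alt : IsAlternating {n} {n} (λ A → det (A ∙ B))
    alt = record
      { cong        = λ A≈A′ → det-cong λ i j → sum-cong-≋ λ k → *-congʳ (A≈A′ i k)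
      ; linear      = λ X Y Z i s t X≈Y X≈Z Xi → linear det-alternating (X ∙ B) (Y ∙ B) (Z ∙ B) i s t
          (λ i′ i′≢i j → sum-cong-≋ λ k → *-congʳ (X≈Y i′ i′≢i k))
          (λ i′ i′≢i j → sum-cong-≋ λ k → *-congʳ (X≈Z i′ i′≢i k))
          (λ j → trans (sum-cong-≋ λ k → trans (*-congʳ (Xi k))
                   (solve 5 (λ s y t z b → (s :* y :+ t :* z) :* b := s :* (y :* b) :+ t :* (z :* b))
                      refl s (Y i k) t (Z i k) (B k j)))
                 (sum-linear s t (λ k → Y i k * B k j) (λ k → Z i k * B k j)))
      ; alternating = λ X nxt Xi≈Xi′ → alternating det-alternating (X ∙ B) nxt
          λ j → sum-cong-≋ λ k → *-congʳ (Xi≈Xi′ k)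
      }

-- Matrices over enumerated index sets and block determinants.

infixr 5 _⊕_
_⊕_ : ∀ {m n} {α β : Set} → Fin m ↔ α → Fin n ↔ β → Fin (m ℕ.+ n) ↔ (α ⊎ β)
e₁ ⊕ e₂ = (e₁ ⊎-↔ e₂) ↔-∘ Fin.+↔⊎

fins : ∀ n → Fin n ↔ Fin n
fins n = record { to = id ; from = id ; to-cong = id ; from-cong = id ; inverse = id , id }

next-↑ˡ : ∀ {m} n {i j : Fin m} → Next i j → Next (i ↑ˡ n) (j ↑ˡ n)
next-↑ˡ n here        = here
next-↑ˡ n (there nxt) = there (next-↑ˡ n nxt)

module EnumeratedMatrices {a ℓ} (R : CommutativeRing a ℓ) where
  open CommutativeRing R hiding (zero)
  open LinearAlgebra R
  open Determinants R
  open SemiringSums semiring using (sum-cong-≋; ∑-distrib-+; ∑-comm; ∑-permute; *-distribˡ-sum; *-distribʳ-sum)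
  open RingProperties ring using (-‿distribʳ-*; -1*x≈-x)
  open IntegerMultiples R using (module Solver)
  open Solver using (solve; _:*_; :-_; _:=_)
  open SetoidReasoning setoid

  sign² : ∀ {n} (i : Fin n) → sign i * sign i ≈ 1#
  sign² zero    = *-identityˡ 1#
  sign² (suc i) = trans (solve 1 (λ s → :- s :* :- s := s :* s) refl (sign i)) (sign² i)

  -- A cofactor is written as the determinant with row `j` replaced by a unit row. The replacement
  -- stands in front, and `sign j` moves it back into place.
  adjugate : ∀ {n} → Matrix n n → Matrix n n
  adjugate {suc n} A k j = sign j * det (δ k ◂ removeAt A j)

  -- By linearity in the leading row, the product is the determinant with row `j` replaced by row
  -- `i`: either `A` itself or a matrix with a repeated row.
  ∙-adjugate : ∀ {n} (A : Matrix n n) → A ∙ adjugate A ≈ₘ (λ i j → δ i j * det A)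
  ∙-adjugate {suc n} A i j = begin
    sum (λ k → A i k * (sign j * det (δ k ◂ removeAt A j)))
      ≈⟨ sum-cong-≋ {suc n} (λ k → solve 3 (λ x s d → x :* (s :* d) := s :* (x :* d)) refl
           (A i k) (sign j) (det (δ k ◂ removeAt A j))) ⟩
    sum (λ k → sign j * (A i k * det (δ k ◂ removeAt A j)))
      ≈⟨ *-distribˡ-sum {suc n} (sign j) (λ k → A i k * det (δ k ◂ removeAt A j)) ⟨
    sign j * sum (λ k → A i k * det (δ k ◂ removeAt A j))
      ≈⟨ *-congˡ (sum-head det-alternating (A i) δ (removeAt A j)) ⟨
    sign j * det ((λ l → sum λ k → A i k * δ k l) ◂ removeAt A j)
      ≈⟨ *-congˡ (det-cong (◂-cong {B = removeAt A j} (λ l → sum-δʳ l (A i)) λ _ _ → refl)) ⟩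
    sign j * det (A i ◂ removeAt A j)
      ≈⟨ replaced ⟩
    δ i j * det A ∎
    where
    replaced : sign j * det (A i ◂ removeAt A j) ≈ δ i j * det A
    replaced with i Fin.≟ j
    ... | yes ≡.refl = trans (*-congˡ (move-head det-alternating A j))
                             (trans (sym (*-assoc _ _ _)) (*-congʳ (sign² j)))
    ... | no  i≢j    = trans (*-congˡ (vanish-head det-alternating (A i) (removeAt A j) (punchOut (i≢j ∘ ≡.sym))
                               λ l → reflexive (≡.cong (λ k → A k l) (Fin.punchIn-punchOut (i≢j ∘ ≡.sym)))))
                             (trans (zeroʳ _) (sym (zeroˡ _)))

  -- Index sets stay abstract and an enumeration enters only when a sum or a determinant is formed,
  -- so blocks are glued along disjoint sums without arithmetic on positions.
  Mat : Set → Set → Set a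
  Mat α β = α → β → Carrier

  block : ∀ {α β γ ε} → Mat α γ → Mat α ε → Mat β γ → Mat β ε → Mat (α ⊎ β) (γ ⊎ ε)
  block A B C D (inj₁ x) (inj₁ y) = A x y
  block A B C D (inj₁ x) (inj₂ y) = B x y
  block A B C D (inj₂ x) (inj₁ y) = C x y
  block A B C D (inj₂ x) (inj₂ y) = D x y

  O : ∀ {α β} → Mat α β
  O _ _ = 0#

  private
    sum-splitAt : ∀ m {n} (f : Fin m ⊎ Fin n → Carrier) →
                  sum (f ∘ splitAt m) ≈ sum (f ∘ inj₁) + sum (f ∘ inj₂)
    sum-splitAt zero    f = sym (+-identityˡ _)
    sum-splitAt (suc m) {n} f = begin
      f (inj₁ zero) + sum (λ i → f (Sum.map suc id (splitAt m i)))
        ≈⟨ +-congˡ (sum-splitAt m (f ∘ Sum.map suc id)) ⟩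
      f (inj₁ zero) + (sum (λ i → f (inj₁ (suc i))) + sum (f ∘ inj₂))
        ≈⟨ +-assoc _ _ _ ⟨
      f (inj₁ zero) + sum (λ i → f (inj₁ (suc i))) + sum (f ∘ inj₂) ∎

    split : ∀ {m n} → Mat (Fin m ⊎ Fin n) (Fin m ⊎ Fin n) → Matrix (m ℕ.+ n) (m ℕ.+ n)
    split {m} A i j = A (splitAt m i) (splitAt m j)

    det-block-δ : ∀ m {n} (C : Mat (Fin n) (Fin m)) (D : Matrix n n) → det (split (block δ O C D)) ≈ det D
    det-block-δ zero    C D = refl
    det-block-δ (suc m) {n} C D = begin
      1# * 1# * det (minorAt zero) + sum rest
        ≈⟨ +-cong (trans (*-congʳ (*-identityˡ 1#)) (*-identityˡ _)) (sum-zero {f = rest} rest≈0) ⟩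
      det (minorAt zero) + 0#
        ≈⟨ +-identityʳ _ ⟩
      det (minorAt zero)
        ≈⟨ det-cong (λ i j → shift (splitAt m i) (splitAt m j)) ⟩
      det (split (block δ O (λ x y → C x (suc y)) D))
        ≈⟨ det-block-δ m _ D ⟩
      det D ∎
      where
      A = split (block δ O C D)
      minorAt : Fin (suc (m ℕ.+ n)) → Matrix (m ℕ.+ n) (m ℕ.+ n)
      minorAt j i l = A (suc i) (punchIn j l)
      rest : Vector Carrier (m ℕ.+ n)
      rest j = sign (suc j) * A zero (suc j) * det (minorAt (suc j))
      entry : ∀ (y : Fin m ⊎ Fin n) → block δ O C D (inj₁ zero) (Sum.map suc id y) ≈ 0#
      entry (inj₁ _) = refl
      entry (inj₂ _) = refl
      rest≈0 : ∀ j → rest j ≈ 0#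
      rest≈0 j = annihilateˡ (annihilateʳ (entry (splitAt m j)))
      shift : ∀ x y → block δ O C D (Sum.map suc id x) (Sum.map suc id y) ≈ block δ O (λ x y → C x (suc y)) D x y
      shift (inj₁ x) (inj₁ y) = refl
      shift (inj₁ x) (inj₂ y) = refl
      shift (inj₂ x) (inj₁ y) = refl
      shift (inj₂ x) (inj₂ y) = refl

    -- The left side is alternating in the rows of `A`, because the block to the right of `A` is
    -- zero. Uniqueness then leaves only the case `A = δ`.
    det-block : ∀ {m n} (A : Matrix m m) (C : Mat (Fin n) (Fin m)) (D : Matrix n n) →
                det (split (block A O C D)) ≈ det A * det D
    det-block {m} {n} A C D = trans (alternating-unique alt A) (trans (*-congʳ (det-block-δ m C D)) (*-comm _ _))
      where
      open IsAlternating
      blk : Matrix m m → Mat (Fin m ⊎ Fin n) (Fin m ⊎ Fin n)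
      blk A = block A O C D
      other : ∀ {A B : Matrix m m} r → (∀ i → i ≢ r → ∀ j → A i j ≈ B i j) →
              ∀ i → i ≢ r ↑ˡ n → ∀ j → split (blk A) i j ≈ split (blk B) i j
      other r A≈B i i≢r j with splitAt m i in eq | splitAt m j
      ... | inj₁ x | inj₁ y = A≈B x (λ { ≡.refl → i≢r (≡.sym (Fin.splitAt⁻¹-↑ˡ eq)) }) y
      ... | inj₁ x | inj₂ y = refl
      ... | inj₂ x | inj₁ y = refl
      ... | inj₂ x | inj₂ y = refl
      alt : IsAlternating (λ A → det (split (blk A)))
      alt .cong {A} {B} A≈B = det-cong λ i j → pointwise (splitAt m i) (splitAt m j)
        where
        pointwise : ∀ x y → blk A x y ≈ blk B x y
        pointwise (inj₁ x) (inj₁ y) = A≈B x y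
        pointwise (inj₁ x) (inj₂ y) = refl
        pointwise (inj₂ x) (inj₁ y) = refl
        pointwise (inj₂ x) (inj₂ y) = refl
      alt .linear A B C′ r s t A≈B A≈C Ar =
        linear det-alternating _ _ _ (r ↑ˡ n) s t (other r A≈B) (other r A≈C) λ j → row j
        where
        row : ∀ j → split (blk A) (r ↑ˡ n) j ≈ s * split (blk B) (r ↑ˡ n) j + t * split (blk C′) (r ↑ˡ n) j
        row j rewrite Fin.splitAt-↑ˡ m r n with splitAt m j
        ... | inj₁ y = Ar y
        ... | inj₂ y = sym (+-dropˡ (zeroʳ s) (zeroʳ t))
      alt .alternating A {i} {i′} nxt Ai≈Ai′ = alternating det-alternating _ (next-↑ˡ n nxt) λ j → row j
        where
        row : ∀ j → split (blk A) (i ↑ˡ n) j ≈ split (blk A) (i′ ↑ˡ n) j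
        row j rewrite Fin.splitAt-↑ˡ m i n | Fin.splitAt-↑ˡ m i′ n with splitAt m j
        ... | inj₁ y = Ai≈Ai′ y
        ... | inj₂ y = refl

  open Inverse

  to-from : ∀ {n} {α : Set} (e : Fin n ↔ α) x → to e (from e x) ≡ x
  to-from e x = inverseˡ e ≡.refl

  from-to : ∀ {n} {α : Set} (e : Fin n ↔ α) i → from e (to e i) ≡ i
  from-to e i = inverseʳ e ≡.refl

  from-injective : ∀ {n} {α : Set} (e : Fin n ↔ α) {x y} → from e x ≡ from e y → x ≡ y
  from-injective e {x} {y} eq = ≡.trans (≡.sym (to-from e x)) (≡.trans (≡.cong (to e) eq) (to-from e y))

  enumerated-≟ : ∀ {n} {α : Set} (e : Fin n ↔ α) (x y : α) → Dec (x ≡ y)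
  enumerated-≟ e x y = map′ (from-injective e) (≡.cong (from e)) (from e x Fin.≟ from e y)

  opaque
    ∑ : ∀ {n} {α : Set} → Fin n ↔ α → (α → Carrier) → Carrier
    ∑ e f = sum λ i → f (to e i)

    Id : ∀ {n} {α : Set} → Fin n ↔ α → Mat α α
    Id e x y = δ (from e x) (from e y)

    -- Separate enumerations of rows and columns fix the value only up to a sign; with one
    -- enumeration on both sides the choice is immaterial, by `Det-reenumerate`.
    Det : ∀ {n} {α β : Set} → Fin n ↔ α → Fin n ↔ β → Mat α β → Carrier
    Det e₁ e₂ A = det λ i j → A (to e₁ i) (to e₂ j)

  mul : ∀ {n} {α β γ : Set} → Fin n ↔ β → Mat α β → Mat β γ → Mat α γ
  mul e A B x z = ∑ e λ y → A x y * B y z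

  module _ {n} {α : Set} (e : Fin n ↔ α) where
    opaque
      unfolding ∑ Id

      ∑-def : ∀ (f : α → Carrier) → ∑ e f ≡ sum λ i → f (to e i)
      ∑-def f = ≡.refl

      ∑-cong : ∀ {f g : α → Carrier} → (∀ x → f x ≈ g x) → ∑ e f ≈ ∑ e g
      ∑-cong f≈g = sum-cong-≋ {n} λ i → f≈g (to e i)

      ∑-zero : ∀ {f : α → Carrier} → (∀ x → f x ≈ 0#) → ∑ e f ≈ 0#
      ∑-zero {f} f≈0 = sum-zero {n} {λ i → f (to e i)} λ i → f≈0 (to e i)

      ∑-+ : ∀ (f g : α → Carrier) → ∑ e (λ x → f x + g x) ≈ ∑ e f + ∑ e g
      ∑-+ f g = ∑-distrib-+ {n} (λ i → f (to e i)) (λ i → g (to e i))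

      ∑-*ˡ : ∀ s (f : α → Carrier) → s * ∑ e f ≈ ∑ e (λ x → s * f x)
      ∑-*ˡ s f = *-distribˡ-sum {n} s (λ i → f (to e i))

      ∑-*ʳ : ∀ (f : α → Carrier) s → ∑ e f * s ≈ ∑ e (λ x → f x * s)
      ∑-*ʳ f s = *-distribʳ-sum {n} s (λ i → f (to e i))

      ∑-swap : ∀ {m} {β : Set} (e′ : Fin m ↔ β) (f : α → β → Carrier) →
               ∑ e (λ x → ∑ e′ (f x)) ≈ ∑ e′ (λ y → ∑ e λ x → f x y)
      ∑-swap {m} e′ f = ∑-comm {n} {m} λ i j → f (to e i) (to e′ j)

      ∑-⊕ : ∀ {m} {β : Set} (e′ : Fin m ↔ β) (f : α ⊎ β → Carrier) →
            ∑ (e ⊕ e′) f ≈ ∑ e (f ∘ inj₁) + ∑ e′ (f ∘ inj₂)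
      ∑-⊕ e′ f = sum-splitAt n (f ∘ Sum.map (to e) (to e′))

      ∑-reenumerate : ∀ {m} (e′ : Fin m ↔ α) (f : α → Carrier) → ∑ e f ≈ ∑ e′ f
      ∑-reenumerate {m} e′ f = trans (∑-permute (λ i → f (to e i)) (↔-sym e ↔-∘ e′))
        (sum-cong-≋ {m} λ i → reflexive (≡.cong f (to-from e (to e′ i))))

      Id-diag : ∀ x → Id e x x ≈ 1#
      Id-diag x = δ-diag (from e x)

      Id-off : ∀ {x y} → x ≢ y → Id e x y ≈ 0#
      Id-off x≢y = δ-off (x≢y ∘ from-injective e)

      ∑-Idˡ : ∀ x (f : α → Carrier) → ∑ e (λ y → Id e x y * f y) ≈ f x
      ∑-Idˡ x f = begin
        sum (λ i → δ (from e x) (from e (to e i)) * f (to e i))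
          ≈⟨ sum-cong-≋ {n} (λ i → *-congʳ (reflexive (≡.cong (δ (from e x)) (from-to e i)))) ⟩
        sum (λ i → δ (from e x) i * f (to e i))
          ≈⟨ sum-δˡ (from e x) (λ i → f (to e i)) ⟩
        f (to e (from e x))
          ≡⟨ ≡.cong f (to-from e x) ⟩
        f x ∎

    Id-sym : ∀ x y → Id e x y ≈ Id e y x
    Id-sym x y with enumerated-≟ e x y
    ... | yes ≡.refl = refl
    ... | no  x≢y    = trans (Id-off x≢y) (sym (Id-off (x≢y ∘ ≡.sym)))

    ∑-Idʳ : ∀ x (f : α → Carrier) → ∑ e (λ y → f y * Id e y x) ≈ f x
    ∑-Idʳ x f = trans (∑-cong λ y → trans (*-comm _ _) (*-congʳ (Id-sym y x))) (∑-Idˡ x f)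

    ∑-neg : ∀ (f : α → Carrier) → ∑ e (λ x → - f x) ≈ - ∑ e f
    ∑-neg f = trans (∑-cong λ x → sym (-1*x≈-x (f x))) (trans (sym (∑-*ˡ (- 1#) f)) (-1*x≈-x _))

  ∑-*-difference : ∀ {n} {α : Set} (e : Fin n ↔ α) (z f g : α → Carrier) →
                   ∑ e (λ x → z x * (f x - g x)) ≈ ∑ e (λ x → z x * f x) - ∑ e (λ x → z x * g x)
  ∑-*-difference e z f g = begin
    ∑ e (λ x → z x * (f x - g x))
      ≈⟨ ∑-cong e (λ x → trans (distribˡ _ _ _) (+-congˡ (sym (-‿distribʳ-* _ _)))) ⟩
    ∑ e (λ x → z x * f x + - (z x * g x))
      ≈⟨ ∑-+ e _ _ ⟩
    ∑ e (λ x → z x * f x) + ∑ e (λ x → - (z x * g x))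
      ≈⟨ +-congˡ (∑-neg e _) ⟩
    ∑ e (λ x → z x * f x) - ∑ e (λ x → z x * g x) ∎

  Id-injection : ∀ {m n} {α β : Set} (e : Fin m ↔ α) (e′ : Fin n ↔ β) {f : α → β} →
                 (∀ {x y} → f x ≡ f y → x ≡ y) → ∀ x y → Id e′ (f x) (f y) ≈ Id e x y
  Id-injection e e′ f-injective x y with enumerated-≟ e x y
  ... | yes ≡.refl = trans (Id-diag e′ _) (sym (Id-diag e x))
  ... | no  x≢y    = trans (Id-off e′ (x≢y ∘ f-injective)) (sym (Id-off e x≢y))

  opaque
    unfolding Id

    Id-fins : ∀ {n} (i j : Fin n) → Id (fins n) i j ≈ δ i j
    Id-fins i j = refl

  module _ {n} {α β : Set} (e₁ : Fin n ↔ α) (e₂ : Fin n ↔ β) where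
    opaque
      unfolding Det ∑ Id

      Det-def : ∀ (A : Mat α β) → Det e₁ e₂ A ≡ det λ i j → A (to e₁ i) (to e₂ j)
      Det-def A = ≡.refl

      Det-cong : ∀ {A B : Mat α β} → (∀ x y → A x y ≈ B x y) → Det e₁ e₂ A ≈ Det e₁ e₂ B
      Det-cong A≈B = det-cong λ i j → A≈B (to e₁ i) (to e₂ j)

      Det-transpose : ∀ (A : Mat α β) → Det e₁ e₂ A ≈ Det e₂ e₁ (flip A)
      Det-transpose A = sym (det-transpose λ i j → A (to e₁ i) (to e₂ j))

      Det-mul : ∀ {γ : Set} (e₃ : Fin n ↔ γ) (A : Mat α β) (B : Mat β γ) →
                Det e₁ e₃ (mul e₂ A B) ≈ Det e₁ e₂ A * Det e₂ e₃ B
      Det-mul e₃ A B = det-∙ (λ i j → A (to e₁ i) (to e₂ j)) (λ i j → B (to e₂ i) (to e₃ j))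

      Det-block : ∀ {m} {γ ε : Set} (e₃ : Fin m ↔ γ) (e₄ : Fin m ↔ ε) (A : Mat α β) (C : Mat γ β) (D : Mat γ ε) →
                  Det (e₁ ⊕ e₃) (e₂ ⊕ e₄) (block A O C D) ≈ Det e₁ e₂ A * Det e₃ e₄ D
      Det-block e₃ e₄ A C D = trans
        (det-cong λ i j → pointwise (splitAt n i) (splitAt n j))
        (det-block (λ i j → A (to e₁ i) (to e₂ j)) (λ i j → C (to e₃ i) (to e₂ j)) (λ i j → D (to e₃ i) (to e₄ j)))
        where
        pointwise : ∀ x y → block A O C D (Sum.map (to e₁) (to e₃) x) (Sum.map (to e₂) (to e₄) y) ≈
                    block (λ i j → A (to e₁ i) (to e₂ j)) O
                          (λ i j → C (to e₃ i) (to e₂ j)) (λ i j → D (to e₃ i) (to e₄ j)) x y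
        pointwise (inj₁ x) (inj₁ y) = refl
        pointwise (inj₁ x) (inj₂ y) = refl
        pointwise (inj₂ x) (inj₁ y) = refl
        pointwise (inj₂ x) (inj₂ y) = refl

      Adj : Mat α β → Mat β α
      Adj A y x = adjugate (λ i j → A (to e₁ i) (to e₂ j)) (from e₂ y) (from e₁ x)

      mul-Adj : ∀ (A : Mat α β) x x′ → mul e₂ A (Adj A) x x′ ≈ Id e₁ x x′ * Det e₁ e₂ A
      mul-Adj A x x′ = begin
        sum (λ j → A x (to e₂ j) * adjugate A′ (from e₂ (to e₂ j)) (from e₁ x′))
          ≈⟨ sum-cong-≋ {n} (λ j → *-cong (reflexive (≡.cong (λ z → A z (to e₂ j)) (≡.sym (to-from e₁ x))))
                              (reflexive (≡.cong (λ k → adjugate A′ k (from e₁ x′)) (from-to e₂ j)))) ⟩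
        sum (λ j → A′ (from e₁ x) j * adjugate A′ j (from e₁ x′))
          ≈⟨ ∙-adjugate A′ (from e₁ x) (from e₁ x′) ⟩
        δ (from e₁ x) (from e₁ x′) * det A′ ∎
        where
        A′ : Matrix n n
        A′ i j = A (to e₁ i) (to e₂ j)

    -- Multiplying `z A = 0` by the adjugate gives `z x₀ * Det A = 0`. An entry equal to 1 makes
    -- this conclusive over any commutative ring.
    Det-left-kernel : ∀ (A : Mat α β) (z : α → Carrier) x₀ → z x₀ ≈ 1# →
                      (∀ y → ∑ e₁ (λ x → z x * A x y) ≈ 0#) → Det e₁ e₂ A ≈ 0#
    Det-left-kernel A z x₀ zx₀≈1 zA≈0 = begin
      Det e₁ e₂ A
        ≈⟨ trans (*-congʳ zx₀≈1) (*-identityˡ _) ⟨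
      z x₀ * Det e₁ e₂ A
        ≈⟨ *-congʳ (∑-Idʳ e₁ x₀ z) ⟨
      ∑ e₁ (λ x → z x * Id e₁ x x₀) * Det e₁ e₂ A
        ≈⟨ ∑-*ʳ e₁ _ _ ⟩
      ∑ e₁ (λ x → z x * Id e₁ x x₀ * Det e₁ e₂ A)
        ≈⟨ ∑-cong e₁ (λ x → trans (*-assoc _ _ _) (*-congˡ (sym (mul-Adj A x x₀)))) ⟩
      ∑ e₁ (λ x → z x * ∑ e₂ λ y → A x y * Adj A y x₀)
        ≈⟨ ∑-cong e₁ (λ x → trans (∑-*ˡ e₂ _ _) (∑-cong e₂ λ y → sym (*-assoc _ _ _))) ⟩
      ∑ e₁ (λ x → ∑ e₂ λ y → z x * A x y * Adj A y x₀)
        ≈⟨ ∑-swap e₁ e₂ _ ⟩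
      ∑ e₂ (λ y → ∑ e₁ λ x → z x * A x y * Adj A y x₀)
        ≈⟨ ∑-zero e₂ (λ y → trans (sym (∑-*ʳ e₁ _ _)) (annihilateˡ (zA≈0 y))) ⟩
      0# ∎

  Det-right-kernel : ∀ {n} {α β : Set} (e₁ : Fin n ↔ α) (e₂ : Fin n ↔ β) (A : Mat α β) (z : β → Carrier) y₀ →
                     z y₀ ≈ 1# → (∀ x → ∑ e₂ (λ y → A x y * z y) ≈ 0#) → Det e₁ e₂ A ≈ 0#
  Det-right-kernel e₁ e₂ A z y₀ zy₀≈1 Az≈0 = trans (Det-transpose e₁ e₂ A)
    (Det-left-kernel e₂ e₁ (flip A) z y₀ zy₀≈1 λ x → trans (∑-cong e₂ λ y → *-comm _ _) (Az≈0 x))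

  opaque
    unfolding Det Id

    Det-Id : ∀ {n} {α : Set} (e : Fin n ↔ α) → Det e e (Id e) ≈ 1#
    Det-Id {n} e = trans (det-cong λ i j → reflexive (≡.cong₂ δ (from-to e i) (from-to e j))) (det-δ n)

  mul-Idˡ : ∀ {n} {α β : Set} (e : Fin n ↔ α) (A : Mat α β) x y → mul e (Id e) A x y ≈ A x y
  mul-Idˡ e A x y = ∑-Idˡ e x λ z → A z y

  mul-Idʳ : ∀ {n} {α β : Set} (e : Fin n ↔ β) (A : Mat α β) x y → mul e A (Id e) x y ≈ A x y
  mul-Idʳ e A x y = ∑-Idʳ e y (A x)

  -- The change of enumeration is a permutation matrix on one side and its inverse on the other;
  -- their determinants have product 1.
  Det-reenumerate : ∀ {m n} {α : Set} (e : Fin m ↔ α) (e′ : Fin n ↔ α) (A : Mat α α) → Det e e A ≈ Det e′ e′ A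
  Det-reenumerate e e′ A with ↔⇒≡ (↔-sym e′ ↔-∘ e)
  ... | ≡.refl = begin
    Det e e A                                             ≈⟨ *-identityʳ _ ⟨
    Det e e A * 1#                                        ≈⟨ *-congˡ (Det-Id e) ⟨
    Det e e A * Det e e (Id e)                            ≈⟨ *-congˡ (Det-cong e e (mul-Idˡ e′ (Id e))) ⟨
    Det e e A * Det e e (mul e′ (Id e′) (Id e))           ≈⟨ *-congˡ (Det-mul e e′ e (Id e′) (Id e)) ⟩
    Det e e A * (Det e e′ (Id e′) * Det e′ e (Id e))
      ≈⟨ solve 3 (λ x y z → x :* (y :* z) := z :* (x :* y)) refl _ _ _ ⟩
    Det e′ e (Id e) * (Det e e A * Det e e′ (Id e′))      ≈⟨ *-congˡ (Det-mul e e e′ A (Id e′)) ⟨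
    Det e′ e (Id e) * Det e e′ (mul e A (Id e′))          ≈⟨ Det-mul e′ e e′ (Id e) _ ⟨
    Det e′ e′ (mul e (Id e) (mul e A (Id e′)))
      ≈⟨ Det-cong e′ e′ (λ x y → trans (mul-Idˡ e (mul e A (Id e′)) x y)
                                       (trans (∑-reenumerate e e′ _) (mul-Idʳ e′ A x y))) ⟩
    Det e′ e′ A                                           ∎

  opaque
    unfolding Det

    Det-rename : ∀ {m n} {α β : Set} (e : Fin m ↔ α) (e′ : Fin n ↔ β) (ψ : α ↔ β) (A : Mat α α) (B : Mat β β) →
                 (∀ x y → A x y ≈ B (to ψ x) (to ψ y)) → Det e e A ≈ Det e′ e′ B
    Det-rename e e′ ψ A B A≈B = trans (Det-cong e e A≈B) (Det-reenumerate (ψ ↔-∘ e) e′ B)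

  -- Padding the inner index set with zeros makes both factors square, and the second one then has a
  -- zero row.
  Det-low-rank : ∀ {m n} {α β γ : Set} (e₁ : Fin n ↔ α) (e₂ : Fin n ↔ β) (e₃ : Fin m ↔ γ) → m ℕ.< n →
                 ∀ (A : Mat α γ) (B : Mat γ β) → Det e₁ e₂ (mul e₃ A B) ≈ 0#
  Det-low-rank {m} {n} {α} {β} {γ} e₁ e₂ e₃ m<n A B with ℕ.m≤n⇒∃[o]m+o≡n m<n
  ... | d , m+d≡n = begin
    Det e₁ e₂ (mul e₃ A B)        ≈⟨ Det-cong e₁ e₂ padded ⟨
    Det e₁ e₂ (mul e A′ B′)       ≈⟨ Det-mul e₁ e e₂ A′ B′ ⟩
    Det e₁ e A′ * Det e e₂ B′     ≈⟨ *-congˡ (Det-left-kernel e e₂ B′ (Id e new) new (Id-diag e new)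
                                       λ y → ∑-Idˡ e new λ x → B′ x y) ⟩
    Det e₁ e A′ * 0#              ≈⟨ zeroʳ _ ⟩
    0#                            ∎
    where
    e : Fin n ↔ (γ ⊎ Fin (suc d))
    e = ≡.subst (λ k → Fin k ↔ (γ ⊎ Fin (suc d))) (≡.trans (ℕ.+-suc m d) m+d≡n) (e₃ ⊕ fins (suc d))
    new : γ ⊎ Fin (suc d)
    new = inj₂ zero
    A′ : Mat α (γ ⊎ Fin (suc d))
    A′ x = [ A x , (λ _ → 0#) ]
    B′ : Mat (γ ⊎ Fin (suc d)) β
    B′ = [ B , (λ _ _ → 0#) ]
    padded : ∀ x y → mul e A′ B′ x y ≈ mul e₃ A B x y
    padded x y = begin
      ∑ e (λ z → A′ x z * B′ z y)                              ≈⟨ ∑-reenumerate e (e₃ ⊕ fins (suc d)) _ ⟩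
      ∑ (e₃ ⊕ fins (suc d)) (λ z → A′ x z * B′ z y)            ≈⟨ ∑-⊕ e₃ (fins (suc d)) _ ⟩
      mul e₃ A B x y + ∑ (fins (suc d)) (λ _ → 0# * 0#)        ≈⟨ +-congˡ (∑-zero (fins (suc d)) λ _ → zeroˡ 0#) ⟩
      mul e₃ A B x y + 0#                                      ≈⟨ +-identityʳ _ ⟩
      mul e₃ A B x y                                           ∎

  mul-block : ∀ {m n} {α α′ β β′ γ γ′ : Set} (e : Fin m ↔ β) (e′ : Fin n ↔ β′)
              (A : Mat α β) (B : Mat α β′) (C : Mat α′ β) (D : Mat α′ β′)
              (A′ : Mat β γ) (B′ : Mat β γ′) (C′ : Mat β′ γ) (D′ : Mat β′ γ′) x z →
              mul (e ⊕ e′) (block A B C D) (block A′ B′ C′ D′) x z ≈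
              block (λ x z → mul e A A′ x z + mul e′ B C′ x z) (λ x z → mul e A B′ x z + mul e′ B D′ x z)
                    (λ x z → mul e C A′ x z + mul e′ D C′ x z) (λ x z → mul e C B′ x z + mul e′ D D′ x z) x z
  mul-block e e′ A B C D A′ B′ C′ D′ (inj₁ x) (inj₁ z) = ∑-⊕ e e′ _
  mul-block e e′ A B C D A′ B′ C′ D′ (inj₁ x) (inj₂ z) = ∑-⊕ e e′ _
  mul-block e e′ A B C D A′ B′ C′ D′ (inj₂ x) (inj₁ z) = ∑-⊕ e e′ _
  mul-block e e′ A B C D A′ B′ C′ D′ (inj₂ x) (inj₂ z) = ∑-⊕ e e′ _

  mul-assoc : ∀ {m n} {α β γ ε : Set} (e : Fin m ↔ β) (e′ : Fin n ↔ γ) (A : Mat α β) (B : Mat β γ) (C : Mat γ ε) x z →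
              mul e A (mul e′ B C) x z ≈ mul e′ (mul e A B) C x z
  mul-assoc e e′ A B C x z = begin
    ∑ e (λ y → A x y * ∑ e′ λ w → B y w * C w z)
      ≈⟨ ∑-cong e (λ y → trans (∑-*ˡ e′ _ _) (∑-cong e′ λ w → sym (*-assoc _ _ _))) ⟩
    ∑ e (λ y → ∑ e′ λ w → A x y * B y w * C w z)
      ≈⟨ ∑-swap e e′ _ ⟩
    ∑ e′ (λ w → ∑ e λ y → A x y * B y w * C w z)
      ≈⟨ ∑-cong e′ (λ w → sym (∑-*ʳ e _ _)) ⟩
    ∑ e′ (λ w → ∑ e (λ y → A x y * B y w) * C w z) ∎

  mul-Oˡ : ∀ {n} {α β γ : Set} (e : Fin n ↔ β) (B : Mat β γ) (x : α) z → mul e O B x z ≈ 0#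
  mul-Oˡ e B x z = ∑-zero e λ y → zeroˡ _

  mul-Oʳ : ∀ {n} {α β γ : Set} (e : Fin n ↔ β) (A : Mat α β) x (z : γ) → mul e A O x z ≈ 0#
  mul-Oʳ e A x z = ∑-zero e λ y → zeroʳ _

  block-cong : ∀ {α β γ ε : Set} {A A′ : Mat α γ} {B B′ : Mat α ε} {C C′ : Mat β γ} {D D′ : Mat β ε} →
               (∀ x y → A x y ≈ A′ x y) → (∀ x y → B x y ≈ B′ x y) → (∀ x y → C x y ≈ C′ x y) →
               (∀ x y → D x y ≈ D′ x y) → ∀ x y → block A B C D x y ≈ block A′ B′ C′ D′ x y
  block-cong A≈ B≈ C≈ D≈ (inj₁ x) (inj₁ y) = A≈ x y
  block-cong A≈ B≈ C≈ D≈ (inj₁ x) (inj₂ y) = B≈ x y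
  block-cong A≈ B≈ C≈ D≈ (inj₂ x) (inj₁ y) = C≈ x y
  block-cong A≈ B≈ C≈ D≈ (inj₂ x) (inj₂ y) = D≈ x y

  Det-block-upper : ∀ {m n} {α β γ ε : Set} (e₁ : Fin n ↔ α) (e₂ : Fin n ↔ β) (e₃ : Fin m ↔ γ) (e₄ : Fin m ↔ ε)
                    (A : Mat α β) (B : Mat α ε) (D : Mat γ ε) →
                    Det (e₁ ⊕ e₃) (e₂ ⊕ e₄) (block A B O D) ≈ Det e₁ e₂ A * Det e₃ e₄ D
  Det-block-upper e₁ e₂ e₃ e₄ A B D = begin
    Det (e₁ ⊕ e₃) (e₂ ⊕ e₄) (block A B O D)
      ≈⟨ Det-transpose (e₁ ⊕ e₃) (e₂ ⊕ e₄) _ ⟩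
    Det (e₂ ⊕ e₄) (e₁ ⊕ e₃) (flip (block A B O D))
      ≈⟨ Det-cong (e₂ ⊕ e₄) (e₁ ⊕ e₃) transposed ⟩
    Det (e₂ ⊕ e₄) (e₁ ⊕ e₃) (block (flip A) O (flip B) (flip D))
      ≈⟨ Det-block e₂ e₁ e₄ e₃ _ _ _ ⟩
    Det e₂ e₁ (flip A) * Det e₄ e₃ (flip D)
      ≈⟨ *-cong (Det-transpose e₁ e₂ A) (Det-transpose e₃ e₄ D) ⟨
    Det e₁ e₂ A * Det e₃ e₄ D ∎
    where
    transposed : ∀ x y → flip (block A B O D) x y ≈ block (flip A) O (flip B) (flip D) x y
    transposed (inj₁ x) (inj₁ y) = refl
    transposed (inj₁ x) (inj₂ y) = refl
    transposed (inj₂ x) (inj₁ y) = refl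
    transposed (inj₂ x) (inj₂ y) = refl

  -- [[M, b], [C, O]] = [[M, O], [C, -CS]] [[1, S], [O, 1]] whenever MS = b.
  Det-schur : ∀ {m n} {α β : Set} (e : Fin m ↔ α) (e′ : Fin n ↔ β)
              (M : Mat α α) (b : Mat α β) (C : Mat β α) (S : Mat α β) →
              (∀ x y → mul e M S x y ≈ b x y) →
              Det (e ⊕ e′) (e ⊕ e′) (block M b C O) ≈ Det e e M * Det e′ e′ (λ x y → - mul e C S x y)
  Det-schur e e′ M b C S MS≈b = begin
    Det e⊕ e⊕ (block M b C O)
      ≈⟨ Det-cong e⊕ e⊕ factor ⟨
    Det e⊕ e⊕ (mul e⊕ (block M O C -CS) (block (Id e) S O (Id e′)))
      ≈⟨ Det-mul e⊕ e⊕ e⊕ _ _ ⟩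
    Det e⊕ e⊕ (block M O C -CS) * Det e⊕ e⊕ (block (Id e) S O (Id e′))
      ≈⟨ *-cong (Det-block e e e′ e′ M C -CS) (Det-block-upper e e e′ e′ (Id e) S (Id e′)) ⟩
    Det e e M * Det e′ e′ -CS * (Det e e (Id e) * Det e′ e′ (Id e′))
      ≈⟨ *-congˡ (trans (*-cong (Det-Id e) (Det-Id e′)) (*-identityˡ 1#)) ⟩
    Det e e M * Det e′ e′ -CS * 1#
      ≈⟨ *-identityʳ _ ⟩
    Det e e M * Det e′ e′ -CS ∎
    where
    e⊕ = e ⊕ e′
    -CS = λ x y → - mul e C S x y
    factor : ∀ x y → mul e⊕ (block M O C -CS) (block (Id e) S O (Id e′)) x y ≈ block M b C O x y
    factor x y = trans (mul-block e e′ M O C -CS (Id e) S O (Id e′) x y) (block-cong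
      (λ x y → +-dropʳ (mul-Idʳ e M x y) (mul-Oˡ e′ O x y))
      (λ x y → +-dropʳ (MS≈b x y) (mul-Oˡ e′ (Id e′) x y))
      (λ x y → +-dropʳ (mul-Idʳ e C x y) (mul-Oʳ e′ -CS x y))
      (λ x y → trans (+-congˡ (mul-Idʳ e′ -CS x y)) (-‿inverseʳ _))
      x y)

  module _ {m n} {α β : Set} (e₁ : Fin m ↔ α) (e₂ : Fin n ↔ β) (X : Mat α β) (Y : Mat β α) where

    -- The inner index set is two copies of `β`. For equal sizes this isolates `X` as a diagonal
    -- block; for unequal sizes it bounds the rank when `β` is the smaller side.
    antidiagonal-factorˡ : ∀ x y → mul (e₂ ⊕ e₂) (block X O O (Id e₂)) (block O (Id e₂) Y O) x y ≈ block O X Y O x y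
    antidiagonal-factorˡ x y = trans (mul-block e₂ e₂ X O O (Id e₂) O (Id e₂) Y O x y) (block-cong
      (λ x y → +-dropʳ (mul-Oʳ e₂ X x y) (mul-Oˡ e₂ Y x y))
      (λ x y → +-dropʳ (mul-Idʳ e₂ X x y) (mul-Oˡ e₂ O x y))
      (λ x y → +-dropˡ (mul-Oˡ e₂ O x y) (mul-Idˡ e₂ Y x y))
      (λ x y → +-dropʳ (mul-Oˡ e₂ (Id e₂) x y) (mul-Oʳ e₂ (Id e₂) x y))
      x y)

    antidiagonal-factorʳ : ∀ x y → mul (e₁ ⊕ e₁) (block (Id e₁) O O Y) (block O X (Id e₁) O) x y ≈ block O X Y O x y
    antidiagonal-factorʳ x y = trans (mul-block e₁ e₁ (Id e₁) O O Y O X (Id e₁) O x y) (block-cong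
      (λ x y → +-dropʳ (mul-Oʳ e₁ (Id e₁) x y) (mul-Oˡ e₁ (Id e₁) x y))
      (λ x y → +-dropʳ (mul-Idˡ e₁ X x y) (mul-Oˡ e₁ O x y))
      (λ x y → +-dropˡ (mul-Oˡ e₁ O x y) (mul-Idʳ e₁ Y x y))
      (λ x y → +-dropʳ (mul-Oˡ e₁ X x y) (mul-Oʳ e₁ Y x y))
      x y)

    -- Factoring through two copies of the smaller side gives an inner dimension below `m + n`.
    Det-antidiagonal-rectangular : ∀ {k} (e : Fin k ↔ (α ⊎ β)) → m ≢ n → Det e e (block O X Y O) ≈ 0#
    Det-antidiagonal-rectangular e m≢n = trans (Det-reenumerate e e⊕ _) (case (ℕ.<-cmp m n))
      where
      e⊕ = e₁ ⊕ e₂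
      case : Tri (m ℕ.< n) (m ≡ n) (n ℕ.< m) → Det e⊕ e⊕ (block O X Y O) ≈ 0#
      case (tri< m<n _ _) = trans (Det-cong e⊕ e⊕ λ x y → sym (antidiagonal-factorʳ x y))
                                  (Det-low-rank e⊕ e⊕ (e₁ ⊕ e₁) (ℕ.+-monoʳ-< m m<n) _ _)
      case (tri≈ _ m≡n _) = contradiction m≡n m≢n
      case (tri> _ _ n<m) = trans (Det-cong e⊕ e⊕ λ x y → sym (antidiagonal-factorˡ x y))
                                  (Det-low-rank e⊕ e⊕ (e₂ ⊕ e₂) (ℕ.+-monoˡ-< n n<m) _ _)

  -- [[O, 1], [Y, O]] = [[1, 1], [O, 1]] [[1, O], [-1, 1]] [[-Y, 1], [O, 1]].
  Det-antidiagonal : ∀ {n} {α β : Set} (e₁ : Fin n ↔ α) (e₂ : Fin n ↔ β) (X : Mat α β) (Y : Mat β α) →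
                     Det (e₁ ⊕ e₂) (e₁ ⊕ e₂) (block O X Y O) ≈ Det e₁ e₂ X * Det e₂ e₁ (λ x y → - Y x y)
  Det-antidiagonal {α = α} {β} e₁ e₂ X Y = begin
    Det e₁₂ e₁₂ (block O X Y O)
      ≈⟨ Det-cong e₁₂ e₁₂ (antidiagonal-factorˡ e₁ e₂ X Y) ⟨
    Det e₁₂ e₁₂ (mul e₂₂ (block X O O 𝟏) (block O 𝟏 Y O))
      ≈⟨ Det-mul e₁₂ e₂₂ e₁₂ _ _ ⟩
    Det e₁₂ e₂₂ (block X O O 𝟏) * Det e₂₂ e₁₂ (block O 𝟏 Y O)
      ≈⟨ *-cong (trans (Det-block e₁ e₂ e₂ e₂ X O 𝟏) (trans (*-congˡ (Det-Id e₂)) (*-identityʳ _)))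
                (trans (Det-cong e₂₂ e₁₂ λ x y → sym (ULV x y)) (Det-mul e₂₂ e₂₂ e₁₂ _ _)) ⟩
    Det e₁ e₂ X * (Det e₂₂ e₂₂ (block 𝟏 𝟏 O 𝟏) * Det e₂₂ e₁₂ (mul e₂₂ (block 𝟏 O -𝟏 𝟏) (block -Y 𝟏 O 𝟏)))
      ≈⟨ *-congˡ (*-cong (trans (Det-block-upper e₂ e₂ e₂ e₂ 𝟏 𝟏 𝟏) one)
           (trans (Det-mul e₂₂ e₂₂ e₁₂ _ _) (*-cong (trans (Det-block e₂ e₂ e₂ e₂ 𝟏 -𝟏 𝟏) one)
             (trans (Det-block-upper e₂ e₁ e₂ e₂ -Y 𝟏 𝟏) (trans (*-congˡ (Det-Id e₂)) (*-identityʳ _)))))) ⟩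
    Det e₁ e₂ X * (1# * (1# * Det e₂ e₁ -Y))
      ≈⟨ *-congˡ (trans (*-identityˡ _) (*-identityˡ _)) ⟩
    Det e₁ e₂ X * Det e₂ e₁ -Y ∎
    where
    e₁₂ = e₁ ⊕ e₂
    e₂₂ = e₂ ⊕ e₂
    𝟏 -𝟏 : Mat β β
    𝟏 = Id e₂
    -𝟏 x y = - Id e₂ x y
    -Y : Mat β α
    -Y x y = - Y x y
    one : Det e₂ e₂ 𝟏 * Det e₂ e₂ 𝟏 ≈ 1#
    one = trans (*-cong (Det-Id e₂) (Det-Id e₂)) (*-identityˡ 1#)
    -𝟏-Y : ∀ x y → mul e₂ -𝟏 -Y x y ≈ Y x y
    -𝟏-Y x y = trans (∑-cong e₂ λ z → solve 2 (λ x y → :- x :* :- y := x :* y) refl (𝟏 x z) (Y z y)) (mul-Idˡ e₂ Y x y)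
    LV : ∀ x y → mul e₂₂ (block 𝟏 O -𝟏 𝟏) (block -Y 𝟏 O 𝟏) x y ≈ block -Y 𝟏 Y O x y
    LV x y = trans (mul-block e₂ e₂ 𝟏 O -𝟏 𝟏 -Y 𝟏 O 𝟏 x y) (block-cong
      (λ x y → +-dropʳ (mul-Idˡ e₂ -Y x y) (mul-Oʳ e₂ O x y))
      (λ x y → +-dropʳ (mul-Idˡ e₂ 𝟏 x y) (mul-Oˡ e₂ 𝟏 x y))
      (λ x y → +-dropʳ (-𝟏-Y x y) (mul-Oʳ e₂ 𝟏 x y))
      (λ x y → trans (+-cong (mul-Idʳ e₂ -𝟏 x y) (mul-Idˡ e₂ 𝟏 x y)) (-‿inverseˡ _))
      x y)
    ULV : ∀ x y → mul e₂₂ (block 𝟏 𝟏 O 𝟏) (mul e₂₂ (block 𝟏 O -𝟏 𝟏) (block -Y 𝟏 O 𝟏)) x y ≈ block O 𝟏 Y O x y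
    ULV x y = trans (∑-cong e₂₂ λ z → *-congˡ (LV z y)) (trans (mul-block e₂ e₂ 𝟏 𝟏 O 𝟏 -Y 𝟏 Y O x y) (block-cong
      (λ x y → trans (+-cong (mul-Idˡ e₂ -Y x y) (mul-Idˡ e₂ Y x y)) (-‿inverseˡ _))
      (λ x y → +-dropʳ (mul-Idˡ e₂ 𝟏 x y) (mul-Oʳ e₂ 𝟏 x y))
      (λ x y → +-dropˡ (mul-Oˡ e₂ -Y x y) (mul-Idˡ e₂ Y x y))
      (λ x y → +-dropˡ (mul-Oˡ e₂ 𝟏 x y) (mul-Oʳ e₂ 𝟏 x y))
      x y))

-- Expansion of a determinant in a sum of rank-one terms.

module RankOneExpansion {a ℓ} (R : CommutativeRing a ℓ) where
  open CommutativeRing R hiding (zero)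
  open LinearAlgebra R
  open Determinants R
  open EnumeratedMatrices R
  open RingProperties ring using (-0#≈0#)
  open IntegerMultiples R using (module Solver)
  open Solver using (solve; _:+_; _:*_; :-_; _:=_)
  open SetoidReasoning setoid
  open Inverse

  opaque
    unfolding Det

    Det-linear : ∀ {n} {α β : Set} (e₁ : Fin n ↔ α) (e₂ : Fin n ↔ β) (A B C : Mat α β) x₀ s t →
                 (∀ x → x ≢ x₀ → ∀ y → A x y ≈ B x y) → (∀ x → x ≢ x₀ → ∀ y → A x y ≈ C x y) →
                 (∀ y → A x₀ y ≈ s * B x₀ y + t * C x₀ y) →
                 Det e₁ e₂ A ≈ s * Det e₁ e₂ B + t * Det e₁ e₂ C
    Det-linear e₁ e₂ A B C x₀ s t A≈B A≈C Ax₀ = IsAlternating.linear det-alternating _ _ _ (from e₁ x₀) s t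
      (λ i i≢ j → A≈B _ (i≢ ∘ inverse-image i) _) (λ i i≢ j → A≈C _ (i≢ ∘ inverse-image i) _)
      (λ j → ≡.subst (λ x → A x (to e₂ j) ≈ s * B x (to e₂ j) + t * C x (to e₂ j)) (≡.sym (to-from e₁ x₀)) (Ax₀ _))
      where
      inverse-image : ∀ i → to e₁ i ≡ x₀ → i ≡ from e₁ x₀
      inverse-image i eq = ≡.trans (≡.sym (from-to e₁ i)) (≡.cong (from e₁) eq)

  module _ {n} {Ω : Set} (e : Fin n ↔ Ω) (A : Mat Ω Ω) (s : Carrier) (u v : Ω → Carrier) where
    private
      𝟙 : Mat (Fin 1) (Fin 1)
      𝟙 = Id (fins 1)
      col : Mat Ω (Fin 1)
      col x _ = u x
      row : Mat (Fin 1) Ω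
      row _ y = - v y
      row′ : Mat (Fin 1) Ω
      row′ _ y = - (s * v y)
      A+suv : Mat Ω Ω
      A+suv x y = A x y + s * (u x * v y)
      e⁺ = fins 1 ⊕ e

      ∑-fin1 : ∀ (f : Fin 1 → Carrier) → ∑ (fins 1) f ≈ f zero
      ∑-fin1 f = trans (reflexive (∑-def (fins 1) f)) (+-identityʳ _)

    -- Both sides are det [[1, -s vᵀ], [u, A]]: eliminate the first column, or split the first row.
    Det-rank-one : Det e e A+suv ≈ Det e e A + s * Det e⁺ e⁺ (block O row col A)
    Det-rank-one = begin
      Det e e A+suv
        ≈⟨ trans (*-cong (trans (*-congʳ (Det-Id (fins 1))) (*-identityˡ _)) one) (*-identityʳ _) ⟨
      Det (fins 1) (fins 1) 𝟙 * Det e e A+suv * (Det (fins 1) (fins 1) 𝟙 * Det e e (Id e))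
        ≈⟨ *-cong (Det-block (fins 1) (fins 1) e e 𝟙 col A+suv) (Det-block-upper (fins 1) (fins 1) e e 𝟙 row′ (Id e)) ⟨
      Det e⁺ e⁺ (block 𝟙 O col A+suv) * Det e⁺ e⁺ (block 𝟙 row′ O (Id e))
        ≈⟨ Det-mul e⁺ e⁺ e⁺ _ _ ⟨
      Det e⁺ e⁺ (mul e⁺ (block 𝟙 O col A+suv) (block 𝟙 row′ O (Id e)))
        ≈⟨ Det-cong e⁺ e⁺ factor ⟩
      Det e⁺ e⁺ (block 𝟙 row′ col A)
        ≈⟨ Det-linear e⁺ e⁺ (block 𝟙 row′ col A) (block 𝟙 O col A) (block O row col A) (inj₁ zero) 1# s
             (λ { (inj₁ zero) 0≢0 → contradiction ≡.refl 0≢0 ; (inj₂ x) _ (inj₁ y) → refl ; (inj₂ x) _ (inj₂ y) → refl })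
             (λ { (inj₁ zero) 0≢0 → contradiction ≡.refl 0≢0 ; (inj₂ x) _ (inj₁ y) → refl ; (inj₂ x) _ (inj₂ y) → refl })
             (λ { (inj₁ y) → sym (+-dropʳ (*-identityˡ _) (zeroʳ s))
                ; (inj₂ y) → sym (+-dropˡ (zeroʳ 1#)
                                  (solve 2 (λ s v → s :* :- v := :- (s :* v)) refl s (v y))) }) ⟩
      1# * Det e⁺ e⁺ (block 𝟙 O col A) + s * Det e⁺ e⁺ (block O row col A)
        ≈⟨ +-congʳ (trans (*-identityˡ _) (trans (Det-block (fins 1) (fins 1) e e 𝟙 col A)
                                                 (trans (*-congʳ (Det-Id (fins 1))) (*-identityˡ _)))) ⟩
      Det e e A + s * Det e⁺ e⁺ (block O row col A) ∎
      where
      one : Det (fins 1) (fins 1) 𝟙 * Det e e (Id e) ≈ 1#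
      one = trans (*-cong (Det-Id (fins 1)) (Det-Id e)) (*-identityˡ 1#)
      factor : ∀ x y → mul e⁺ (block 𝟙 O col A+suv) (block 𝟙 row′ O (Id e)) x y ≈ block 𝟙 row′ col A x y
      factor x y = trans (mul-block (fins 1) e 𝟙 O col A+suv 𝟙 row′ O (Id e) x y) (block-cong
        (λ x y → +-dropʳ (mul-Idˡ (fins 1) 𝟙 x y) (mul-Oˡ e O x y))
        (λ x y → +-dropʳ (mul-Idˡ (fins 1) row′ x y) (mul-Oˡ e (Id e) x y))
        (λ x y → +-dropʳ (mul-Idʳ (fins 1) col x y) (mul-Oʳ e A+suv x y))
        (λ x y → begin
          mul (fins 1) col row′ x y + mul e A+suv (Id e) x y
            ≈⟨ +-cong (∑-fin1 _) (mul-Idʳ e A+suv x y) ⟩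
          u x * - (s * v y) + (A x y + s * (u x * v y))
            ≈⟨ solve 4 (λ u s v a → u :* :- (s :* v) :+ (a :+ s :* (u :* v)) := a) refl (u x) s (v y) (A x y) ⟩
          A x y ∎)
        x y)

  sumSubsets-cong : ∀ {m} {f g : Subset m → Carrier} → (∀ F → f F ≈ g F) → sumSubsets f ≈ sumSubsets g
  sumSubsets-cong {zero}  f≈g = f≈g []
  sumSubsets-cong {suc m} f≈g = +-cong
    (sumSubsets-cong {m} λ F → f≈g (outside ∷ F)) (sumSubsets-cong {m} λ F → f≈g (inside ∷ F))

  sumSubsets-*ˡ : ∀ {m} s (f : Subset m → Carrier) → s * sumSubsets f ≈ sumSubsets (λ F → s * f F)
  sumSubsets-*ˡ {zero}  s f = refl
  sumSubsets-*ˡ {suc m} s f = trans (distribˡ s _ _) (+-cong (sumSubsets-*ˡ {m} s _) (sumSubsets-*ˡ {m} s _))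

  subsetProduct : ∀ {m} → (Fin m → Carrier) → Subset m → Carrier
  subsetProduct c F = product λ i → if does (i ∈? F) then c i else 1#

  border : ∀ {m} {Ω : Set} (F : Subset m) (u v : Fin m → Ω → Carrier) → Mat Ω Ω →
           Mat (Fin ∣ F ∣ ⊎ Ω) (Fin ∣ F ∣ ⊎ Ω)
  border F u v A = block O (λ i y → - v (pick F i) y) (λ x i → u (pick F i) x) A

  -- The Cauchy–Binet expansion, with the minors of u and v packed into one bordered determinant.
  Det-rank-one-sum : ∀ {m n} {Ω : Set} (e : Fin n ↔ Ω) (c : Fin m → Carrier) (u v : Fin m → Ω → Carrier) (A : Mat Ω Ω) →
    Det e e (λ x y → A x y + sum (λ i → c i * (u i x * v i y))) ≈
    sumSubsets (λ F → subsetProduct c F * Det (fins ∣ F ∣ ⊕ e) (fins ∣ F ∣ ⊕ e) (border F u v A))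
  Det-rank-one-sum {zero} {Ω = Ω} e c u v A = begin
    Det e e (λ x y → A x y + 0#)                         ≈⟨ Det-cong e e (λ x y → +-identityʳ _) ⟩
    Det e e A                                            ≈⟨ Det-rename e (fins 0 ⊕ e) ψ A _ (λ x y → refl) ⟩
    Det (fins 0 ⊕ e) (fins 0 ⊕ e) (border [] u v A)      ≈⟨ *-identityˡ _ ⟨
    1# * Det (fins 0 ⊕ e) (fins 0 ⊕ e) (border [] u v A) ∎
    where
    ψ : Ω ↔ (Fin 0 ⊎ Ω)
    ψ = record
      { to = inj₂ ; from = λ { (inj₂ x) → x } ; to-cong = ≡.cong inj₂ ; from-cong = λ { ≡.refl → ≡.refl }
      ; inverse = (λ { {inj₂ x} ≡.refl → ≡.refl }) , λ { ≡.refl → ≡.refl } }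
  Det-rank-one-sum {suc m} {Ω = Ω} e c u v A = begin
    Det e e (λ x y → A x y + (c zero * (u zero x * v zero y) + rest x y))
      ≈⟨ Det-cong e e (λ x y → trans (+-congˡ (+-comm _ _)) (sym (+-assoc _ _ _))) ⟩
    Det e e (λ x y → A₁ x y + c zero * (u zero x * v zero y))
      ≈⟨ Det-rank-one e A₁ (c zero) (u zero) (v zero) ⟩
    Det e e A₁ + c zero * Det e⁺ e⁺ (block O (row zero) (col zero) A₁)
      -- The two summands omit and choose the term `zero`. If it is chosen, its border joins the
      -- base matrix as `A⁺`, and the remaining vectors are extended by 0 on the new index.
      ≈⟨ +-cong (Det-rank-one-sum e (tail c) (tail u) (tail v) A)
           (*-congˡ (trans (Det-cong e⁺ e⁺ extended) (Det-rank-one-sum e⁺ (tail c) ũ ṽ A⁺))) ⟩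
    sumSubsets (λ F → subsetProduct (tail c) F * Det (fins ∣ F ∣ ⊕ e) (fins ∣ F ∣ ⊕ e) (border F (tail u) (tail v) A)) +
    c zero * sumSubsets (λ F → subsetProduct (tail c) F * Det (fins ∣ F ∣ ⊕ e⁺) (fins ∣ F ∣ ⊕ e⁺) (border F ũ ṽ A⁺))
      ≈⟨ +-cong (sumSubsets-cong {m} λ F → *-congʳ (sym (*-identityˡ _)))
           (trans (sumSubsets-*ˡ {m} (c zero) _)
                  (sumSubsets-cong {m} λ F → trans (sym (*-assoc _ _ _)) (*-congˡ (merge F)))) ⟩
    sumSubsets (λ F → subsetProduct c F * Det (fins ∣ F ∣ ⊕ e) (fins ∣ F ∣ ⊕ e) (border F u v A)) ∎
    where
    rest : Mat Ω Ω
    rest x y = sum λ i → c (suc i) * (u (suc i) x * v (suc i) y)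
    A₁ : Mat Ω Ω
    A₁ x y = A x y + rest x y
    e⁺ = fins 1 ⊕ e
    col : Fin (suc m) → Mat Ω (Fin 1)
    col i x _ = u i x
    row : Fin (suc m) → Mat (Fin 1) Ω
    row i _ y = - v i y
    A⁺ : Mat (Fin 1 ⊎ Ω) (Fin 1 ⊎ Ω)
    A⁺ = block O (row zero) (col zero) A
    ũ ṽ : Fin m → Fin 1 ⊎ Ω → Carrier
    ũ i = [ (λ _ → 0#) , u (suc i) ]
    ṽ i = [ (λ _ → 0#) , v (suc i) ]
    extended : ∀ x y → block O (row zero) (col zero) A₁ x y ≈ A⁺ x y + sum (λ i → c (suc i) * (ũ i x * ṽ i y))
    extended (inj₁ x) (inj₁ y) = sym (+-dropʳ refl (sum-zero {m} λ i → annihilateʳ (zeroˡ _)))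
    extended (inj₁ x) (inj₂ y) = sym (+-dropʳ refl (sum-zero {m} λ i → annihilateʳ (zeroˡ _)))
    extended (inj₂ x) (inj₁ y) = sym (+-dropʳ refl (sum-zero {m} λ i → annihilateʳ (zeroʳ _)))
    extended (inj₂ x) (inj₂ y) = refl
    merge : ∀ F → Det (fins ∣ F ∣ ⊕ e⁺) (fins ∣ F ∣ ⊕ e⁺) (border F ũ ṽ A⁺) ≈
                  Det (fins (suc ∣ F ∣) ⊕ e) (fins (suc ∣ F ∣) ⊕ e) (border (inside ∷ F) u v A)
    -- The border index of the term `zero` returns to the front of the others. Rows and columns are
    -- permuted alike, hence no sign.
    merge F = Det-rename (fins ∣ F ∣ ⊕ e⁺) (fins (suc ∣ F ∣) ⊕ e) ψ _ _ pointwise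
      where
      ψ : (Fin ∣ F ∣ ⊎ (Fin 1 ⊎ Ω)) ↔ (Fin (suc ∣ F ∣) ⊎ Ω)
      ψ = record
        { to        = λ { (inj₁ i) → inj₁ (suc i) ; (inj₂ (inj₁ zero)) → inj₁ zero ; (inj₂ (inj₂ x)) → inj₂ x }
        ; from      = λ { (inj₁ zero) → inj₂ (inj₁ zero) ; (inj₁ (suc i)) → inj₁ i ; (inj₂ x) → inj₂ (inj₂ x) }
        ; to-cong   = λ { ≡.refl → ≡.refl }
        ; from-cong = λ { ≡.refl → ≡.refl }
        ; inverse   = (λ { {inj₁ zero} ≡.refl → ≡.refl ; {inj₁ (suc i)} ≡.refl → ≡.refl ; {inj₂ x} ≡.refl → ≡.refl })
                    , (λ { {inj₁ i} ≡.refl → ≡.refl ; {inj₂ (inj₁ zero)} ≡.refl → ≡.refl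
                         ; {inj₂ (inj₂ x)} ≡.refl → ≡.refl })
        }
      pointwise : ∀ x y → border F ũ ṽ A⁺ x y ≈ border (inside ∷ F) u v A (to ψ x) (to ψ y)
      pointwise (inj₁ i)              (inj₁ j)              = refl
      pointwise (inj₁ i)              (inj₂ (inj₁ zero))    = -0#≈0#
      pointwise (inj₁ i)              (inj₂ (inj₂ y))       = refl
      pointwise (inj₂ (inj₁ zero))    (inj₁ j)              = refl
      pointwise (inj₂ (inj₁ zero))    (inj₂ (inj₁ zero))    = refl
      pointwise (inj₂ (inj₁ zero))    (inj₂ (inj₂ y))       = refl
      pointwise (inj₂ (inj₂ x))       (inj₁ j)              = refl
      pointwise (inj₂ (inj₂ x))       (inj₂ (inj₁ zero))    = refl
      pointwise (inj₂ (inj₂ x))       (inj₂ (inj₂ y))       = refl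

-- Integral elements, unimodular matrices and integral spans.

module IntegralMatrices {a ℓ} (R : CommutativeRing a ℓ)
  (φ-injective : IntegerMultiples.CharacteristicZero R) where
  open CommutativeRing R hiding (zero)
  open LinearAlgebra R
  open Determinants R
  open EnumeratedMatrices R
  open RingProperties ring using (-0#≈0#; -‿distribˡ-*)
  open IntegerMultiples R using (φ; φ-+; φ-*; φ-neg; φ-1)
  open SetoidReasoning setoid
  open Inverse

  Integral : Carrier → Set ℓ
  Integral x = ∃[ i ] x ≈ φ i

  1≉0 : ¬ 1# ≈ 0#
  1≉0 1≈0 with φ-injective (+ 1) (trans φ-1 1≈0)
  ... | ()

  integral-cong : ∀ {x y} → x ≈ y → Integral x → Integral y
  integral-cong x≈y (i , x≈i) = i , trans (sym x≈y) x≈i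

  integral-0 : Integral 0#
  integral-0 = + 0 , refl

  integral-1 : Integral 1#
  integral-1 = + 1 , sym φ-1

  integral-+ : ∀ {x y} → Integral x → Integral y → Integral (x + y)
  integral-+ (i , x≈i) (j , y≈j) = i ℤ.+ j , trans (+-cong x≈i y≈j) (sym (φ-+ i j))

  integral-* : ∀ {x y} → Integral x → Integral y → Integral (x * y)
  integral-* (i , x≈i) (j , y≈j) = i ℤ.* j , trans (*-cong x≈i y≈j) (sym (φ-* i j))

  integral-neg : ∀ {x} → Integral x → Integral (- x)
  integral-neg (i , x≈i) = ℤ.- i , trans (-‿cong x≈i) (sym (φ-neg i))

  integral-difference : ∀ {x y} → Integral x → Integral y → Integral (x - y)
  integral-difference x∈ℤ y∈ℤ = integral-+ x∈ℤ (integral-neg y∈ℤ)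

  integral-sum : ∀ {n} {f : Vector Carrier n} → (∀ i → Integral (f i)) → Integral (sum f)
  integral-sum {zero}  f∈ℤ = integral-0
  integral-sum {suc n} f∈ℤ = integral-+ (f∈ℤ zero) (integral-sum (λ i → f∈ℤ (suc i)))

  integral-δ : ∀ {n} (i j : Fin n) → Integral (δ i j)
  integral-δ i j with i Fin.≟ j
  ... | yes _ = integral-1
  ... | no  _ = integral-0

  integral-sign : ∀ {n} (i : Fin n) → Integral (sign i)
  integral-sign zero    = integral-1
  integral-sign (suc i) = integral-neg (integral-sign i)

  integral-det : ∀ {n} (A : Matrix n n) → (∀ i j → Integral (A i j)) → Integral (det A)
  integral-det {zero}  A A∈ℤ = integral-1
  integral-det {suc n} A A∈ℤ = integral-sum {suc n} λ j →
    integral-* (integral-* (integral-sign j) (A∈ℤ zero j)) (integral-det _ λ i l → A∈ℤ (suc i) (punchIn j l))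

  opaque
    unfolding Det ∑ Id

    integral-Det : ∀ {n} {α β : Set} (e₁ : Fin n ↔ α) (e₂ : Fin n ↔ β) (A : Mat α β) →
                   (∀ x y → Integral (A x y)) → Integral (Det e₁ e₂ A)
    integral-Det e₁ e₂ A A∈ℤ = integral-det _ λ i j → A∈ℤ (to e₁ i) (to e₂ j)

    integral-Id : ∀ {n} {α : Set} (e : Fin n ↔ α) x y → Integral (Id e x y)
    integral-Id e x y = integral-δ (from e x) (from e y)

  private
    ∣i∣≡1⇒i≡±1 : ∀ i → ℤ.∣ i ∣ ≡ 1 → i ≡ + 1 ⊎ i ≡ -[1+ 0 ]
    ∣i∣≡1⇒i≡±1 (+ 1)      ≡.refl = inj₁ ≡.refl
    ∣i∣≡1⇒i≡±1 -[1+ 0 ]   ≡.refl = inj₂ ≡.refl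

  IsUnit : Carrier → Set ℓ
  IsUnit x = x ≈ 1# ⊎ x ≈ - 1#

  -- The equation descends to ℤ because `φ` is injective, and the only units of ℤ are 1 and -1.
  integral-unit : ∀ {x y} → Integral x → Integral y → x * y ≈ 1# → IsUnit x
  integral-unit {x} {y} (i , x≈i) (j , y≈j) xy≈1 =
    Sum.map (λ { ≡.refl → trans x≈i φ-1 }) (λ { ≡.refl → trans x≈i (-‿cong φ-1) })
      (∣i∣≡1⇒i≡±1 i (ℕ.m*n≡1⇒m≡1 ℤ.∣ i ∣ ℤ.∣ j ∣ (≡.trans (≡.sym (ℤ.abs-* i j)) (≡.cong ℤ.∣_∣ ij≡1))))
    where
    ij≡1 : i ℤ.* j ≡ + 1
    ij≡1 = ℤ.i-j≡0⇒i≡j (i ℤ.* j) (+ 1) (φ-injective (i ℤ.* j ℤ.- + 1) (begin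
      φ (i ℤ.* j ℤ.- + 1)       ≈⟨ φ-+ (i ℤ.* j) (ℤ.- + 1) ⟩
      φ (i ℤ.* j) + - φ (+ 1)   ≈⟨ +-cong (trans (φ-* i j) (trans (*-cong (sym x≈i) (sym y≈j)) xy≈1)) (-‿cong φ-1) ⟩
      1# - 1#                   ≈⟨ -‿inverseʳ 1# ⟩
      0#                        ∎))

  unit-square : ∀ {x} → IsUnit x → x * x ≈ 1#
  unit-square (inj₁ x≈1)  = trans (*-cong x≈1 x≈1) (*-identityˡ 1#)
  unit-square (inj₂ x≈-1) = trans (*-cong x≈-1 x≈-1) -1*-1≈1

  Det-unimodular : ∀ {n} {α β : Set} (e₁ : Fin n ↔ α) (e₂ : Fin n ↔ β) (A : Mat α β) (Z : Mat β α) →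
                   (∀ x y → Integral (A x y)) → (∀ y x → Integral (Z y x)) →
                   (∀ x x′ → mul e₂ A Z x x′ ≈ Id e₁ x x′) → IsUnit (Det e₁ e₂ A)
  Det-unimodular e₁ e₂ A Z A∈ℤ Z∈ℤ AZ≈1 =
    integral-unit (integral-Det e₁ e₂ A A∈ℤ) (integral-Det e₂ e₁ Z Z∈ℤ)
      (trans (sym (Det-mul e₁ e₂ e₁ A Z)) (trans (Det-cong e₁ e₁ AZ≈1) (Det-Id e₁)))

  -- This replaces dimension theory: with `n < m` the identity matrix would factor through too few
  -- indices and have determinant 0. It is used to count the edges of forests.
  right-inverse⇒≤ : ∀ {m n} {α β : Set} (e₁ : Fin m ↔ α) (e₂ : Fin n ↔ β) (A : Mat α β) (Z : Mat β α) →
                    (∀ x x′ → mul e₂ A Z x x′ ≈ Id e₁ x x′) → m ℕ.≤ n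
  right-inverse⇒≤ e₁ e₂ A Z AZ≈1 = ℕ.≮⇒≥ λ n<m → 1≉0
    (trans (sym (trans (Det-cong e₁ e₁ AZ≈1) (Det-Id e₁))) (Det-low-rank e₁ e₁ e₂ n<m A Z))

  module Span {n} {ι Ω : Set} (e : Fin n ↔ ι) (b : ι → Ω → Carrier) (P : ι → Set) where

    record Spanned (v : Ω → Carrier) : Set (a ⊔ ℓ) where
      field
        coefficient : ι → Carrier
        integral    : ∀ i → Integral (coefficient i)
        support     : ∀ i → ¬ P i → coefficient i ≈ 0#
        combination : ∀ w → v w ≈ ∑ e λ i → coefficient i * b i w

    open Spanned public

    span-cong : ∀ {u v} → (∀ w → u w ≈ v w) → Spanned u → Spanned v
    span-cong u≈v s = record
      { coefficient = coefficient s ; integral = integral s ; support = support s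
      ; combination = λ w → trans (sym (u≈v w)) (combination s w) }

    span-0 : Spanned (λ _ → 0#)
    span-0 = record
      { coefficient = λ _ → 0# ; integral = λ _ → integral-0 ; support = λ _ _ → refl
      ; combination = λ w → sym (∑-zero e λ i → zeroˡ _) }

    span-base : ∀ {i} → P i → Spanned (b i)
    span-base {i} Pi = record
      { coefficient = Id e i
      ; integral    = integral-Id e i
      ; support     = λ j ¬Pj → Id-off e λ { ≡.refl → ¬Pj Pi }
      ; combination = λ w → sym (∑-Idˡ e i λ j → b j w) }

    span-+ : ∀ {u v} → Spanned u → Spanned v → Spanned (λ w → u w + v w)
    span-+ s t = record
      { coefficient = λ i → coefficient s i + coefficient t i
      ; integral    = λ i → integral-+ (integral s i) (integral t i)
      ; support     = λ i ¬Pi → +-dropˡ (support s i ¬Pi) (support t i ¬Pi)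
      ; combination = λ w → trans (+-cong (combination s w) (combination t w))
          (trans (sym (∑-+ e _ _)) (∑-cong e λ i → sym (distribʳ _ _ _))) }

    span-neg : ∀ {u} → Spanned u → Spanned (λ w → - u w)
    span-neg s = record
      { coefficient = λ i → - coefficient s i
      ; integral    = λ i → integral-neg (integral s i)
      ; support     = λ i ¬Pi → trans (-‿cong (support s i ¬Pi)) -0#≈0#
      ; combination = λ w → trans (-‿cong (combination s w))
          (trans (sym (∑-neg e _)) (∑-cong e λ i → -‿distribˡ-* _ _)) }

    module _ {m} (e′ : Fin m ↔ Ω) (basis : ∀ w → Spanned (Id e′ w)) where

      span-inverse : ∀ w w′ → mul e (λ w i → b i w) (λ i w → coefficient (basis w) i) w w′ ≈ Id e′ w w′
      span-inverse w w′ = trans (∑-cong e λ i → *-comm _ _) (trans (sym (combination (basis w′) w)) (Id-sym e′ w′ w))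

      span-≤ : m ℕ.≤ n
      span-≤ = right-inverse⇒≤ e′ e _ _ span-inverse

    -- The unit vector at `i₀` minus the coefficients is a left kernel vector. Its entry at `i₀` is
    -- 1, since `P` excludes `i₀` from the combination.
    dependent-row : (e′ : Fin n ↔ Ω) → ∀ {i₀} → ¬ P i₀ → Spanned (b i₀) → Det e e′ b ≈ 0#
    dependent-row e′ {i₀} ¬Pi₀ s = Det-left-kernel e e′ b (λ i → Id e i₀ i - coefficient s i) i₀
      (+-dropʳ (Id-diag e i₀) (trans (-‿cong (support s i₀ ¬Pi₀)) -0#≈0#))
      λ w → begin
        ∑ e (λ i → (Id e i₀ i - coefficient s i) * b i w)
          ≈⟨ trans (∑-cong e λ i → *-comm _ _) (∑-*-difference e (λ i → b i w) (Id e i₀) (coefficient s)) ⟩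
        ∑ e (λ i → b i w * Id e i₀ i) - ∑ e (λ i → b i w * coefficient s i)
          ≈⟨ +-cong (∑-cong e λ i → *-comm _ _) (-‿cong (∑-cong e λ i → *-comm _ _)) ⟩
        ∑ e (λ i → Id e i₀ i * b i w) - ∑ e (λ i → coefficient s i * b i w)
          ≈⟨ +-cong (∑-Idˡ e i₀ λ i → b i w) (-‿cong (sym (combination s w))) ⟩
        b i₀ w - b i₀ w
          ≈⟨ -‿inverseʳ _ ⟩
        0# ∎

    span-unimodular : (e′ : Fin n ↔ Ω) → (∀ i w → Integral (b i w)) → (∀ w → Spanned (Id e′ w)) →
                      IsUnit (Det e′ e λ w i → b i w)
    span-unimodular e′ b∈ℤ basis = Det-unimodular e′ e _ _ (λ w i → b∈ℤ i w) (λ i w → integral (basis w) i)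
      (span-inverse e′ basis)

-- Walks, cycles and components of a multigraph.

x∉p-x : ∀ {n} {p : Subset n} {x} → x ∉ p ∖ x
x∉p-x {p = _ ∷ p} {suc x} x∈ = x∉p-x (drop-there x∈)
x∉p-x {p = inside  ∷ p} {zero} ()
x∉p-x {p = outside ∷ p} {zero} ()

pick∈ : ∀ {n} (I : Subset n) i → pick I i ∈ I
pick∈ (inside  ∷ I) zero    = Vec.here
pick∈ (inside  ∷ I) (suc i) = Vec.there (pick∈ I i)
pick∈ (outside ∷ I) i       = Vec.there (pick∈ I i)

pick-surjective : ∀ {n} (I : Subset n) {x} → x ∈ I → ∃[ i ] pick I i ≡ x
pick-surjective (inside  ∷ I) Vec.here       = zero , ≡.refl
pick-surjective (inside  ∷ I) (Vec.there x∈) with pick-surjective I x∈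
... | i , eq = suc i , ≡.cong suc eq
pick-surjective (outside ∷ I) (Vec.there x∈) with pick-surjective I x∈
... | i , eq = i , ≡.cong suc eq

pick-injective : ∀ {n} (I : Subset n) {i j} → pick I i ≡ pick I j → i ≡ j
pick-injective (inside  ∷ I) {zero}  {zero}  eq = ≡.refl
pick-injective (inside  ∷ I) {suc i} {suc j} eq = ≡.cong suc (pick-injective I (Fin.suc-injective eq))
pick-injective (outside ∷ I) eq                 = pick-injective I (Fin.suc-injective eq)

module Walks {n m} (H : Multigraph n m) where
  open Multigraph H

  source target : Fin m → Fin n
  source e = proj₁ (ends e)
  target e = proj₂ (ends e)

  joins-sym : ∀ {e u v} → Joins H e u v → Joins H e v u
  joins-sym = Sum.swap

  reverseWalk : ∀ {P u v} → Walk H P u v → Walk H P v u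
  reverseWalk = Star.reverse λ (e , Pe , j) → e , Pe , joins-sym j

  edgeWalk : ∀ {P : Pred (Fin m) 0ℓ} {e} → P e → Walk H P (source e) (target e)
  edgeWalk Pe = (_ , Pe , inj₁ ≡.refl) ◅ ε

  module _ {P : Pred (Fin m) 0ℓ} where

    -- In contrast to `walkVertices` the endpoint is included: uniqueness here describes a simple
    -- path, uniqueness there also admits a closed one.
    visited : ∀ {u v} → Walk H P u v → List (Fin n)
    visited {v = v} ε   = v ∷ []
    visited {u} (_ ◅ w) = u ∷ visited w

    start-visited : ∀ {u v} (w : Walk H P u v) → u ∈ˡ visited w
    start-visited ε       = here ≡.refl
    start-visited (_ ◅ w) = here ≡.refl

    end-visited : ∀ {u v} (w : Walk H P u v) → v ∈ˡ visited w
    end-visited ε       = here ≡.refl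
    end-visited (_ ◅ w) = there (end-visited w)

    suffix : ∀ {u v x} (w : Walk H P u v) → x ∈ˡ visited w → Unique (visited w) →
             Σ[ w′ ∈ Walk H P x v ] Unique (visited w′)
    suffix ε         (here ≡.refl) uq       = ε , uq
    suffix w@(_ ◅ _) (here ≡.refl) uq       = w , uq
    suffix (_ ◅ w)   (there x∈)    (_ ∷ uq) = suffix w x∈ uq

    eraseLoops : ∀ {u v} → Walk H P u v → Σ[ w ∈ Walk H P u v ] Unique (visited w)
    eraseLoops ε           = ε , [] ∷ []
    eraseLoops {u} (s ◅ w) with eraseLoops w
    ... | w′ , uq with DecMembership._∈?_ Fin._≟_ u (visited w′)
    ...   | yes u∈ = suffix w′ u∈ uq
    ...   | no  u∉ = s ◅ w′ , All.¬Any⇒All¬ _ u∉ ∷ uq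

    end-last : ∀ {u v} (w : Walk H P u v) → Unique (visited w) → All (v ≢_) (walkVertices H w)
    end-last ε       uq        = []
    end-last (_ ◅ w) (u≢ ∷ uq) = All.lookup u≢ (end-visited w) ∘ ≡.sym ∷ end-last w uq

    unique-vertices : ∀ {u v} (w : Walk H P u v) → Unique (visited w) → Unique (walkVertices H w)
    unique-vertices ε       uq        = []
    unique-vertices (_ ◅ w) (u≢ ∷ uq) = initial w u≢ ∷ unique-vertices w uq
      where
      initial : ∀ {Q : Fin n → Set} {u v} (w : Walk H P u v) → All Q (visited w) → All Q (walkVertices H w)
      initial ε       qs       = []
      initial (_ ◅ w) (q ∷ qs) = q ∷ initial w qs

    edge-visited : ∀ {e u v x y} (w : Walk H P u v) → e ∈ˡ walkEdges H w → Joins H e x y → x ∈ˡ visited w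
    edge-visited ((e , _ , inj₁ ends≡) ◅ w) (here ≡.refl) (inj₁ ends≡′) =
      here (≡.cong proj₁ (≡.trans (≡.sym ends≡′) ends≡))
    edge-visited ((e , _ , inj₁ ends≡) ◅ w) (here ≡.refl) (inj₂ ends≡′) =
      there (≡.subst (_∈ˡ visited w) (≡.cong proj₂ (≡.trans (≡.sym ends≡) ends≡′)) (start-visited w))
    edge-visited ((e , _ , inj₂ ends≡) ◅ w) (here ≡.refl) (inj₁ ends≡′) =
      there (≡.subst (_∈ˡ visited w) (≡.cong proj₁ (≡.trans (≡.sym ends≡) ends≡′)) (start-visited w))
    edge-visited ((e , _ , inj₂ ends≡) ◅ w) (here ≡.refl) (inj₂ ends≡′) =
      here (≡.cong proj₂ (≡.trans (≡.sym ends≡′) ends≡))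
    edge-visited (_ ◅ w) (there e∈) j = there (edge-visited w e∈ j)

    -- Using the first edge again would bring the walk back to its first vertex.
    unique-edges : ∀ {u v} (w : Walk H P u v) → Unique (visited w) → Unique (walkEdges H w)
    unique-edges ε                 uq        = []
    unique-edges ((e , _ , j) ◅ w) (u≢ ∷ uq) =
      All.¬Any⇒All¬ _ (λ e∈ → All.lookup u≢ (edge-visited w e∈ j) ≡.refl) ∷ unique-edges w uq

    edges-satisfy : ∀ {u v} (w : Walk H P u v) → All P (walkEdges H w)
    edges-satisfy ε                  = []
    edges-satisfy ((_ , Pe , _) ◅ w) = Pe ∷ edges-satisfy w

  module _ {P Q : Pred (Fin m) 0ℓ} where

    relabel : ∀ {u v} (w : Walk H P u v) → All Q (walkEdges H w) → Walk H Q u v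
    relabel ε                 []        = ε
    relabel ((e , _ , j) ◅ w) (q ∷ qs) = (e , q , j) ◅ relabel w qs

    relabel-edges : ∀ {u v} (w : Walk H P u v) qs → walkEdges H (relabel w qs) ≡ walkEdges H w
    relabel-edges ε       []       = ≡.refl
    relabel-edges (_ ◅ w) (q ∷ qs) = ≡.cong (_ ∷_) (relabel-edges w qs)

    relabel-vertices : ∀ {u v} (w : Walk H P u v) qs → walkVertices H (relabel w qs) ≡ walkVertices H w
    relabel-vertices ε       []       = ≡.refl
    relabel-vertices (_ ◅ w) (q ∷ qs) = ≡.cong (_ ∷_) (relabel-vertices w qs)

  -- An edge of `F` that is not a bridge, loops included. This form of lying on a cycle is decidable
  -- and translates directly into linear dependence.
  Bypassed : Subset m → Fin m → Set
  Bypassed F e = e ∈ F × Linked H (F ∖ e) (source e) (target e)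

  bypassed? : ∀ F → (∃[ e ] Bypassed F e) ⊎ (∀ e → ¬ Bypassed F e)
  bypassed? F with Fin.any? (λ e → (e ∈? F) ×-dec linked? H (F ∖ e) (source e) (target e))
  ... | yes found = inj₁ found
  ... | no  none  = inj₂ λ e b → none (e , b)

  -- After loop erasure the bypass is a simple path, and `e` closes it to a cycle. The edge is new
  -- because the bypass avoids it.
  acyclic⇒¬bypassed : ∀ {F} → Acyclic H F → ∀ e → ¬ Bypassed F e
  acyclic⇒¬bypassed {F} acyclic e (e∈F , link) with eraseLoops (reverseWalk link)
  ... | w , uq = acyclic (source e , (e , e∈F , inj₁ ≡.refl) ◅ w′ , (λ ()) , edges , vertices′)
    where
    w∈F : All (_∈ F) (walkEdges H w)
    w∈F = All.map (p─q⊆p F _) (edges-satisfy w)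
    w′ : Linked H F (target e) (source e)
    w′ = relabel w w∈F
    edges : Unique (e ∷ walkEdges H w′)
    edges rewrite relabel-edges w w∈F =
      All.map (λ e′∈ e≡e′ → x∉p-x (≡.subst (_∈ F ∖ e) (≡.sym e≡e′) e′∈)) (edges-satisfy w) ∷ unique-edges w uq
    vertices′ : Unique (source e ∷ walkVertices H w′)
    vertices′ rewrite relabel-vertices w w∈F = end-last w uq ∷ unique-vertices w uq

  -- The rest of a cycle bypasses its first edge.
  ¬bypassed⇒acyclic : ∀ {F} → (∀ e → ¬ Bypassed F e) → Acyclic H F
  ¬bypassed⇒acyclic none (v , ε , nonempty , _) = nonempty ≡.refl
  ¬bypassed⇒acyclic {F} none (v , (e , e∈F , j) ◅ w , _ , e≢ ∷ _ , _) = none e (e∈F , link j w′)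
    where
    w′ : Linked H (F ∖ e) _ v
    w′ = relabel w (All.zipWith (λ (e≢e′ , e′∈F) → x∈p∧x≢y⇒x∈p-y e′∈F (e≢e′ ∘ ≡.sym)) (e≢ , edges-satisfy w))
    link : ∀ {t} → Joins H e v t → Linked H (F ∖ e) t v → Linked H (F ∖ e) (source e) (target e)
    link (inj₁ ≡.refl) w = reverseWalk w
    link (inj₂ ≡.refl) w = w

  remove-bypassed : ∀ {F e} → Bypassed F e → ∀ {u v} → Linked H F u v → Linked H (F ∖ e) u v
  remove-bypassed {F} {e} (_ , link) = Star.kleisliStar id step
    where
    step : ∀ {u v} → Step H (_∈ F) u v → Linked H (F ∖ e) u v
    step (f , f∈F , j) with f Fin.≟ e
    ... | no f≢e = (f , x∈p∧x≢y⇒x∈p-y f∈F f≢e , j) ◅ ε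
    step (f , f∈F , inj₁ ≡.refl) | yes ≡.refl = link
    step (f , f∈F , inj₂ ≡.refl) | yes ≡.refl = reverseWalk link

  -- Bypassed edges are deleted one at a time; no connection is lost, and the number of edges drops.
  -- This is where a spanning tree of the quotient comes from.
  acyclic-linking : ∀ F → ∃[ F′ ] (∀ e → ¬ Bypassed F′ e) × (∀ {u v} → Linked H F u v → Linked H F′ u v)
  acyclic-linking F = go F (<-wellFounded ∣ F ∣)
    where
    go : ∀ F → Acc ℕ._<_ ∣ F ∣ → ∃[ F′ ] (∀ e → ¬ Bypassed F′ e) × (∀ {u v} → Linked H F u v → Linked H F′ u v)
    go F (acc rec) with bypassed? F
    ... | inj₂ none    = F , none , id
    ... | inj₁ (e , b) with go (F ∖ e) (rec (x∈p⇒∣p-x∣<∣p∣ (proj₁ b)))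
    ...   | F′ , none , links = F′ , none , links ∘ remove-bypassed b

  linkedDecSetoid : Subset m → DecSetoid 0ℓ 0ℓ
  linkedDecSetoid F = record
    { Carrier = Fin n ; _≈_ = Linked H F
    ; isDecEquivalence = record
        { isEquivalence = record { refl = ε ; sym = reverseWalk ; trans = _◅◅_ } ; _≟_ = linked? H F } }

  record Components (F : Subset m) (s : ℕ) : Set where
    field
      component      : Fin n → Fin s
      representative : Fin s → Fin n
      component-representative : ∀ a → component (representative a) ≡ a
      separates      : ∀ u v → component u ≡ component v ⇔ Linked H F u v

  -- The representatives form the very list whose length is `componentCount`, so edge counts based
  -- on `Components` apply to the forests in `𝓕`.
  components : ∀ F → Components F (length (deduplicate (linked? H F) (allFin n)))
  components F = record
    { component                = λ v → Any.index (cover v)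
    ; representative           = List.lookup reps
    ; component-representative = λ a → injective distinct (reverseWalk (Any.lookup-index (cover (List.lookup reps a))))
    ; separates                = λ u v → record
        { to        = λ eq → Any.lookup-index (cover u) ◅◅
                        ≡.subst (λ a → Linked H F (List.lookup reps a) v) (≡.sym eq)
                          (reverseWalk (Any.lookup-index (cover v)))
        ; from      = λ link → injective distinct
                        (reverseWalk (Any.lookup-index (cover u)) ◅◅ link ◅◅ Any.lookup-index (cover v))
        ; to-cong   = λ { ≡.refl → ≡.refl }
        ; from-cong = λ { ≡.refl → ≡.refl }
        }
    }
    where
    reps = deduplicate (linked? H F) (allFin n)
    distinct : AllPairs (λ u v → ¬ Linked H F u v) reps
    distinct = UniqueDecSetoid.deduplicate-! (linkedDecSetoid F) (allFin n)
    cover : ∀ v → Any (Linked H F v) reps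
    cover v = Any.deduplicate⁺ (linked? H F) (λ x~y v~y → v~y ◅◅ reverseWalk x~y)
                (Any.map (λ { ≡.refl → ε }) (∈-allFin v))
    injective : ∀ {xs} → AllPairs (λ u v → ¬ Linked H F u v) xs →
                ∀ {i j} → Linked H F (List.lookup xs i) (List.lookup xs j) → i ≡ j
    injective (x≁ ∷ _)  {zero}  {zero}  _    = ≡.refl
    injective {xs = x ∷ xs} (x≁ ∷ _) {zero}  {suc j} link = contradiction link (All.lookup x≁ (∈-lookup j))
    injective {xs = x ∷ xs} (x≁ ∷ _) {suc i} {zero}  link = contradiction (reverseWalk link) (All.lookup x≁ (∈-lookup i))
    injective (_ ∷ ≁)   {suc i} {suc j} link = ≡.cong suc (injective ≁ link)

-- Incidence vectors of a multigraph.

module GraphMatrices {a ℓ} (R : CommutativeRing a ℓ)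
  (φ-injective : IntegerMultiples.CharacteristicZero R)
  {n m} (H : Multigraph n m) where
  open CommutativeRing R hiding (zero)
  open LinearAlgebra R
  open Determinants R
  open EnumeratedMatrices R
  open IntegralMatrices R φ-injective
  open RingProperties ring using (-0#≈0#)
  open IntegerMultiples R using (module Solver)
  open Solver using (solve; _:+_; _:-_; :-_; _:=_)
  open SetoidReasoning setoid
  open Walks H
  open Equivalence using () renaming (to to ⇒; from to ⇐)

  𝟙 : ∀ {A : Set} → Dec A → Carrier
  𝟙 A? = if does A? then 1# else 0#

  𝟙-yes : ∀ {A : Set} (A? : Dec A) → A → 𝟙 A? ≈ 1#
  𝟙-yes (yes _) x = refl
  𝟙-yes (no ¬x) x = contradiction x ¬x

  𝟙-no : ∀ {A : Set} (A? : Dec A) → ¬ A → 𝟙 A? ≈ 0#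
  𝟙-no (yes x) ¬x = contradiction x ¬x
  𝟙-no (no _)  ¬x = refl

  𝟙-cong : ∀ {A B : Set} (A? : Dec A) (B? : Dec B) → (A → B) → (B → A) → 𝟙 A? ≈ 𝟙 B?
  𝟙-cong (yes x) B? f g = sym (𝟙-yes B? (f x))
  𝟙-cong (no ¬x) B? f g = sym (𝟙-no B? (¬x ∘ g))

  incidence : Fin m → Fin n → Carrier
  incidence e v = δ v (target e) - δ v (source e)

  integral-incidence : ∀ e v → Integral (incidence e v)
  integral-incidence e v = integral-difference (integral-δ v (target e)) (integral-δ v (source e))

  ∑-δ : ∀ {k} (z : Fin k → Carrier) u → ∑ (fins k) (λ v → z v * δ v u) ≈ z u
  ∑-δ {k} z u = trans (reflexive (∑-def (fins k) _)) (sum-δʳ u z)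

  ∑-δ-difference : ∀ {k} (z : Fin k → Carrier) u v → ∑ (fins k) (λ w → z w * (δ w u - δ w v)) ≈ z u - z v
  ∑-δ-difference {k} z u v = trans (∑-*-difference (fins k) z _ _) (+-cong (∑-δ z u) (-‿cong (∑-δ z v)))

  module _ {k} {ι Ω : Set} {e : Fin k ↔ ι} {b : ι → Ω → Carrier} {Q : ι → Set} where
    open Span e b Q

    -- Differences telescope along the walk. The assignment `t` of vectors to vertices is left free
    -- so that the same argument serves full, grounded and bordered coordinates.
    walk-span : ∀ {P : Pred (Fin m) 0ℓ} (t : Fin n → Ω → Carrier) →
                (∀ f → P f → Spanned (λ w → t (target f) w - t (source f) w)) →
                ∀ {u v} → Walk H P u v → Spanned (λ w → t u w - t v w)
    walk-span t spans {u} ε = span-cong (λ w → sym (-‿inverseʳ (t u w))) span-0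
    walk-span t spans {u} {v} ((f , Pf , inj₁ ≡.refl) ◅ w) = span-cong
      (λ ω → solve 3 (λ u x v → :- (x :- u) :+ (x :- v) := u :- v) refl (t u ω) (t (target f) ω) (t v ω))
      (span-+ (span-neg (spans f Pf)) (walk-span t spans w))
    walk-span t spans {u} {v} ((f , Pf , inj₂ ≡.refl) ◅ w) = span-cong
      (λ ω → solve 3 (λ u x v → u :- x :+ (x :- v) := u :- v) refl (t u ω) (t (source f) ω) (t v ω))
      (span-+ (spans f Pf) (walk-span t spans w))

  module _ {F : Subset m} {s} (C : Components F s) where
    open Components C

    private
      ι = Fin ∣ F ∣ ⊎ Fin s
      e : Fin (∣ F ∣ ℕ.+ s) ↔ ι
      e = fins ∣ F ∣ ⊕ fins s
      b : ι → Fin n → Carrier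
      b (inj₁ i) v = incidence (pick F i) v
      b (inj₂ a) v = δ v (representative a)
      open Span e b (λ _ → Unit)

      -- A unit vector is the representative of its component plus the edge vectors of a walk
      -- joining the two.
      basis : ∀ v → Spanned (Id (fins n) v)
      basis v = span-cong
        (λ w → begin
          δ w v - δ w r + δ w r       ≈⟨ solve 2 (λ x y → x :- y :+ y := x) refl (δ w v) (δ w r) ⟩
          δ w v                       ≈⟨ δ-sym w v ⟩
          δ v w                       ≈⟨ Id-fins v w ⟨
          Id (fins n) v w             ∎)
        (span-+ (walk-span (λ u w → δ w u) (λ f f∈F → edge f f∈F)
                   (⇒ (separates v r) (≡.sym (component-representative (component v)))))
                (span-base {inj₂ (component v)} tt))
        where
        r = representative (component v)
        edge : ∀ f → f ∈ F → Spanned (incidence f)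
        edge f f∈F with pick-surjective F f∈F
        ... | i , ≡.refl = span-base {inj₁ i} tt

      module _ (bridges : ∀ f → ¬ Bypassed F f) where
        side : Fin ∣ F ∣ → Fin n → Carrier
        side i v = 𝟙 (linked? H (F ∖ pick F i) v (target (pick F i)))

        -- The dual basis. For an edge it is the indicator of the target side of the cut made by
        -- removing that edge, shifted on each component to vanish at the representative; for a
        -- component it is its indicator.
        X : Mat ι (Fin n)
        X (inj₁ i) v = side i v - side i (representative (component v))
        X (inj₂ a) v = 𝟙 (component v Fin.≟ a)

        same : ∀ f → f ∈ F → component (target f) ≡ component (source f)
        same f f∈F = ⇐ (separates _ _) (reverseWalk (edgeWalk f∈F))

        inverse : ∀ x y → mul (fins n) X (λ v i → b i v) x y ≈ Id e x y
        inverse x (inj₂ b) = trans (∑-δ (X x) (representative b)) (at-rep x)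
          where
          at-rep : ∀ x → X x (representative b) ≈ Id e x (inj₂ b)
          at-rep (inj₁ i) rewrite component-representative b =
            trans (-‿inverseʳ _) (sym (Id-off e λ ()))
          at-rep (inj₂ a) rewrite component-representative b with b Fin.≟ a
          ... | yes ≡.refl = sym (Id-diag e _)
          ... | no  b≢a    = sym (Id-off e λ { ≡.refl → b≢a ≡.refl })
        inverse x (inj₁ j) = trans (∑-δ-difference (X x) _ _) (difference x)
          where
          f = pick F j
          difference : ∀ x → X x (target f) - X x (source f) ≈ Id e x (inj₁ j)
          difference (inj₂ a) rewrite same f (pick∈ F j) = trans (-‿inverseʳ _) (sym (Id-off e λ ()))
          difference (inj₁ i) = begin
            side i (target f) - side i (representative (component (target f))) -
            (side i (source f) - side i (representative (component (source f))))
              ≡⟨ ≡.cong (λ c → side i (target f) - side i (representative c) - (side i (source f) - r))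
                        (same f (pick∈ F j)) ⟩
            side i (target f) - r - (side i (source f) - r)
              ≈⟨ solve 3 (λ t s r → t :- r :- (s :- r) := t :- s) refl _ _ _ ⟩
            side i (target f) - side i (source f)
              ≈⟨ sides ⟩
            Id e (inj₁ i) (inj₁ j) ∎
            where
            r = side i (representative (component (source f)))
            sides : side i (target f) - side i (source f) ≈ Id e (inj₁ i) (inj₁ j)
            -- Removing edge `i` separates its own ends, since it is a bridge, and keeps the ends of
            -- every other edge of `F` on one side.
            sides with i Fin.≟ j
            ... | yes ≡.refl = trans (+-cong (𝟙-yes (linked? H _ _ _) ε)
                                             (trans (-‿cong (𝟙-no (linked? H _ _ _) λ l → bridges f (pick∈ F i , l)))
                                                    -0#≈0#))
                                     (trans (+-identityʳ 1#) (sym (Id-diag e _)))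
            ... | no  i≢j    = trans (+-congʳ (𝟙-cong (linked? H _ _ _) (linked? H _ _ _)
                                                 (edgeWalk f∈ ◅◅_) (reverseWalk (edgeWalk f∈) ◅◅_)))
                                     (trans (-‿inverseʳ _) (sym (Id-off e λ { ≡.refl → i≢j ≡.refl })))
              where
              f∈ : f ∈ F ∖ pick F i
              f∈ = x∈p∧x≢y⇒x∈p-y (pick∈ F j) (i≢j ∘ ≡.sym ∘ pick-injective F)

    -- The incidence vectors of F together with one vertex per component form a basis.
    acyclic-count : Acyclic H F → ∣ F ∣ ℕ.+ s ≡ n
    acyclic-count acyclic = ℕ.≤-antisym
      (right-inverse⇒≤ e (fins n) _ _ (inverse (acyclic⇒¬bypassed acyclic)))
      (span-≤ (fins n) basis)

casts : ∀ {m n} → m ≡ n → Fin m ↔ Fin n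
casts eq = record
  { to        = cast eq
  ; from      = cast (≡.sym eq)
  ; to-cong   = ≡.cong (cast eq)
  ; from-cong = ≡.cong (cast (≡.sym eq))
  ; inverse   = (λ { ≡.refl → Fin.cast-involutive eq (≡.sym eq) _ })
              , (λ { ≡.refl → Fin.cast-involutive (≡.sym eq) eq _ })
  }

pick′∈ : ∀ {n k} (I : Subset n) (∣I∣≡k : ∣ I ∣ ≡ k) i → pick′ I ∣I∣≡k i ∈ I
pick′∈ I ∣I∣≡k i = pick∈ I _

pick′-injective : ∀ {n k} (I : Subset n) (∣I∣≡k : ∣ I ∣ ≡ k) {i j} → pick′ I ∣I∣≡k i ≡ pick′ I ∣I∣≡k j → i ≡ j
pick′-injective I ≡.refl {i} {j} eq = ≡.trans (≡.sym (Fin.cast-is-id ≡.refl i))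
  (≡.trans (pick-injective I eq) (Fin.cast-is-id ≡.refl j))

pick′-surjective : ∀ {n k} (I : Subset n) (∣I∣≡k : ∣ I ∣ ≡ k) {x} → x ∈ I → ∃[ i ] pick′ I ∣I∣≡k i ≡ x
pick′-surjective I ∣I∣≡k x∈I with pick-surjective I x∈I
... | i , ≡.refl = cast ∣I∣≡k i , ≡.cong (pick I) (Fin.cast-involutive (≡.sym ∣I∣≡k) ∣I∣≡k i)

-- The grounded network matrix and its bordered expansion.

module NetworkDeterminants {a ℓ} (R : CommutativeRing a ℓ)
  (φ-injective : IntegerMultiples.CharacteristicZero R)
  {n m q : ℕ} (G : SimpleGraph (suc n) m) (c : Fin m → CommutativeRing.Carrier R) (S : Superports (suc n) q) where
  open CommutativeRing R hiding (zero)
  open PortNetwork R G c S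
  open SimpleGraph G
  open Superports S
  open Determinants R
  open EnumeratedMatrices R
  open RankOneExpansion R
  open IntegralMatrices R φ-injective
  open GraphMatrices R φ-injective multigraph
  open Walks multigraph
  open SemiringSums semiring using (sum-cong-≋; sum-remove)
  open RingProperties ring using (-0#≈0#; -‿distribˡ-*; -‿distribʳ-*; -‿involutive; +-cancelʳ)
  open IntegerMultiples R using (module Solver)
  open Solver using (solve; _:+_; _:*_; _:-_; :-_; _:=_)
  open Equivalence using () renaming (to to ⇒; from to ⇐)
  open SetoidReasoning setoid

  private
    0-0 : 0# - 0# ≈ 0#
    0-0 = -‿inverseʳ 0#

    1-0 : 1# - 0# ≈ 1#
    1-0 = +-dropʳ refl -0#≈0#

    0-1 : 0# - 1# ≈ - 1#
    0-1 = +-identityˡ _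

  incidence-off : ∀ e {v} → v ≢ source e → v ≢ target e → incidence e v ≈ 0#
  incidence-off e v≢s v≢t = trans (+-cong (δ-off v≢t) (-‿cong (δ-off v≢s))) 0-0

  incidence-source : ∀ e → incidence e (source e) ≈ - 1#
  incidence-source e = trans (+-cong (δ-off λ s≡t → loopless e (source e) (inj₁ (≡.cong (source e ,_) (≡.sym s≡t))))
                                     (-‿cong (δ-diag (source e)))) 0-1

  incidence-target : ∀ e → incidence e (target e) ≈ 1#
  incidence-target e = trans (+-cong (δ-diag (target e))
                                     (-‿cong (δ-off λ t≡s → loopless e (source e) (inj₁ (≡.cong (source e ,_) t≡s))))) 1-0

  incidence-joins : ∀ e {u v} → Joins multigraph e u v → incidence e u * incidence e v ≈ - 1#
  incidence-joins e (inj₁ ≡.refl) = trans (*-cong (incidence-source e) (incidence-target e)) (*-identityʳ _)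
  incidence-joins e (inj₂ ≡.refl) = trans (*-cong (incidence-target e) (incidence-source e)) (*-identityˡ _)

  incidence-¬joins : ∀ e {u v} → u ≢ v → ¬ Joins multigraph e u v → incidence e u * incidence e v ≈ 0#
  incidence-¬joins e {u} {v} u≢v ¬j =
    cases (u Fin.≟ source e) (u Fin.≟ target e) (v Fin.≟ source e) (v Fin.≟ target e)
    where
    cases : Dec (u ≡ source e) → Dec (u ≡ target e) → Dec (v ≡ source e) → Dec (v ≡ target e) →
            incidence e u * incidence e v ≈ 0#
    cases (no u≢s)     (no u≢t)     _            _            = annihilateˡ (incidence-off e u≢s u≢t)
    cases _            _            (no v≢s)     (no v≢t)     = annihilateʳ (incidence-off e v≢s v≢t)
    cases (yes u≡s)    _            (yes v≡s)    _            = contradiction (≡.trans u≡s (≡.sym v≡s)) u≢v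
    cases _            (yes u≡t)    _            (yes v≡t)    = contradiction (≡.trans u≡t (≡.sym v≡t)) u≢v
    cases (yes ≡.refl) _            _            (yes ≡.refl) = contradiction (inj₁ ≡.refl) ¬j
    cases _            (yes ≡.refl) (yes ≡.refl) _            = contradiction (inj₂ ≡.refl) ¬j

  -- On the diagonal `loopless` makes every incident entry ±1, with square 1. Off the diagonal
  -- `no-parallel` leaves at most one edge, whose two entries have product -1.
  laplacian-incidence : ∀ u v → laplacian u v ≈ sum λ e → c e * (incidence e u * incidence e v)
  laplacian-incidence u v with u Fin.≟ v
  ... | yes ≡.refl = sum-cong-≋ {m} λ e → cases e (u Fin.≟ source e) (u Fin.≟ target e)
    where
    square : ∀ {x y : Carrier} → x ≈ y → y * y ≈ 1# → ∀ s → s ≈ s * (x * x)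
    square x≈y yy≈1 s = sym (trans (*-congˡ (trans (*-cong x≈y x≈y) yy≈1)) (*-identityʳ s))
    cases : ∀ e (s? : Dec (u ≡ source e)) (t? : Dec (u ≡ target e)) →
            (if does (s? ⊎-dec t?) then c e else 0#) ≈ c e * (incidence e u * incidence e u)
    cases e (yes ≡.refl) _            = square (incidence-source e) -1*-1≈1 (c e)
    cases e (no _)       (yes ≡.refl) = square (incidence-target e) (*-identityˡ 1#) (c e)
    cases e (no u≢s)     (no u≢t)     = sym (annihilateʳ (annihilateˡ (incidence-off e u≢s u≢t)))
  ... | no u≢v with Fin.any? (λ e → joins? multigraph e u v)
  ...   | yes (e , j) = sym (begin
    sum (λ f → c f * (incidence f u * incidence f v))
      ≈⟨ sum-cong-≋ {m} term ⟩
    sum (λ f → δ e f * - c f)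
      ≈⟨ sum-δˡ e (λ f → - c f) ⟩
    - c e ∎)
    where
    term : ∀ f → c f * (incidence f u * incidence f v) ≈ δ e f * - c f
    term f with e Fin.≟ f
    ... | yes ≡.refl = trans (*-congˡ (incidence-joins e j)) (solve 2 (λ x y → x :* :- y := y :* :- x) refl (c e) 1#)
    ... | no  e≢f    = trans (annihilateʳ (incidence-¬joins f u≢v λ j′ → e≢f (no-parallel e f u v j j′))) (sym (zeroˡ _))
  ...   | no none = sym (sum-zero {m} λ f → annihilateʳ (incidence-¬joins f u≢v λ j → none (f , j)))

  ∂ : Fin m → Fin n → Carrier
  ∂ e w = incidence e (punchIn g w)

  A : Mat (Fin n) (Fin n)
  A w w′ = laplacian (punchIn g w) (punchIn g w′)

  -D : Mat (Fin n) (Fin q)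
  -D w x = - D w x

  Dᵀ : Mat (Fin q) (Fin n)
  Dᵀ x w = D w x

  Vert = Fin n ⊎ Fin q

  eVert : Fin (n ℕ.+ q) ↔ Vert
  eVert = fins n ⊕ fins q

  -- `M₀` is the part of `M` free of conductances, the base matrix of the rank-one expansion.
  M M₀ : Mat Vert Vert
  M  = block A -D Dᵀ O
  M₀ = block O -D Dᵀ O

  module _ {k : ℕ} where

    below : Matrix q k → Mat Vert (Fin k)
    below E (inj₁ w) j = 0#
    below E (inj₂ x) j = E x j

    beside : Matrix q k → Mat (Fin k) Vert
    beside E i (inj₁ w) = 0#
    beside E i (inj₂ x) = - E x i

    Ω = Vert ⊎ Fin k

    eΩ : Fin (n ℕ.+ q ℕ.+ k) ↔ Ω
    eΩ = eVert ⊕ fins k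

    ∂Ω : Fin m → Ω → Carrier
    ∂Ω e (inj₁ (inj₁ w)) = ∂ e w
    ∂Ω e (inj₁ (inj₂ x)) = 0#
    ∂Ω e (inj₂ i)        = 0#

    -- The signs are chosen so that neither the Schur complement of M in W nor the
    -- antidiagonal form of its bordered matrices contributes a sign.
    W W₀ : (E E′ : Matrix q k) → Mat Ω Ω
    W  E E′ = block M (below E′) (beside E) O
    W₀ E E′ = block M₀ (below E′) (beside E) O

    W-rank-one-sum : ∀ E E′ x y → W E E′ x y ≈ W₀ E E′ x y + sum λ e → c e * (∂Ω e x * ∂Ω e y)
    W-rank-one-sum E E′ = pointwise
      where
      zeroˡ′ : ∀ z {f : Fin m → Carrier} → z ≈ z + sum (λ e → c e * (0# * f e))
      zeroˡ′ z = sym (+-dropʳ refl (sum-zero {m} λ e → annihilateʳ (zeroˡ _)))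
      zeroʳ′ : ∀ z {f : Fin m → Carrier} → z ≈ z + sum (λ e → c e * (f e * 0#))
      zeroʳ′ z = sym (+-dropʳ refl (sum-zero {m} λ e → annihilateʳ (zeroʳ _)))
      pointwise : ∀ x y → W E E′ x y ≈ W₀ E E′ x y + sum λ e → c e * (∂Ω e x * ∂Ω e y)
      pointwise (inj₁ (inj₁ w)) (inj₁ (inj₁ w′)) =
        trans (laplacian-incidence (punchIn g w) (punchIn g w′)) (sym (+-identityˡ _))
      pointwise (inj₁ (inj₁ w)) (inj₁ (inj₂ y))  = zeroʳ′ _
      pointwise (inj₁ (inj₁ w)) (inj₂ j)         = zeroʳ′ _
      pointwise (inj₁ (inj₂ x)) (inj₁ (inj₁ w′)) = zeroˡ′ _
      pointwise (inj₁ (inj₂ x)) (inj₁ (inj₂ y))  = zeroˡ′ _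
      pointwise (inj₁ (inj₂ x)) (inj₂ j)         = zeroˡ′ _
      pointwise (inj₂ i)        (inj₁ (inj₁ w′)) = zeroˡ′ _
      pointwise (inj₂ i)        (inj₁ (inj₂ y))  = zeroˡ′ _
      pointwise (inj₂ i)        (inj₂ j)         = zeroˡ′ _

    borderDet : Subset m → (E E′ : Matrix q k) → Carrier
    borderDet F E E′ = Det (fins ∣ F ∣ ⊕ eΩ) (fins ∣ F ∣ ⊕ eΩ) (border F ∂Ω ∂Ω (W₀ E E′))

    Det-W : ∀ E E′ → Det eΩ eΩ (W E E′) ≈ sumSubsets λ F → weight F * borderDet F E E′
    Det-W E E′ = trans (Det-cong eΩ eΩ (W-rank-one-sum E E′)) (Det-rank-one-sum eΩ c ∂Ω ∂Ω (W₀ E E′))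

    module _ (F : Subset m) where

      -- The two sides of the bipartition: vertices and selections have nonzero entries only against
      -- edges and ports.
      Row Col : Set
      Row = Fin n ⊎ Fin k
      Col = Fin ∣ F ∣ ⊎ Fin q

      ∂F : Mat (Fin n) (Fin ∣ F ∣)
      ∂F w i = ∂ (pick F i) w

      -- Up to the order of its indices, the bordered W₀ is [[O, X E], [-(X E′)ᵀ, O]].
      X : Matrix q k → Mat Row Col
      X E = block ∂F -D O λ i x → - E x i

      private
        ψ : (Fin ∣ F ∣ ⊎ Ω) ↔ (Row ⊎ Col)
        ψ = record
          { to        = λ { (inj₁ i) → inj₂ (inj₁ i) ; (inj₂ (inj₁ (inj₁ w))) → inj₁ (inj₁ w)
                          ; (inj₂ (inj₁ (inj₂ x))) → inj₂ (inj₂ x) ; (inj₂ (inj₂ j)) → inj₁ (inj₂ j) }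
          ; from      = λ { (inj₂ (inj₁ i)) → inj₁ i ; (inj₁ (inj₁ w)) → inj₂ (inj₁ (inj₁ w))
                          ; (inj₂ (inj₂ x)) → inj₂ (inj₁ (inj₂ x)) ; (inj₁ (inj₂ j)) → inj₂ (inj₂ j) }
          ; to-cong   = λ { ≡.refl → ≡.refl }
          ; from-cong = λ { ≡.refl → ≡.refl }
          ; inverse   = (λ { {inj₂ (inj₁ i)} ≡.refl → ≡.refl ; {inj₁ (inj₁ w)} ≡.refl → ≡.refl
                           ; {inj₂ (inj₂ x)} ≡.refl → ≡.refl ; {inj₁ (inj₂ j)} ≡.refl → ≡.refl })
                      , (λ { {inj₁ i} ≡.refl → ≡.refl ; {inj₂ (inj₁ (inj₁ w))} ≡.refl → ≡.refl
                           ; {inj₂ (inj₁ (inj₂ x))} ≡.refl → ≡.refl ; {inj₂ (inj₂ j)} ≡.refl → ≡.refl })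
          }

        -Xᵀ : Matrix q k → Mat Col Row
        -Xᵀ E y x = - X E x y

        open Inverse ψ using (to)

        bipartite : ∀ E E′ x y → border F ∂Ω ∂Ω (W₀ E E′) x y ≈ block O (X E) (-Xᵀ E′) O (to x) (to y)
        bipartite E E′ (inj₁ i)               (inj₁ j)               = refl
        bipartite E E′ (inj₁ i)               (inj₂ (inj₁ (inj₁ w))) = refl
        bipartite E E′ (inj₁ i)               (inj₂ (inj₁ (inj₂ y))) = -0#≈0#
        bipartite E E′ (inj₁ i)               (inj₂ (inj₂ l))        = refl
        bipartite E E′ (inj₂ (inj₁ (inj₁ w))) (inj₁ j)               = refl
        bipartite E E′ (inj₂ (inj₁ (inj₁ w))) (inj₂ (inj₁ (inj₁ v))) = refl
        bipartite E E′ (inj₂ (inj₁ (inj₁ w))) (inj₂ (inj₁ (inj₂ y))) = refl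
        bipartite E E′ (inj₂ (inj₁ (inj₁ w))) (inj₂ (inj₂ l))        = refl
        bipartite E E′ (inj₂ (inj₁ (inj₂ x))) (inj₁ j)               = refl
        bipartite E E′ (inj₂ (inj₁ (inj₂ x))) (inj₂ (inj₁ (inj₁ v))) = sym (-‿involutive _)
        bipartite E E′ (inj₂ (inj₁ (inj₂ x))) (inj₂ (inj₁ (inj₂ y))) = refl
        bipartite E E′ (inj₂ (inj₁ (inj₂ x))) (inj₂ (inj₂ l))        = sym (-‿involutive _)
        bipartite E E′ (inj₂ (inj₂ h))        (inj₁ j)               = refl
        bipartite E E′ (inj₂ (inj₂ h))        (inj₂ (inj₁ (inj₁ v))) = refl
        bipartite E E′ (inj₂ (inj₂ h))        (inj₂ (inj₁ (inj₂ y))) = refl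
        bipartite E E′ (inj₂ (inj₂ h))        (inj₂ (inj₂ l))        = refl

      borderDet-square : ∀ {s} (e₁ : Fin s ↔ Row) (e₂ : Fin s ↔ Col) E E′ →
                         borderDet F E E′ ≈ Det e₁ e₂ (X E) * Det e₁ e₂ (X E′)
      borderDet-square e₁ e₂ E E′ = begin
        borderDet F E E′
          ≈⟨ Det-rename (fins ∣ F ∣ ⊕ eΩ) (e₁ ⊕ e₂) ψ _ _ (bipartite E E′) ⟩
        Det (e₁ ⊕ e₂) (e₁ ⊕ e₂) (block O (X E) (-Xᵀ E′) O)
          ≈⟨ Det-antidiagonal e₁ e₂ (X E) (-Xᵀ E′) ⟩
        Det e₁ e₂ (X E) * Det e₂ e₁ (λ y x → - -Xᵀ E′ y x)
          ≈⟨ *-congˡ (trans (Det-cong e₂ e₁ λ y x → -‿involutive _) (sym (Det-transpose e₁ e₂ (X E′)))) ⟩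
        Det e₁ e₂ (X E) * Det e₁ e₂ (X E′) ∎

      borderDet-rectangular : n ℕ.+ k ≢ ∣ F ∣ ℕ.+ q → ∀ E E′ → borderDet F E E′ ≈ 0#
      borderDet-rectangular n+k≢f+q E E′ = trans
        (Det-rename (fins ∣ F ∣ ⊕ eΩ) e ψ _ _ (bipartite E E′))
        (Det-antidiagonal-rectangular e₁ e₂ (X E) (-Xᵀ E′) e n+k≢f+q)
        where
        e₁ = fins n ⊕ fins k
        e₂ = fins ∣ F ∣ ⊕ fins q
        e = e₁ ⊕ e₂

      -- A vertex function that is constant along the edges of `F` and across the ports stays in the
      -- kernel when extended by 0 to all other indices.
      borderDet-right-kernel : ∀ E E′ (z : Fin n → Carrier) w → z w ≈ 1# →
        (∀ i → ∑ (fins n) (λ w → ∂F w i * z w) ≈ 0#) → (∀ x → ∑ (fins n) (λ w → D w x * z w) ≈ 0#) →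
        borderDet F E E′ ≈ 0#
      borderDet-right-kernel E E′ z w₀ zw₀≈1 kernel₁ kernel₂ =
        Det-right-kernel (fins ∣ F ∣ ⊕ eΩ) (fins ∣ F ∣ ⊕ eΩ) bordered z′ (inj₂ (inj₁ (inj₁ w₀))) zw₀≈1 λ v → begin
          ∑ (fins ∣ F ∣ ⊕ eΩ) (λ x → bordered v x * z′ x)
            ≈⟨ ∑-⊕ (fins ∣ F ∣) eΩ _ ⟩
          ∑ (fins ∣ F ∣) (λ i → bordered v (inj₁ i) * 0#) + ∑ eΩ (λ x → bordered v (inj₂ x) * z′ (inj₂ x))
            ≈⟨ +-dropˡ (∑-zero (fins ∣ F ∣) λ i → zeroʳ _) refl ⟩
          ∑ eΩ (λ x → bordered v (inj₂ x) * z′ (inj₂ x))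
            ≈⟨ trans (∑-⊕ eVert (fins k) _) (+-dropʳ refl (∑-zero (fins k) λ j → zeroʳ _)) ⟩
          ∑ eVert (λ x → bordered v (inj₂ (inj₁ x)) * z′ (inj₂ (inj₁ x)))
            ≈⟨ trans (∑-⊕ (fins n) (fins q) _) (+-dropʳ refl (∑-zero (fins q) λ j → zeroʳ _)) ⟩
          ∑ (fins n) (λ w → bordered v (inj₂ (inj₁ (inj₁ w))) * z w)
            ≈⟨ row v ⟩
          0# ∎
        where
        bordered = border F ∂Ω ∂Ω (W₀ E E′)
        z′ : Fin ∣ F ∣ ⊎ Ω → Carrier
        z′ (inj₁ i)               = 0#
        z′ (inj₂ (inj₁ (inj₁ w))) = z w
        z′ (inj₂ (inj₁ (inj₂ x))) = 0#
        z′ (inj₂ (inj₂ j))        = 0#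
        row : ∀ v → ∑ (fins n) (λ w → bordered v (inj₂ (inj₁ (inj₁ w))) * z w) ≈ 0#
        row (inj₁ i) = trans (∑-cong (fins n) λ w → sym (-‿distribˡ-* _ _))
                             (trans (∑-neg (fins n) _) (trans (-‿cong (kernel₁ i)) -0#≈0#))
        row (inj₂ (inj₁ (inj₁ w))) = ∑-zero (fins n) λ w → zeroˡ _
        row (inj₂ (inj₁ (inj₂ x))) = kernel₂ x
        row (inj₂ (inj₂ j))        = ∑-zero (fins n) λ w → zeroˡ _

  -- The convention that the basis vector of `g` is 0 is harmless for functions vanishing at `g`.
  sum-reduced-δ : ∀ (z : Fin (suc n) → Carrier) → z g ≈ 0# → ∀ u →
                  ∑ (fins n) (λ w → z (punchIn g w) * δ (punchIn g w) u) ≈ z u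
  sum-reduced-δ z zg≈0 u with g Fin.≟ u
  ... | yes ≡.refl = trans (∑-zero (fins n) λ w → annihilateʳ (δ-off (Fin.punchInᵢ≢i g w))) (sym zg≈0)
  ... | no  g≢u    = ≡.subst (λ u → ∑ (fins n) (λ w → z (punchIn g w) * δ (punchIn g w) u) ≈ z u)
    (Fin.punchIn-punchOut g≢u)
    (trans (∑-cong (fins n) λ w → *-congˡ (δ-injection (Fin.punchIn-injective g _ _) w (punchOut g≢u)))
           (∑-δ (λ w → z (punchIn g w)) (punchOut g≢u)))

  sum-reduced-difference : ∀ (z : Fin (suc n) → Carrier) → z g ≈ 0# → ∀ u v →
    ∑ (fins n) (λ w → z (punchIn g w) * (δ (punchIn g w) u - δ (punchIn g w) v)) ≈ z u - z v
  sum-reduced-difference z zg≈0 u v = trans (∑-*-difference (fins n) (λ w → z (punchIn g w)) _ _)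
    (+-cong (sum-reduced-δ z zg≈0 u) (-‿cong (sum-reduced-δ z zg≈0 v)))

  -- Completed determinants and spanning trees of the quotient port graph.

  module _ {F : Subset m} {r : ℕ} (o : ComponentOrder F r) where
    open ComponentOrder o
    private
      H = portGraph o
      module HW = Walks H
      module HM = GraphMatrices R φ-injective H

    -- `Q` omits the component of `g`, so each of its rows vanishes at `g` and grounding does not
    -- disturb the product with `D`. What remains is the port graph's incidence matrix without the
    -- row of vertex `zero`.
    B-incidence : ∀ a x → B o a x ≈ HM.incidence x (suc a)
    B-incidence a x = begin
      B o a x
        ≡⟨ ∑-def (fins n) (λ w → Q o a w * D w x) ⟨
      ∑ (fins n) (λ w → Q o a w * D w x)
        ≈⟨ sum-reduced-difference (λ v → δ (component v) (suc a)) at-g (N x) (rootOf (N x)) ⟩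
      δ (component (N x)) (suc a) - δ (component (rootOf (N x))) (suc a)
        ≈⟨ +-cong (δ-sym (component (N x)) (suc a)) (-‿cong (δ-sym (component (rootOf (N x))) (suc a))) ⟩
      HM.incidence x (suc a) ∎
      where
      at-g : δ (component g) (suc a) ≈ 0#
      at-g = δ-off λ eq → Fin.0≢1+n (≡.trans (≡.sym ground≡0) eq)

    module _ {k} (r+k≡q : r ℕ.+ k ≡ q) where

      rows : Fin q ↔ (Fin r ⊎ Fin k)
      rows = Fin.+↔⊎ ↔-∘ casts (≡.sym r+k≡q)

      module _ (I : Subset q) (∣I∣≡k : ∣ I ∣ ≡ k) where

        T : Mat (Fin r ⊎ Fin k) (Fin q)
        T = [ B o , flip (E I ∣I∣≡k) ]

        χ : Carrier
        χ = χ̂ o r+k≡q I ∣I∣≡k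

        χ-Det : χ ≈ Det rows (fins q) T
        χ-Det = reflexive (≡.sym (Det-def rows (fins q) T))

        private
          off-I : ∀ {x} → x ∉ I → ∀ i → δ x (pick′ I ∣I∣≡k i) ≈ 0#
          off-I x∉I i = δ-off λ x≡ → x∉I (≡.subst (_∈ I) (≡.sym x≡) (pick′∈ I ∣I∣≡k i))

          module Columns (P : Fin q → Set) where
            open Span (fins q) (λ x y → T y x) P public

            t : Fin (suc r) → Fin r ⊎ Fin k → Carrier
            t v (inj₁ a) = δ (suc a) v
            t v (inj₂ i) = 0#

            edge : ∀ x → x ∉ I → P x → Spanned (λ y → t (HW.target x) y - t (HW.source x) y)
            edge x x∉I Px = span-cong column (span-base Px)
              where
              column : ∀ y → T y x ≈ t (HW.target x) y - t (HW.source x) y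
              column (inj₁ a) = B-incidence a x
              column (inj₂ i) = trans (off-I x∉I i) (sym (-‿inverseʳ 0#))

        χ-connected : (∀ u v → Linked H (∁ I) u v) → IsUnit χ
        χ-connected connected = Sum.map (trans χ-Det) (trans χ-Det)
          (span-unimodular rows T∈ℤ basis)
          where
          open Columns (λ _ → Unit)
          T∈ℤ : ∀ x y → Integral (T y x)
          T∈ℤ x (inj₁ a) = integral-cong (sym (B-incidence a x)) (HM.integral-incidence x (suc a))
          T∈ℤ x (inj₂ i) = integral-δ x (pick′ I ∣I∣≡k i)
          link : ∀ u v → Spanned (λ y → t u y - t v y)
          link u v = HM.walk-span t (λ x x∈ → edge x (x∈∁p⇒x∉p x∈) tt) (connected u v)
          basis : ∀ y → Spanned (Id rows y)
          basis (inj₁ a) = span-cong vector (link (suc a) zero)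
            where
            vector : ∀ y → t (suc a) y - t zero y ≈ Id rows (inj₁ a) y
            vector (inj₂ i) = trans (-‿inverseʳ 0#) (sym (Id-off rows λ ()))
            vector (inj₁ b) = trans (+-dropʳ refl -0#≈0#) (trans (δ-sym b a)
              (trans (sym (Id-fins a b)) (sym (Id-injection (fins r) rows Sum.inj₁-injective a b))))
          -- The column of a selected port is a unit vector plus the port's edge vector; a walk
          -- between the port's ends outside `I` cancels the latter.
          basis (inj₂ i) = span-cong vector (span-+ (span-base {x} tt) (link (HW.source x) (HW.target x)))
            where
            x = pick′ I ∣I∣≡k i
            vector : ∀ y → T y x + (t (HW.source x) y - t (HW.target x) y) ≈ Id rows (inj₂ i) y
            vector (inj₁ a) = trans (+-congʳ (B-incidence a x))
              (trans (solve 2 (λ s t → t :- s :+ (s :- t) := t :- t) refl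
                       (δ (suc a) (HW.source x)) (δ (suc a) (HW.target x)))
                     (trans (-‿inverseʳ _) (sym (Id-off rows λ ()))))
            vector (inj₂ j) = trans (+-dropʳ refl (-‿inverseʳ 0#))
              (trans (δ-injection (pick′-injective I ∣I∣≡k) i j)
                (trans (sym (Id-fins i j)) (sym (Id-injection (fins k) rows Sum.inj₂-injective i j))))

        -- The indicator of a part away from `zero` is annihilated by the ports outside `I`, which
        -- do not leave the part. A selected port may cross its boundary, and the row of that
        -- selection compensates the crossing.
        χ-disconnected : ∀ v → ¬ Linked H (∁ I) v zero → χ ≈ 0#
        χ-disconnected zero     ¬link = contradiction ε ¬link
        χ-disconnected (suc a₀) ¬link = trans χ-Det
          (Det-left-kernel rows (fins q) T z (inj₁ a₀) (𝟙-yes (linked? H (∁ I) (suc a₀) (suc a₀)) ε) column)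
          where
          side : Fin (suc r) → Carrier
          side u = 𝟙 (linked? H (∁ I) u (suc a₀))
          change : Fin q → Carrier
          change x = side (HW.target x) - side (HW.source x)
          z : Fin r ⊎ Fin k → Carrier
          z (inj₁ a) = side (suc a)
          z (inj₂ i) = - change (pick′ I ∣I∣≡k i)
          side-zero : side zero ≈ 0#
          side-zero = 𝟙-no (linked? H (∁ I) zero (suc a₀)) (¬link ∘ HW.reverseWalk)
          side-linked : ∀ {u v} → Linked H (∁ I) u v → side u ≈ side v
          side-linked {u} {v} link = 𝟙-cong (linked? H (∁ I) u (suc a₀)) (linked? H (∁ I) v (suc a₀))
            (HW.reverseWalk link ◅◅_) (link ◅◅_)
          sum-side : ∀ u → ∑ (fins r) (λ a → side (suc a) * δ (suc a) u) ≈ side u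
          sum-side zero    = trans (∑-zero (fins r) λ a → zeroʳ _) (sym side-zero)
          sum-side (suc u) = ∑-δ (side ∘ suc) u
          top : ∀ x → ∑ (fins r) (λ a → side (suc a) * B o a x) ≈ change x
          top x = trans (∑-cong (fins r) λ a → *-congˡ (B-incidence a x)) (trans
            (∑-*-difference (fins r) (side ∘ suc) (λ a → δ (suc a) (HW.target x)) (λ a → δ (suc a) (HW.source x)))
            (+-cong (sum-side (HW.target x)) (-‿cong (sum-side (HW.source x)))))
          bottom : ∀ x → ∑ (fins k) (λ i → - change (pick′ I ∣I∣≡k i) * δ x (pick′ I ∣I∣≡k i)) ≈ - change x
          bottom x with x ∈? I
          ... | no x∉I = trans
            (∑-zero (fins k) λ i → annihilateʳ (off-I x∉I i))
            (sym (trans (-‿cong (trans (+-congʳ (side-linked (HW.reverseWalk (HW.edgeWalk (x∉p⇒x∈∁p x∉I)))))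
                                       (-‿inverseʳ (side (HW.source x))))) -0#≈0#))
          ... | yes x∈I with pick′-surjective I ∣I∣≡k x∈I
          ...   | j , ≡.refl = trans
            (∑-cong (fins k) λ i → *-congˡ (trans (δ-sym (pick′ I ∣I∣≡k j) (pick′ I ∣I∣≡k i))
                                                  (δ-injection (pick′-injective I ∣I∣≡k) i j)))
            (∑-δ (λ i → - change (pick′ I ∣I∣≡k i)) j)
          column : ∀ x → ∑ rows (λ y → z y * T y x) ≈ 0#
          column x = begin
            ∑ rows (λ y → z y * T y x)
              ≈⟨ ∑-reenumerate rows (fins r ⊕ fins k) _ ⟩
            ∑ (fins r ⊕ fins k) (λ y → z y * T y x)
              ≈⟨ ∑-⊕ (fins r) (fins k) _ ⟩
            ∑ (fins r) (λ a → side (suc a) * B o a x) +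
            ∑ (fins k) (λ i → - change (pick′ I ∣I∣≡k i) * δ x (pick′ I ∣I∣≡k i))
              ≈⟨ +-cong (top x) (bottom x) ⟩
            change x - change x
              ≈⟨ -‿inverseʳ _ ⟩
            0# ∎

        -- Columns outside `I` have no selection entries, so the walk around `e` expresses its whole
        -- column by other columns.
        χ-bypassed : ∀ e → HW.Bypassed (∁ I) e → χ ≈ 0#
        χ-bypassed e (e∈ , link) = trans χ-Det (trans (Det-transpose rows (fins q) T)
          (dependent-row rows (λ e≢e → e≢e ≡.refl) (span-cong column (span-neg bypass))))
          where
          open Columns (_≢ e)
          bypass : Spanned (λ y → t (HW.source e) y - t (HW.target e) y)
          bypass = HM.walk-span t (λ x x∈ → edge x (x∈∁p⇒x∉p (p─q⊆p (∁ I) _ x∈)) λ { ≡.refl → x∉p-x x∈ }) link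
          column : ∀ y → - (t (HW.source e) y - t (HW.target e) y) ≈ T y e
          column (inj₁ a) = trans
            (solve 2 (λ s t → :- (s :- t) := t :- s) refl (δ (suc a) (HW.source e)) (δ (suc a) (HW.target e)))
            (sym (B-incidence a e))
          column (inj₂ i) = trans (trans (-‿cong (-‿inverseʳ 0#)) -0#≈0#) (sym (off-I (x∈∁p⇒x∉p e∈) i))

        χ-spanning-tree : (IsSpanningTree H (∁ I) × IsUnit χ) ⊎ (¬ IsSpanningTree H (∁ I) × χ ≈ 0#)
        χ-spanning-tree with isSpanningTree? H (∁ I)
        ... | yes tree = inj₁ (tree , χ-connected λ u v → proj₂ tree u v ∈⊤ ∈⊤)
        ... | no ¬tree with Fin.all? (λ v → linked? H (∁ I) v zero)
        ...   | no ¬linked = inj₂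
          (¬tree , χ-disconnected _ (proj₂ (Fin.¬∀⟶∃¬ _ _ (λ v → linked? H (∁ I) v zero) ¬linked)))
        ...   | yes linked with HW.bypassed? (∁ I)
        ...     | inj₁ (e , b) = inj₂ (¬tree , χ-bypassed e b)
        ...     | inj₂ none    = contradiction
          (HW.¬bypassed⇒acyclic none , λ u v _ _ → linked u ◅◅ HW.reverseWalk (linked v)) ¬tree

      -- Row operations with the unimodular matrix K turn X into [[1, *], [O, [B; Eᵀ]]].
      module _ (e₁ : Fin (∣ F ∣ ℕ.+ q) ↔ Row {k} F) where
        private
          f = ∣ F ∣
          -- The ground component must be represented by `g` itself, since this vertex disappears in
          -- the grounded coordinates.
          representative : Fin (suc r) → Fin (suc n)
          representative zero    = g
          representative (suc a) = proj₁ (surjective (suc a))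

          component-representative : ∀ a → component (representative a) ≡ a
          component-representative zero    = ground≡0
          component-representative (suc a) = proj₂ (surjective (suc a))

          Mid = Fin f ⊎ (Fin r ⊎ Fin k)
          mid : Fin (f ℕ.+ q) ↔ Mid
          mid = fins f ⊕ rows

          e₂ : Fin (f ℕ.+ q) ↔ Col {k} F
          e₂ = fins f ⊕ fins q

          module Edges = Span (fins f) (λ i → incidence (pick F i)) (λ _ → Unit)
          open Edges using (Spanned; coefficient; integral; combination; span-base)

          to-representative : ∀ v → Spanned (λ w → δ w v - δ w (representative (component v)))
          to-representative v = walk-span (λ u w → δ w u) edge
            (⇒ (separates v _) (≡.sym (component-representative (component v))))
            where
            edge : ∀ h → h ∈ F → Spanned (incidence h)
            edge h h∈F with pick-surjective F h∈F
            ... | i , ≡.refl = span-base tt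

          Z : Mat (Fin f) (Fin n)
          Z i w = coefficient (to-representative (punchIn g w)) i

          Y : Mat (Fin n) (Fin r)
          Y w a = δ (punchIn g w) (representative (suc a))

          -- `Z` carries a vertex to the representative of its component along edges of `F`, `Q`
          -- reads off the component and `Y` places its representative.
          ∂Z+YQ : ∀ w w′ → mul (fins f) (∂F {k} F) Z w w′ + mul (fins r) Y (Q o) w w′ ≈ Id (fins n) w w′
          ∂Z+YQ w w′ = begin
            mul (fins f) (∂F {k} F) Z w w′ + mul (fins r) Y (Q o) w w′
              ≈⟨ +-cong (trans (∑-cong (fins f) λ i → *-comm _ _) (sym (combination (to-representative v′) v)))
                        (YQ (component v′) ≡.refl) ⟩
            δ v v′ - δ v (representative (component v′)) + δ v (representative (component v′))
              ≈⟨ solve 2 (λ x y → x :- y :+ y := x) refl (δ v v′) (δ v (representative (component v′))) ⟩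
            δ v v′
              ≈⟨ trans (δ-injection (Fin.punchIn-injective g _ _) w w′) (sym (Id-fins w w′)) ⟩
            Id (fins n) w w′ ∎
            where
            v = punchIn g w
            v′ = punchIn g w′
            YQ : ∀ b → component v′ ≡ b → ∑ (fins r) (λ a → δ v (representative (suc a)) * δ (component v′) (suc a)) ≈
                 δ v (representative (component v′))
            YQ zero    eq rewrite eq = trans (∑-zero (fins r) λ a → zeroʳ _) (sym (δ-off (Fin.punchInᵢ≢i g w)))
            YQ (suc b) eq rewrite eq = trans (∑-cong (fins r) λ a → *-congˡ (δ-sym b a))
              (∑-δ (λ a → δ v (representative (suc a))) b)

          ∑-mid : ∀ (h : Mid → Carrier) → ∑ mid h ≈ ∑ (fins f) (h ∘ inj₁) +
                  (∑ (fins r) (λ a → h (inj₂ (inj₁ a))) + ∑ (fins k) (λ i → h (inj₂ (inj₂ i))))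
          ∑-mid h = trans (∑-⊕ (fins f) rows h) (+-congˡ
            (trans (∑-reenumerate rows (fins r ⊕ fins k) _) (∑-⊕ (fins r) (fins k) _)))

          -- The minus signs match those of -D and -Eᵀ in `X`, so that the reduced matrix contains
          -- `T` itself.
          K : Mat (Row F) Mid
          K (inj₁ w) (inj₁ i)        = ∂F {k} F w i
          K (inj₁ w) (inj₂ (inj₁ a)) = - Y w a
          K (inj₁ w) (inj₂ (inj₂ j)) = 0#
          K (inj₂ i) (inj₁ j)        = 0#
          K (inj₂ i) (inj₂ (inj₁ a)) = 0#
          K (inj₂ i) (inj₂ (inj₂ j)) = - Id (fins k) i j

          K⁻¹ : Mat Mid (Row F)
          K⁻¹ (inj₁ i)        (inj₁ w) = Z i w
          K⁻¹ (inj₂ (inj₁ a)) (inj₁ w) = - Q o a w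
          K⁻¹ (inj₂ (inj₂ j)) (inj₁ w) = 0#
          K⁻¹ (inj₁ j)        (inj₂ i) = 0#
          K⁻¹ (inj₂ (inj₁ a)) (inj₂ i) = 0#
          K⁻¹ (inj₂ (inj₂ j)) (inj₂ i) = - Id (fins k) j i

          neg-neg : ∀ x y → - x * - y ≈ x * y
          neg-neg = solve 2 (λ x y → :- x :* :- y := x :* y) refl

          KK⁻¹ : ∀ x y → mul mid K K⁻¹ x y ≈ Id e₁ x y
          KK⁻¹ x y = trans (∑-mid _) (entry x y)
            where
            entry : ∀ x y → ∑ (fins f) (λ i → K x (inj₁ i) * K⁻¹ (inj₁ i) y) +
              (∑ (fins r) (λ a → K x (inj₂ (inj₁ a)) * K⁻¹ (inj₂ (inj₁ a)) y) +
               ∑ (fins k) (λ i → K x (inj₂ (inj₂ i)) * K⁻¹ (inj₂ (inj₂ i)) y)) ≈ Id e₁ x y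
            entry (inj₁ w) (inj₁ w′) = trans
              (+-congˡ (+-dropʳ (∑-cong (fins r) λ a → neg-neg _ _) (∑-zero (fins k) λ i → zeroˡ _)))
              (trans (∂Z+YQ w w′) (sym (Id-injection (fins n) e₁ Sum.inj₁-injective w w′)))
            entry (inj₁ w) (inj₂ j) = trans (+-cong (∑-zero (fins f) λ i → zeroʳ _)
              (+-dropˡ (∑-zero (fins r) λ a → zeroʳ _) (∑-zero (fins k) λ i → zeroˡ _)))
              (trans (+-identityˡ 0#) (sym (Id-off e₁ λ ())))
            entry (inj₂ i) (inj₁ w) = trans (+-cong (∑-zero (fins f) λ i → zeroˡ _)
              (+-dropˡ (∑-zero (fins r) λ a → zeroˡ _) (∑-zero (fins k) λ i → zeroʳ _)))
              (trans (+-identityˡ 0#) (sym (Id-off e₁ λ ())))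
            entry (inj₂ i) (inj₂ j) = trans (+-cong (∑-zero (fins f) λ i → zeroˡ _)
              (+-dropˡ (∑-zero (fins r) λ a → zeroˡ _) (trans (∑-cong (fins k) λ l → neg-neg _ _)
                       (∑-Idˡ (fins k) i λ l → Id (fins k) l j))))
              (trans (+-identityˡ _) (sym (Id-injection (fins k) e₁ Sum.inj₂-injective i j)))

          κ : Carrier
          κ = Det e₁ mid K

          κ-unit : IsUnit κ
          κ-unit = Det-unimodular e₁ mid K K⁻¹ K∈ℤ K⁻¹∈ℤ KK⁻¹
            where
            K∈ℤ : ∀ x y → Integral (K x y)
            K∈ℤ (inj₁ w) (inj₁ i)        = integral-incidence (pick F i) (punchIn g w)
            K∈ℤ (inj₁ w) (inj₂ (inj₁ a)) = integral-neg (integral-δ (punchIn g w) (representative (suc a)))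
            K∈ℤ (inj₁ w) (inj₂ (inj₂ j)) = integral-0
            K∈ℤ (inj₂ i) (inj₁ j)        = integral-0
            K∈ℤ (inj₂ i) (inj₂ (inj₁ a)) = integral-0
            K∈ℤ (inj₂ i) (inj₂ (inj₂ j)) = integral-neg (integral-Id (fins k) i j)
            K⁻¹∈ℤ : ∀ x y → Integral (K⁻¹ x y)
            K⁻¹∈ℤ (inj₁ i)        (inj₁ w) = integral (to-representative (punchIn g w)) i
            K⁻¹∈ℤ (inj₂ (inj₁ a)) (inj₁ w) = integral-neg (integral-δ (component (punchIn g w)) (suc a))
            K⁻¹∈ℤ (inj₂ (inj₂ j)) (inj₁ w) = integral-0
            K⁻¹∈ℤ (inj₁ j)        (inj₂ i) = integral-0
            K⁻¹∈ℤ (inj₂ (inj₁ a)) (inj₂ i) = integral-0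
            K⁻¹∈ℤ (inj₂ (inj₂ j)) (inj₂ i) = integral-neg (integral-Id (fins k) j i)

          module _ (I : Subset q) (∣I∣≡k : ∣ I ∣ ≡ k) where
            -ZD : Mat (Fin f) (Fin q)
            -ZD i x = - mul (fins n) Z D i x

            reduced : Mat Mid (Col {k} F)
            reduced = block (Id (fins f)) -ZD O (T I ∣I∣≡k)

            factor : ∀ x y → mul mid K reduced x y ≈ X F (E I ∣I∣≡k) x y
            factor x y = trans (∑-mid _) (entry x y)
              where
              entry : ∀ x y → ∑ (fins f) (λ i → K x (inj₁ i) * reduced (inj₁ i) y) +
                (∑ (fins r) (λ a → K x (inj₂ (inj₁ a)) * reduced (inj₂ (inj₁ a)) y) +
                 ∑ (fins k) (λ i → K x (inj₂ (inj₂ i)) * reduced (inj₂ (inj₂ i)) y)) ≈ X F (E I ∣I∣≡k) x y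
              entry (inj₁ w) (inj₁ j) = +-dropʳ (∑-Idʳ (fins f) j (∂F {k} F w))
                (+-dropˡ (∑-zero (fins r) λ a → zeroʳ _) (∑-zero (fins k) λ i → zeroʳ _))
              -- Since `B` is `Q` times `D`, both contributions are multiples of `D`, and their sum
              -- is -(∂Z + YQ)D = -D.
              entry (inj₁ w) (inj₂ x) = begin
                ∑ (fins f) (λ i → ∂F {k} F w i * - mul (fins n) Z D i x) +
                (∑ (fins r) (λ a → - Y w a * B o a x) + ∑ (fins k) (λ i → 0# * E I ∣I∣≡k x i))
                  ≈⟨ +-cong (trans (∑-cong (fins f) λ i → sym (-‿distribʳ-* _ _)) (∑-neg (fins f) _))
                       (+-dropʳ (trans (∑-cong (fins r) λ a → sym (-‿distribˡ-* _ _)) (∑-neg (fins r) _))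
                                      (∑-zero (fins k) λ i → zeroˡ _)) ⟩
                - ∑ (fins f) (λ i → ∂F {k} F w i * mul (fins n) Z D i x) - ∑ (fins r) (λ a → Y w a * B o a x)
                  ≈⟨ solve 2 (λ x y → :- x :- y := :- (x :+ y)) refl _ _ ⟩
                - (∑ (fins f) (λ i → ∂F {k} F w i * mul (fins n) Z D i x) + ∑ (fins r) (λ a → Y w a * B o a x))
                  ≈⟨ -‿cong (+-congˡ (∑-cong (fins r) λ a → *-congˡ (reflexive (≡.sym (∑-def (fins n) _))))) ⟩
                - (mul (fins f) (∂F {k} F) (mul (fins n) Z D) w x + mul (fins r) Y (mul (fins n) (Q o) D) w x)
                  ≈⟨ -‿cong (+-cong (mul-assoc (fins f) (fins n) (∂F {k} F) Z D w x)
                                    (mul-assoc (fins r) (fins n) Y (Q o) D w x)) ⟩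
                - (mul (fins n) (mul (fins f) (∂F {k} F) Z) D w x + mul (fins n) (mul (fins r) Y (Q o)) D w x)
                  ≈⟨ -‿cong (trans (sym (∑-+ (fins n) _ _))
                       (∑-cong (fins n) λ w′ → trans (sym (distribʳ _ _ _)) (*-congʳ (∂Z+YQ w w′)))) ⟩
                - mul (fins n) (Id (fins n)) D w x
                  ≈⟨ -‿cong (mul-Idˡ (fins n) D w x) ⟩
                - D w x ∎
              entry (inj₂ i) (inj₁ j) = +-dropˡ (∑-zero (fins f) λ _ → zeroˡ _)
                (+-dropˡ (∑-zero (fins r) λ a → zeroˡ _) (∑-zero (fins k) λ i → zeroʳ _))
              entry (inj₂ i) (inj₂ x) = +-dropˡ (∑-zero (fins f) λ _ → zeroˡ _)
                (+-dropˡ (∑-zero (fins r) λ a → zeroˡ _)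
                  (trans (∑-cong (fins k) λ j → sym (-‿distribˡ-* _ _))
                  (trans (∑-neg (fins k) _) (-‿cong (∑-Idˡ (fins k) i λ j → E I ∣I∣≡k x j)))))

            Det-X : Det e₁ e₂ (X F (E I ∣I∣≡k)) ≈ κ * χ I ∣I∣≡k
            Det-X = begin
              Det e₁ e₂ (X F (E I ∣I∣≡k))
                ≈⟨ Det-cong e₁ e₂ factor ⟨
              Det e₁ e₂ (mul mid K reduced)
                ≈⟨ Det-mul e₁ mid e₂ K reduced ⟩
              κ * Det mid e₂ reduced
                ≈⟨ *-congˡ (Det-block-upper (fins f) (fins f) rows (fins q) (Id (fins f)) -ZD (T I ∣I∣≡k)) ⟩
              κ * (Det (fins f) (fins f) (Id (fins f)) * Det rows (fins q) (T I ∣I∣≡k))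
                ≈⟨ *-congˡ (trans (*-congʳ (Det-Id (fins f))) (*-identityˡ _)) ⟩
              κ * Det rows (fins q) (T I ∣I∣≡k)
                ≈⟨ *-congˡ (χ-Det I ∣I∣≡k) ⟨
              κ * χ I ∣I∣≡k ∎

        borderDet-α : ∀ I J (∣I∣≡k : ∣ I ∣ ≡ k) (∣J∣≡k : ∣ J ∣ ≡ k) →
                      borderDet F (E I ∣I∣≡k) (E J ∣J∣≡k) ≈ α o r+k≡q I J ∣I∣≡k ∣J∣≡k
        borderDet-α I J ∣I∣≡k ∣J∣≡k = begin
          borderDet F (E I ∣I∣≡k) (E J ∣J∣≡k)
            ≈⟨ borderDet-square F e₁ e₂ _ _ ⟩
          Det e₁ e₂ (X F (E I ∣I∣≡k)) * Det e₁ e₂ (X F (E J ∣J∣≡k))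
            ≈⟨ *-cong (Det-X I ∣I∣≡k) (Det-X J ∣J∣≡k) ⟩
          κ * χ I ∣I∣≡k * (κ * χ J ∣J∣≡k)
            ≈⟨ solve 3 (λ k x y → k :* x :* (k :* y) := k :* k :* (x :* y)) refl κ _ _ ⟩
          κ * κ * (χ I ∣I∣≡k * χ J ∣J∣≡k)
            ≈⟨ trans (*-congʳ (unit-square κ-unit)) (*-identityˡ _) ⟩
          χ I ∣I∣≡k * χ J ∣J∣≡k ∎

  -- Spanning trees of the quotient network and valid forests.

  private
    Hq = quotient G
    module HW = Walks Hq
    module HM = GraphMatrices R φ-injective Hq

  rootOf-just : ∀ {v a} → port v ≡ just a → rootOf v ≡ root a
  rootOf-just {v} eq = ≡.cong (maybe′ root v) eq

  rootOf-nothing : ∀ {v} → port v ≡ nothing → rootOf v ≡ v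
  rootOf-nothing {v} eq = ≡.cong (maybe′ root v) eq

  rootOf-root : ∀ b → rootOf (root b) ≡ root b
  rootOf-root b = rootOf-just (root-port b)

  rootOf-idempotent : ∀ v → rootOf (rootOf v) ≡ rootOf v
  rootOf-idempotent v = cases (port v) ≡.refl
    where
    cases : ∀ b → port v ≡ b → rootOf (rootOf v) ≡ rootOf v
    cases (just b) eq = ≡.trans (≡.cong rootOf (rootOf-just eq)) (≡.trans (rootOf-root b) (≡.sym (rootOf-just eq)))
    cases nothing  eq = ≡.cong rootOf (rootOf-nothing eq)

  N-moves : ∀ x → rootOf (N x) ≢ N x
  N-moves x eq with ⇒ (N-image (N x)) (x , ≡.refl)
  ... | b , port≡ , N≢root = N≢root (≡.trans (≡.sym eq) (rootOf-just port≡))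

  moves⇒N : ∀ v → rootOf v ≢ v → ∃[ x ] N x ≡ v
  moves⇒N v moves = cases (port v) ≡.refl
    where
    cases : ∀ b → port v ≡ b → ∃[ x ] N x ≡ v
    cases (just b) eq = ⇐ (N-image v) (b , eq , λ v≡root → moves (≡.trans (rootOf-just eq) (≡.sym v≡root)))
    cases nothing  eq = contradiction (rootOf-nothing eq) moves

  vertex⁺ : ∀ {v} → rootOf v ≡ v → v ∈ Multigraph.vertices Hq
  vertex⁺ {v} eq = lookup⇒[]= v _
    (≡.trans (lookup∘tabulate (λ v → does (rootOf v Fin.≟ v)) v) (dec-true (rootOf v Fin.≟ v) eq))

  vertex⁻ : ∀ {v} → v ∈ Multigraph.vertices Hq → rootOf v ≡ v
  vertex⁻ {v} v∈ = cases (rootOf v Fin.≟ v)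
    (≡.trans (≡.sym (lookup∘tabulate (λ v → does (rootOf v Fin.≟ v)) v)) ([]=⇒lookup v∈))
    where
    cases : (eq? : Dec (rootOf v ≡ v)) → does eq? ≡ true → rootOf v ≡ v
    cases (yes eq) _ = eq

  quotientWalk : ∀ {P : Pred (Fin m) 0ℓ} {u v} → Walk multigraph P u v → Walk Hq P (rootOf u) (rootOf v)
  quotientWalk = Star.gmap rootOf λ (e , Pe , j) → e , Pe , Sum.map (≡.cong image) (≡.cong image) j
    where
    image : Fin (suc n) × Fin (suc n) → Fin (suc n) × Fin (suc n)
    image = Product.map rootOf rootOf

  quotient-bypassed : ∀ {F e} → Bypassed F e → HW.Bypassed F e
  quotient-bypassed (e∈F , link) = e∈F , quotientWalk link

  -- The quotient keeps all vertex names, and the non-root boundary vertices become isolated. A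
  -- spanning tree therefore leaves these `q` singletons and the tree itself.
  tree-components : ∀ {F} → IsSpanningTree Hq F → HW.Components F (suc q)
  tree-components {F} tree = record
    { component                = λ v → index v (isN? v)
    ; representative           = λ { zero → g ; (suc x) → N x }
    ; component-representative = λ { zero → fixed (rootOf-root ground) ; (suc x) → index-N x (isN? (N x)) }
    ; separates                = λ u v → mk⇔ (linked u v (isN? u) (isN? v)) constant
    }
    where
    isN? : ∀ v → Dec (∃[ x ] N x ≡ v)
    isN? v = Fin.any? λ x → N x Fin.≟ v
    index : ∀ v → Dec (∃[ x ] N x ≡ v) → Fin (suc q)
    index v (yes (x , _)) = suc x
    index v (no _)        = zero
    index-N : ∀ x (N? : Dec (∃[ y ] N y ≡ N x)) → index (N x) N? ≡ suc x
    index-N x (yes (y , Ny≡Nx)) = ≡.cong suc (N-injective y x Ny≡Nx)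
    index-N x (no none)         = contradiction (x , ≡.refl) none
    fixed : ∀ {v} → rootOf v ≡ v → index v (isN? v) ≡ zero
    fixed {v} eq with isN? v
    ... | yes (x , ≡.refl) = contradiction eq (N-moves x)
    ... | no _             = ≡.refl
    not-N : ∀ v → ¬ (∃[ x ] N x ≡ v) → rootOf v ≡ v
    not-N v none = decidable-stable (rootOf v Fin.≟ v) (none ∘ moves⇒N v)
    linked : ∀ u v (u? : Dec (∃[ x ] N x ≡ u)) (v? : Dec (∃[ x ] N x ≡ v)) → index u u? ≡ index v v? → Linked Hq F u v
    linked u v (yes (x , ≡.refl)) (yes (y , ≡.refl)) eq rewrite Fin.suc-injective eq = ε
    linked u v (no ¬u) (no ¬v) eq = proj₂ tree u v (vertex⁺ (not-N u ¬u)) (vertex⁺ (not-N v ¬v))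
    step : ∀ {u v} → Step Hq (_∈ F) u v → rootOf u ≡ u × rootOf v ≡ v
    step (e , _ , inj₁ ≡.refl) = rootOf-idempotent (source e) , rootOf-idempotent (target e)
    step (e , _ , inj₂ ≡.refl) = rootOf-idempotent (target e) , rootOf-idempotent (source e)
    constant : ∀ {u v} → Linked Hq F u v → index u (isN? u) ≡ index v (isN? v)
    constant ε       = ≡.refl
    constant (s ◅ w) = ≡.trans (≡.trans (fixed (proj₁ (step s))) (≡.sym (fixed (proj₂ (step s))))) (constant w)

  tree-size : ∀ {F} → IsSpanningTree Hq F → n ℕ.+ 0 ≡ ∣ F ∣ ℕ.+ q
  tree-size {F} tree = ≡.trans (ℕ.+-identityʳ n) (≡.sym (ℕ.suc-injective
    (≡.trans (≡.sym (ℕ.+-suc ∣ F ∣ q)) (HM.acyclic-count (tree-components tree) (proj₁ tree)))))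

  -- Dependence of an edge is tested among the border rows, where the row of an edge is its negated
  -- grounded incidence vector.
  module BorderRows {k : ℕ} (F : Subset m) (E E′ : Matrix q k) (P : Fin ∣ F ∣ ⊎ Ω {k} → Set) where
    open Span (fins ∣ F ∣ ⊕ eΩ) (border F ∂Ω ∂Ω (W₀ E E′)) P public

    t : Fin (suc n) → Fin ∣ F ∣ ⊎ Ω {k} → Carrier
    t v (inj₂ (inj₁ (inj₁ w))) = δ (punchIn g w) v
    t v _                      = 0#

    edge : ∀ {e} → (∀ {i} → pick F i ≡ e → P (inj₁ i)) → e ∈ F → Spanned (λ w → t (target e) w - t (source e) w)
    edge Pe e∈F with pick-surjective F e∈F
    ... | i , ≡.refl = span-cong row (span-neg (span-base (Pe ≡.refl)))
      where
      row : ∀ x → - border F ∂Ω ∂Ω (W₀ E E′) (inj₁ i) x ≈ t (target (pick F i)) x - t (source (pick F i)) x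
      row (inj₁ j)               = trans -0#≈0# (sym (-‿inverseʳ 0#))
      row (inj₂ (inj₁ (inj₁ w))) = -‿involutive _
      row (inj₂ (inj₁ (inj₂ x))) = trans (-‿involutive _) (sym (-‿inverseʳ 0#))
      row (inj₂ (inj₂ l))        = trans (-‿involutive _) (sym (-‿inverseʳ 0#))

    dependent-edge : ∀ i → ¬ P (inj₁ i) → Spanned (λ w → t (target (pick F i)) w - t (source (pick F i)) w) →
                     borderDet F E E′ ≈ 0#
    dependent-edge i ¬Pi s = dependent-row (fins ∣ F ∣ ⊕ eΩ) ¬Pi (span-cong row (span-neg s))
      where
      row : ∀ x → - (t (target (pick F i)) x - t (source (pick F i)) x) ≈ border F ∂Ω ∂Ω (W₀ E E′) (inj₁ i) x
      row (inj₁ j)               = trans (-‿cong (-‿inverseʳ 0#)) -0#≈0#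
      row (inj₂ (inj₁ (inj₁ w))) = refl
      row (inj₂ (inj₁ (inj₂ x))) = -‿cong (-‿inverseʳ 0#)
      row (inj₂ (inj₂ l))        = -‿cong (-‿inverseʳ 0#)

  bypassed-borderDet : ∀ {k} F (E E′ : Matrix q k) e → Bypassed F e → borderDet F E E′ ≈ 0#
  bypassed-borderDet F E E′ e (e∈F , link) with pick-surjective F e∈F
  ... | i₀ , ≡.refl = dependent-edge i₀ (λ i₀≢i₀ → i₀≢i₀ ≡.refl)
      (span-cong (λ w → solve 2 (λ s t → :- (s :- t) := t :- s) refl (t (source e) w) (t (target e) w))
        (span-neg (walk-span t (λ h h∈ → edge (λ { ≡.refl → λ { ≡.refl → x∉p-x h∈ } }) (p─q⊆p F _ h∈)) link)))
    where open BorderRows F E E′ (_≢ inj₁ i₀)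

  module _ {s} {ι Ω : Set} {e : Fin s ↔ ι} {b : ι → Ω → Carrier} {P : ι → Set} (t : Fin (suc n) → Ω → Carrier)
           (ports : ∀ x → Span.Spanned e b P (λ w → t (N x) w - t (rootOf (N x)) w)) where
    open Span e b P

    -- Modulo the port vectors a vertex equals its root. This lifts walks of the quotient to
    -- combinations of edge and port vectors of the network.
    contraction : ∀ v → Spanned (λ w → t v w - t (rootOf v) w)
    contraction v with rootOf v Fin.≟ v
    ... | yes eq = span-cong
      (λ w → sym (trans (+-congˡ (-‿cong (reflexive (≡.cong (λ u → t u w) eq)))) (-‿inverseʳ _))) span-0
    ... | no moves with moves⇒N v moves
    ...   | x , ≡.refl = ports x

    quotient-edge : ∀ {f} → Spanned (λ w → t (target f) w - t (source f) w) →
                    Spanned (λ w → t (HW.target f) w - t (HW.source f) w)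
    quotient-edge {f} edge = span-cong
      (λ w → solve 4 (λ t t′ s s′ → t :- s :+ (:- (t :- t′) :+ (s :- s′)) := t′ :- s′) refl
         (t (target f) w) (t (rootOf (target f)) w) (t (source f) w) (t (rootOf (source f)) w))
      (span-+ edge (span-+ (span-neg (contraction (target f))) (contraction (source f))))

  module _ (F : Subset m) (E₀ E₀′ : Matrix q 0) where

    tree-borderDet : IsSpanningTree Hq F → borderDet F E₀ E₀′ ≈ 1#
    tree-borderDet tree = begin
      borderDet F E₀ E₀′                         ≈⟨ borderDet-square F e₁ e₂ E₀ E₀′ ⟩
      Det e₁ e₂ (X F E₀) * Det e₁ e₂ (X F E₀′)   ≈⟨ *-congˡ (Det-cong e₁ e₂ λ { (inj₁ w) (inj₁ i) → refl
                                                                              ; (inj₁ w) (inj₂ x) → refl }) ⟩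
      Det e₁ e₂ (X F E₀) * Det e₁ e₂ (X F E₀)    ≈⟨ unit-square (span-unimodular e₁ X∈ℤ basis) ⟩
      1#                                         ∎
      where
      open Span (fins ∣ F ∣ ⊕ fins q) (λ y x → X F E₀ x y) (λ _ → Unit)
      t : Fin (suc n) → Row {0} F → Carrier
      t v (inj₁ w) = δ (punchIn g w) v
      ports : ∀ x → Spanned (λ w → t (N x) w - t (rootOf (N x)) w)
      ports x = span-cong (λ { (inj₁ w) → -‿involutive _ }) (span-neg (span-base {inj₂ x} tt))
      e₂ = fins ∣ F ∣ ⊕ fins q
      e₁ : Fin (∣ F ∣ ℕ.+ q) ↔ Row {0} F
      e₁ = ≡.subst (λ s → Fin s ↔ Row {0} F) (tree-size tree) (fins n ⊕ fins 0)
      X∈ℤ : ∀ y x → Integral (X F E₀ x y)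
      X∈ℤ (inj₁ i) (inj₁ w) = integral-incidence (pick F i) (punchIn g w)
      X∈ℤ (inj₂ x) (inj₁ w) = integral-neg
        (integral-difference (integral-δ (punchIn g w) (N x)) (integral-δ (punchIn g w) (rootOf (N x))))
      link : ∀ e → e ∈ F → Spanned (λ w → t (HW.target e) w - t (HW.source e) w)
      link e e∈F with pick-surjective F e∈F
      ... | i , ≡.refl = quotient-edge t ports (span-cong (λ { (inj₁ w) → refl }) (span-base {inj₁ i} tt))
      basis : ∀ x → Spanned (Id e₁ x)
      -- The unit vector of `v` is moved to the root by ports and then through the tree to `g`,
      -- whose grounded vector is 0.
      basis (inj₁ w) = span-cong vector (span-+ (contraction t ports v) (HM.walk-span t link
          (proj₂ tree (rootOf v) g (vertex⁺ (rootOf-idempotent v)) (vertex⁺ (rootOf-root ground)))))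
        where
        v = punchIn g w
        vector : ∀ x → t v x - t (rootOf v) x + (t (rootOf v) x - t g x) ≈ Id e₁ (inj₁ w) x
        vector (inj₁ w′) = trans (solve 3 (λ v r g → v :- r :+ (r :- g) := v :- g) refl
                                    (δ (punchIn g w′) v) (δ (punchIn g w′) (rootOf v)) (δ (punchIn g w′) g))
          (trans (+-congˡ (-‿cong (δ-off (Fin.punchInᵢ≢i g w′)))) (trans (+-congˡ -0#≈0#) (trans (+-identityʳ _)
            (trans (δ-injection (Fin.punchIn-injective g _ _) w′ w) (trans (δ-sym w′ w)
              (trans (sym (Id-fins w w′)) (sym (Id-injection (fins n) e₁ Sum.inj₁-injective w w′))))))))

    -- A bypass in the quotient may jump between vertices of a superport; the port rows Dᵀ pay for
    -- the jumps. They are pure vertex vectors because the selection is empty.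
    quotient-bypassed-borderDet : ∀ e → HW.Bypassed F e → borderDet F E₀ E₀′ ≈ 0#
    quotient-bypassed-borderDet e (e∈F , link) with pick-surjective F e∈F
    ... | i₀ , ≡.refl = dependent-edge i₀ (λ i₀≢i₀ → i₀≢i₀ ≡.refl) (span-cong
        (λ w → solve 4 (λ t t′ s s′ → t :- t′ :+ (:- (s :- s′) :+ :- (s′ :- t′)) := t :- s) refl
           (t (target e) w) (t (rootOf (target e)) w) (t (source e) w) (t (rootOf (source e)) w))
        (span-+ (contraction t ports (target e)) (span-+ (span-neg (contraction t ports (source e)))
          (span-neg (HM.walk-span t (λ h h∈ → quotient-edge t ports
            (edge (λ { ≡.refl → λ { ≡.refl → x∉p-x h∈ } }) (p─q⊆p F _ h∈))) link)))))
      where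
      open BorderRows F E₀ E₀′ (_≢ inj₁ i₀)
      ports : ∀ x → Spanned (λ w → t (N x) w - t (rootOf (N x)) w)
      ports x = span-cong row (span-base {inj₂ (inj₁ (inj₂ x))} λ ())
        where
        row : ∀ y → border F ∂Ω ∂Ω (W₀ E₀ E₀′) (inj₂ (inj₁ (inj₂ x))) y ≈ t (N x) y - t (rootOf (N x)) y
        row (inj₁ j)               = sym (-‿inverseʳ 0#)
        row (inj₂ (inj₁ (inj₁ w))) = refl
        row (inj₂ (inj₁ (inj₂ z))) = sym (-‿inverseʳ 0#)

    -- The indicator of a quotient component, pulled back to the vertices, is constant on every
    -- superport and vanishes at `g`.
    disconnected-borderDet : ∀ v → ¬ Linked Hq F (rootOf v) g → borderDet F E₀ E₀′ ≈ 0#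
    disconnected-borderDet v₀ ¬link = borderDet-right-kernel F E₀ E₀′ (λ w → side (punchIn g w)) (punchOut g≢r)
        (≡.subst (λ u → side u ≈ 1#) (≡.sym (Fin.punchIn-punchOut g≢r))
          (𝟙-yes (linked? Hq F (rootOf r) r) (≡.subst (λ u → Linked Hq F u r) (≡.sym (rootOf-idempotent v₀)) ε)))
        (λ i → reduced (target (pick F i)) (source (pick F i))
                 (side-cong (HW.reverseWalk (HW.edgeWalk (pick∈ F i)))))
        (λ x → reduced (N x) (rootOf (N x))
                 (reflexive (≡.cong (λ u → 𝟙 (linked? Hq F u r)) (≡.sym (rootOf-idempotent (N x))))))
      where
      r = rootOf v₀
      g≢r : g ≢ r
      g≢r g≡r = ¬link (≡.subst (Linked Hq F r) (≡.sym g≡r) ε)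
      side : Fin (suc n) → Carrier
      side u = 𝟙 (linked? Hq F (rootOf u) r)
      side-cong : ∀ {u v} → Linked Hq F (rootOf u) (rootOf v) → side u ≈ side v
      side-cong {u} {v} link = 𝟙-cong (linked? Hq F (rootOf u) r) (linked? Hq F (rootOf v) r)
        (HW.reverseWalk link ◅◅_) (link ◅◅_)
      side-g : side g ≈ 0#
      side-g = 𝟙-no (linked? Hq F (rootOf g) r)
        λ link → ¬link (HW.reverseWalk (≡.subst (λ u → Linked Hq F u r) (rootOf-root ground) link))
      reduced : ∀ u v → side u ≈ side v →
        ∑ (fins n) (λ w → (δ (punchIn g w) u - δ (punchIn g w) v) * side (punchIn g w)) ≈ 0#
      reduced u v eq = trans (∑-cong (fins n) λ w → *-comm _ _)
        (trans (sum-reduced-difference side side-g u v) (trans (+-congˡ (-‿cong (sym eq))) (-‿inverseʳ _)))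

    -- Everything is decided in the quotient: a bypass in the network maps to one there, so
    -- acyclicity of the quotient entails that of `F`.
    borderDet-valid : (Valid F × borderDet F E₀ E₀′ ≈ 1#) ⊎ (¬ Valid F × borderDet F E₀ E₀′ ≈ 0#)
    borderDet-valid with HW.bypassed? F
    ... | inj₁ (e , b) = inj₂ ((λ (_ , tree) → HW.acyclic⇒¬bypassed (proj₁ tree) e b) , quotient-bypassed-borderDet e b)
    ... | inj₂ none with Fin.all? (λ v → linked? Hq F (rootOf v) g)
    ...   | no ¬linked with Fin.¬∀⟶∃¬ _ _ (λ v → linked? Hq F (rootOf v) g) ¬linked
    ...     | v , ¬link = inj₂
      ( (λ (_ , tree) → ¬link (proj₂ tree (rootOf v) g (vertex⁺ (rootOf-idempotent v)) (vertex⁺ (rootOf-root ground))))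
      , disconnected-borderDet v ¬link )
    borderDet-valid | inj₂ none | yes linked = inj₁ (valid , tree-borderDet (proj₂ valid))
      where
      valid : Valid F
      valid = ¬bypassed⇒acyclic (λ e b → none e (quotient-bypassed b)) , HW.¬bypassed⇒acyclic none ,
        λ u v u∈ v∈ → ≡.subst₂ (Linked Hq F) (vertex⁻ u∈) (vertex⁻ v∈) (linked u ◅◅ HW.reverseWalk (linked v))

  -- Forest sums as sums over all edge sets, and the determinant of the network matrix.

  module _ {l : ℕ} {P : Pred (Subset l) 0ℓ} (P? : Decidable P) {f : ∀ F → P F → Carrier} {h : Subset l → Carrier}
    (f≈h : ∀ F p → f F p ≈ h F) (0≈h : ∀ F → ¬ P F → 0# ≈ h F) where

    -- The summand of sumOver is local to its definition: unification in sumOver-sumSubsets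
    -- supplies it as the left side of sumOver-term.
    mutual
      sumOver-sumSubsets : sumOver P? f ≈ sumSubsets h
      sumOver-sumSubsets = sumSubsets-cong {l} sumOver-term

      sumOver-term : ∀ F → _ ≈ h F
      sumOver-term F with P? F
      ... | yes p = f≈h F p
      ... | no ¬p = 0≈h F ¬p

  Φ-borderDet : ∀ (E₀ E₀′ : Matrix q 0) → Φ-valid ≈ sumSubsets λ F → weight F * borderDet F E₀ E₀′
  Φ-borderDet E₀ E₀′ = sumOver-sumSubsets valid? on-valid off-valid
    where
    on-valid : ∀ F → Valid F → weight F ≈ weight F * borderDet F E₀ E₀′
    on-valid F valid with borderDet-valid F E₀ E₀′
    ... | inj₁ (_ , eq)     = sym (trans (*-congˡ eq) (*-identityʳ _))
    ... | inj₂ (¬valid , _) = contradiction valid ¬valid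
    off-valid : ∀ F → ¬ Valid F → 0# ≈ weight F * borderDet F E₀ E₀′
    off-valid F ¬valid with borderDet-valid F E₀ E₀′
    ... | inj₁ (valid , _) = contradiction valid ¬valid
    ... | inj₂ (_ , eq)    = sym (annihilateʳ eq)

  valid-forest : Connected → ∃[ F ] Valid F
  valid-forest connected with HW.acyclic-linking ⊤
  ... | F , none , links = F , ¬bypassed⇒acyclic (λ e b → none e (quotient-bypassed b)) , HW.¬bypassed⇒acyclic none ,
    λ u v u∈ v∈ → ≡.subst₂ (Linked Hq F) (vertex⁻ u∈) (vertex⁻ v∈) (links (quotientWalk (connected u v)))

  module _ {r k} (r+k≡q : r ℕ.+ k ≡ q) (I J : Subset q) (∣I∣≡k : ∣ I ∣ ≡ k) (∣J∣≡k : ∣ J ∣ ≡ k) where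

    forest-size : ∀ {F} → 𝓕 (suc r) F → n ℕ.+ k ≡ ∣ F ∣ ℕ.+ q
    forest-size {F} (acyclic , count) = ≡.trans (≡.cong (ℕ._+ k) n≡f+r)
      (≡.trans (ℕ.+-assoc ∣ F ∣ r k) (≡.cong (∣ F ∣ ℕ.+_) r+k≡q))
      where
      n≡f+r : n ≡ ∣ F ∣ ℕ.+ r
      n≡f+r = ℕ.suc-injective (≡.trans (≡.sym (acyclic-count (components F) acyclic))
        (≡.trans (≡.cong (∣ F ∣ ℕ.+_) count) (ℕ.+-suc ∣ F ∣ r)))

    -- For acyclic `F`, edges and components together number `n + 1`. With `r + k = q`, having
    -- `r + 1` components thus means exactly that the matrix `X` is square.
    acyclic-size⇒forest : ∀ {F} → Acyclic multigraph F → n ℕ.+ k ≡ ∣ F ∣ ℕ.+ q → 𝓕 (suc r) F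
    acyclic-size⇒forest {F} acyclic size = acyclic , ℕ.+-cancelˡ-≡ ∣ F ∣ _ _
      (≡.trans (acyclic-count (components F) acyclic) (≡.trans (≡.cong suc n≡f+r) (≡.sym (ℕ.+-suc ∣ F ∣ r))))
      where
      n≡f+r : n ≡ ∣ F ∣ ℕ.+ r
      n≡f+r = ℕ.+-cancelʳ-≡ k _ _
        (≡.trans size (≡.trans (≡.cong (∣ F ∣ ℕ.+_) (≡.sym r+k≡q)) (≡.sym (ℕ.+-assoc ∣ F ∣ r k))))

    forest-sum : (order : ∀ F → 𝓕 (suc r) F → ComponentOrder F r) →
      sumOver (𝓕? (suc r)) (λ F F∈𝓕 → α (order F F∈𝓕) r+k≡q I J ∣I∣≡k ∣J∣≡k * weight F) ≈
      sumSubsets λ F → weight F * borderDet F (E I ∣I∣≡k) (E J ∣J∣≡k)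
    forest-sum order = sumOver-sumSubsets (𝓕? (suc r))
      (λ F F∈𝓕 → trans (*-comm _ _) (*-congˡ (sym (borderDet-α (order F F∈𝓕) r+k≡q
        (≡.subst (λ s → Fin s ↔ Row {k} F) (forest-size F∈𝓕) (fins n ⊕ fins k)) I J ∣I∣≡k ∣J∣≡k))))
      (λ F F∉𝓕 → sym (annihilateʳ (vanish F F∉𝓕)))
      where
      vanish : ∀ F → ¬ 𝓕 (suc r) F → borderDet F (E I ∣I∣≡k) (E J ∣J∣≡k) ≈ 0#
      vanish F F∉𝓕 with bypassed? F
      ... | inj₁ (e , b) = bypassed-borderDet F _ _ e b
      ... | inj₂ none    = borderDet-rectangular F (F∉𝓕 ∘ acyclic-size⇒forest (¬bypassed⇒acyclic none)) _ _

  -- For `k = 0` the border of `W` is empty and its Schur factor is an empty determinant, so the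
  -- expansion of det W is one of det M.
  Det-M : Det eVert eVert M ≈ Φ-valid
  Det-M = begin
    Det eVert eVert M
      ≈⟨ trans (*-congˡ (reflexive (Det-def (fins 0) (fins 0) _))) (*-identityʳ _) ⟨
    Det eVert eVert M * Det (fins 0) (fins 0) (λ x y → - mul eVert (beside E₀) S₀ x y)
      ≈⟨ Det-schur eVert (fins 0) M (below E₀) (beside E₀) S₀ (λ x ()) ⟨
    Det eΩ eΩ (W E₀ E₀)
      ≈⟨ Det-W E₀ E₀ ⟩
    sumSubsets (λ F → weight F * borderDet F E₀ E₀)
      ≈⟨ Φ-borderDet E₀ E₀ ⟨
    Φ-valid ∎
    where
    E₀ : Matrix q 0
    E₀ x ()
    S₀ : Mat Vert (Fin 0)
    S₀ x ()

  -- The superport response as a Schur complement.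

  private
    sum-∑ : ∀ {k} (f : Fin k → Carrier) → sum f ≈ ∑ (fins k) f
    sum-∑ {k} f = reflexive (≡.sym (∑-def (fins k) f))

  -- The current vector in which `j x` enters at the port vertex `N x` and leaves at its root;
  -- unlike `D` it also records the ground.
  current : (Fin q → Carrier) → Fin (suc n) → Carrier
  current j v = ∑ (fins q) λ x → (δ v (N x) - δ v (rootOf (N x))) * j x

  -- Each port injects and withdraws the same amount. Taking `z` constant gives total current 0, and
  -- taking the indicator of a superport gives its balance condition.
  ∑-current : ∀ (z : Fin (suc n) → Carrier) j → (∀ x → z (N x) ≈ z (rootOf (N x))) →
              ∑ (fins (suc n)) (λ v → z v * current j v) ≈ 0#
  ∑-current z j z-port = begin
    ∑ (fins (suc n)) (λ v → z v * current j v)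
      ≈⟨ mul-assoc (fins (suc n)) (fins q) (λ (_ : Unit) → z) (λ v x → δ v (N x) - δ v (rootOf (N x)))
           (λ x (_ : Unit) → j x) tt tt ⟩
    ∑ (fins q) (λ x → ∑ (fins (suc n)) (λ v → z v * (δ v (N x) - δ v (rootOf (N x)))) * j x)
      ≈⟨ ∑-zero (fins q) (λ x → annihilateˡ (trans (∑-δ-difference z (N x) (rootOf (N x)))
           (trans (+-congˡ (-‿cong (sym (z-port x)))) (-‿inverseʳ _)))) ⟩
    0# ∎

  laplacian-column-sum : ∀ v′ → ∑ (fins (suc n)) (λ v → laplacian v v′) ≈ 0#
  laplacian-column-sum v′ = begin
    ∑ (fins (suc n)) (λ v → laplacian v v′)
      ≈⟨ ∑-cong (fins (suc n)) (λ v → trans (laplacian-incidence v v′) (sum-∑ _)) ⟩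
    ∑ (fins (suc n)) (λ v → ∑ (fins m) λ e → c e * (incidence e v * incidence e v′))
      ≈⟨ ∑-swap (fins (suc n)) (fins m) _ ⟩
    ∑ (fins m) (λ e → ∑ (fins (suc n)) λ v → c e * (incidence e v * incidence e v′))
      ≈⟨ ∑-zero (fins m) (λ e → trans (∑-cong (fins (suc n)) λ v →
             solve 3 (λ c x y → c :* (x :* y) := c :* y :* x) refl (c e) (incidence e v) (incidence e v′))
           (trans (∑-δ-difference (λ _ → c e * incidence e v′) (target e) (source e)) (-‿inverseʳ _))) ⟩
    0# ∎

  module _ (L : Matrix q q) (response : IsResponse L) (ρ : Carrier) (Φρ≈1 : Φ-valid * ρ ≈ 1#) where

    -- The columns of the inverse of `M` that belong to the ports: potentials and port currents
    -- produced by a unit voltage at one port.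
    solution : Mat Vert (Fin q)
    solution v y = Adj eVert eVert M v (inj₂ y) * ρ

    M-solution : ∀ x y → mul eVert M solution x y ≈ Id eVert x (inj₂ y)
    M-solution x y = begin
      ∑ eVert (λ v → M x v * (Adj eVert eVert M v (inj₂ y) * ρ))
        ≈⟨ trans (∑-cong eVert λ v → sym (*-assoc _ _ _)) (sym (∑-*ʳ eVert _ ρ)) ⟩
      mul eVert M (Adj eVert eVert M) x (inj₂ y) * ρ
        ≈⟨ *-congʳ (mul-Adj eVert eVert M x (inj₂ y)) ⟩
      Id eVert x (inj₂ y) * Det eVert eVert M * ρ
        ≈⟨ trans (*-assoc _ _ _) (*-congˡ (trans (*-congʳ Det-M) Φρ≈1)) ⟩
      Id eVert x (inj₂ y) * 1#
        ≈⟨ *-identityʳ _ ⟩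
      Id eVert x (inj₂ y) ∎

    module _ (y : Fin q) where
      u : Fin n → Carrier
      u w = solution (inj₁ w) y

      j : Fin q → Carrier
      j x = solution (inj₂ x) y

      U : Fin (suc n) → Carrier
      U = insertAt u g 0#

      U-g : U g ≈ 0#
      U-g = reflexive (insertAt-lookup u g 0#)

      U-punchIn : ∀ w → U (punchIn g w) ≈ u w
      U-punchIn w = reflexive (insertAt-punchIn u g 0# w)

      Dᵀu : ∀ x → ∑ (fins n) (λ w → D w x * u w) ≈ δ x y
      Dᵀu x = begin
        ∑ (fins n) (λ w → D w x * u w)
          ≈⟨ +-dropʳ refl (∑-zero (fins q) λ z → zeroˡ _) ⟨
        ∑ (fins n) (λ w → D w x * u w) + ∑ (fins q) (λ z → 0# * j z)
          ≈⟨ ∑-⊕ (fins n) (fins q) _ ⟨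
        mul eVert M solution (inj₂ x) y
          ≈⟨ M-solution (inj₂ x) y ⟩
        Id eVert (inj₂ x) (inj₂ y)
          ≈⟨ trans (Id-injection (fins q) eVert Sum.inj₂-injective x y) (Id-fins x y) ⟩
        δ x y ∎

      Au : ∀ w → ∑ (fins n) (λ w′ → A w w′ * u w′) ≈ current j (punchIn g w)
      Au w = begin
        a′                                  ≈⟨ solve 2 (λ a b → a := a :- b :+ b) refl a′ b′ ⟩
        a′ - b′ + b′                        ≈⟨ +-congʳ balance ⟩
        0# + b′                             ≈⟨ +-identityˡ _ ⟩
        b′                                  ∎
        where
        a′ = ∑ (fins n) λ w′ → A w w′ * u w′
        b′ = current j (punchIn g w)
        balance : a′ - b′ ≈ 0#
        balance = begin
          a′ - b′
            ≈⟨ +-congˡ (trans (∑-cong (fins q) λ x → sym (-‿distribˡ-* _ _)) (∑-neg (fins q) _)) ⟨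
          a′ + ∑ (fins q) (λ x → - D w x * j x)
            ≈⟨ ∑-⊕ (fins n) (fins q) _ ⟨
          mul eVert M solution (inj₁ w) y
            ≈⟨ M-solution (inj₁ w) y ⟩
          Id eVert (inj₁ w) (inj₂ y)
            ≈⟨ Id-off eVert (λ ()) ⟩
          0# ∎

      incoming : Fin (suc n) → Carrier
      incoming = laplacian ∙ᵥ U

      incoming-sum : sum incoming ≈ 0#
      incoming-sum = begin
        sum incoming
          ≈⟨ trans (sum-∑ _) (∑-cong (fins (suc n)) λ v → trans (sum-∑ _) (sym (*-identityˡ _))) ⟩
        ∑ (fins (suc n)) (λ v → 1# * ∑ (fins (suc n)) λ v′ → laplacian v v′ * U v′)
          ≈⟨ mul-assoc (fins (suc n)) (fins (suc n)) (λ (_ : Unit) _ → 1#) laplacian (λ v′ (_ : Unit) → U v′) tt tt ⟩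
        ∑ (fins (suc n)) (λ v′ → ∑ (fins (suc n)) (λ v → 1# * laplacian v v′) * U v′)
          ≈⟨ ∑-zero (fins (suc n)) (λ v′ → annihilateˡ
               (trans (∑-cong (fins (suc n)) λ v → *-identityˡ _) (laplacian-column-sum v′))) ⟩
        0# ∎

      current-sum : sum (current j) ≈ 0#
      current-sum = trans (sum-∑ _)
        (trans (∑-cong (fins (suc n)) λ v → sym (*-identityˡ _)) (∑-current (λ _ → 1#) j λ x → refl))

      incoming-punchIn : ∀ w → incoming (punchIn g w) ≈ current j (punchIn g w)
      incoming-punchIn w = begin
        incoming (punchIn g w)
          ≈⟨ sum-remove {n} {g} (λ v → laplacian (punchIn g w) v * U v) ⟩
        laplacian (punchIn g w) g * U g + sum (λ w′ → A w w′ * U (punchIn g w′))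
          ≈⟨ +-cong (annihilateʳ U-g) (trans (sum-∑ _) (∑-cong (fins n) λ w′ → *-congˡ (U-punchIn w′))) ⟩
        0# + ∑ (fins n) (λ w′ → A w w′ * u w′)
          ≈⟨ trans (+-identityˡ _) (Au w) ⟩
        current j (punchIn g w) ∎

      -- The grounded system contains no equation at `g`. That equation follows from the others
      -- because both current vectors have total 0.
      incoming-current : ∀ v → incoming v ≈ current j v
      incoming-current v with g Fin.≟ v
      ... | no g≢v     = ≡.subst (λ v → incoming v ≈ current j v) (Fin.punchIn-punchOut g≢v)
                           (incoming-punchIn (punchOut g≢v))
      ... | yes ≡.refl = +-cancelʳ (sum λ w → current j (punchIn g w)) (incoming g) (current j g) (begin
        incoming g + sum (λ w → current j (punchIn g w))   ≈⟨ +-congˡ (sum-cong-≋ {n} incoming-punchIn) ⟨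
        incoming g + sum (λ w → incoming (punchIn g w))    ≈⟨ sum-remove {n} {g} incoming ⟨
        sum incoming                                       ≈⟨ trans incoming-sum (sym current-sum) ⟩
        sum (current j)                                    ≈⟨ sum-remove {n} {g} (current j) ⟩
        current j g + sum (λ w → current j (punchIn g w))  ∎)

      port-N : ∀ x → ∃[ b ] port (N x) ≡ just b
      port-N x with ⇒ (N-image (N x)) (x , ≡.refl)
      ... | b , port≡ , _ = b , port≡

      port-rootOf-N : ∀ x → port (rootOf (N x)) ≡ port (N x)
      port-rootOf-N x with port-N x
      ... | b , port≡ = ≡.trans (≡.cong port (rootOf-just port≡)) (≡.trans (root-port b) (≡.sym port≡))

      admissible : Admissible (λ x → δ x y) U
      admissible = record
        { voltages = λ x → begin
            U (N x) - U (rootOf (N x))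
              ≈⟨ sum-reduced-difference U U-g (N x) (rootOf (N x)) ⟨
            ∑ (fins n) (λ w → U (punchIn g w) * D w x)
              ≈⟨ ∑-cong (fins n) (λ w → trans (*-comm _ _) (*-congˡ (U-punchIn w))) ⟩
            ∑ (fins n) (λ w → D w x * u w)
              ≈⟨ Dᵀu x ⟩
            δ x y ∎
        ; interior = λ v port≡nothing → trans (incoming-current v) (∑-zero (fins q) λ x → trans
            (*-congʳ (trans (+-cong (δ-off (unported port≡nothing x ≡.refl))
                                    (-‿cong (δ-off (unported port≡nothing x (port-rootOf-N x)))))
                            (-‿inverseʳ 0#)))
            (zeroˡ _))
        ; balanced = λ b → begin
            sum (λ v → if does (Maybe.≡-dec Fin._≟_ (port v) (just b)) then incoming v else 0#)
              ≈⟨ trans (sum-∑ _) (∑-cong (fins (suc n)) λ v →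
                   restrict (Maybe.≡-dec Fin._≟_ (port v) (just b)) (incoming-current v)) ⟩
            ∑ (fins (suc n)) (λ v → 𝟙 (Maybe.≡-dec Fin._≟_ (port v) (just b)) * current j v)
              ≈⟨ ∑-current (λ v → 𝟙 (Maybe.≡-dec Fin._≟_ (port v) (just b))) j
                   (λ x → reflexive (≡.cong (λ p → 𝟙 (Maybe.≡-dec Fin._≟_ p (just b))) (≡.sym (port-rootOf-N x)))) ⟩
            0# ∎
        }
        where
        unported : ∀ {v v′} → port v ≡ nothing → ∀ x → port v′ ≡ port (N x) → v ≢ v′
        unported port≡nothing x port≡ ≡.refl with port-N x
        ... | b , N≡ with ≡.trans (≡.sym port≡nothing) (≡.trans port≡ N≡)
        ...   | ()
        restrict : ∀ {P : Set} (P? : Dec P) {s t} → s ≈ t → (if does P? then s else 0#) ≈ 𝟙 P? * t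
        restrict (yes _) s≈t = trans s≈t (sym (*-identityˡ _))
        restrict (no _)  s≈t = sym (zeroˡ _)

      current-N : ∀ x → current j (N x) ≈ j x
      current-N x = trans
        -- A non-root boundary vertex is never the root of a port, so only the injection of its own
        -- port is seen there.
        (∑-cong (fins q) λ x′ → *-congʳ (trans (+-congˡ (trans (-‿cong (δ-off (off x′))) -0#≈0#))
                                             (trans (+-identityʳ _) (δ-N x′))))
        (∑-Idˡ (fins q) x j)
        where
        δ-N : ∀ x′ → δ (N x) (N x′) ≈ Id (fins q) x x′
        δ-N x′ = trans (δ-injection (N-injective _ _) x x′) (sym (Id-fins x x′))
        off : ∀ x′ → N x ≢ rootOf (N x′)
        off x′ eq = N-moves x (≡.trans (≡.cong rootOf eq) (≡.trans (rootOf-idempotent (N x′)) (≡.sym eq)))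

      solution-response : ∀ x → j x ≈ L x y
      solution-response x = begin
        j x                   ≈⟨ current-N x ⟨
        current j (N x)       ≈⟨ incoming-current (N x) ⟨
        incoming (N x)        ≈⟨ response (λ x → δ x y) U admissible x ⟩
        (L ∙ᵥ λ x → δ x y) x  ≈⟨ sum-δʳ y (L x) ⟩
        L x y                 ∎

    module _ {k} (I J : Subset q) (∣I∣≡k : ∣ I ∣ ≡ k) (∣J∣≡k : ∣ J ∣ ≡ k) where
      private
        EI = E I ∣I∣≡k
        EJ = E J ∣J∣≡k
        σ : Mat Vert (Fin k)
        σ v l = ∑ (fins q) λ y → solution v y * EJ y l

      M-σ : ∀ x l → mul eVert M σ x l ≈ below EJ x l
      M-σ x l = trans (mul-assoc eVert (fins q) M solution EJ x l)
        (trans (∑-cong (fins q) λ y → *-congʳ (M-solution x y)) (entry x))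
        where
        entry : ∀ x → ∑ (fins q) (λ y → Id eVert x (inj₂ y) * EJ y l) ≈ below EJ x l
        entry (inj₁ w) = ∑-zero (fins q) λ y → annihilateˡ (Id-off eVert λ ())
        entry (inj₂ x) = trans (∑-cong (fins q) λ y → *-congʳ (Id-injection (fins q) eVert Sum.inj₂-injective x y))
                               (∑-Idˡ (fins q) x λ y → EJ y l)

      σ-minor : ∀ i l → - mul eVert (beside EI) σ i l ≈ L (pick′ I ∣I∣≡k i) (pick′ J ∣J∣≡k l)
      σ-minor i l = begin
        - mul eVert (beside EI) σ i l
          ≈⟨ -‿cong (trans (∑-⊕ (fins n) (fins q) _) (+-dropˡ (∑-zero (fins n) λ w → zeroˡ _) refl)) ⟩
        - ∑ (fins q) (λ x → - EI x i * σ (inj₂ x) l)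
          ≈⟨ trans (-‿cong (trans (∑-cong (fins q) λ x → sym (-‿distribˡ-* _ _)) (∑-neg (fins q) _))) (-‿involutive _) ⟩
        ∑ (fins q) (λ x → EI x i * σ (inj₂ x) l)
          ≈⟨ trans (∑-cong (fins q) λ x → *-comm _ _) (∑-δ (λ x → σ (inj₂ x) l) (pick′ I ∣I∣≡k i)) ⟩
        σ (inj₂ (pick′ I ∣I∣≡k i)) l
          ≈⟨ ∑-δ (solution (inj₂ (pick′ I ∣I∣≡k i))) (pick′ J ∣J∣≡k l) ⟩
        solution (inj₂ (pick′ I ∣I∣≡k i)) (pick′ J ∣J∣≡k l)
          ≈⟨ solution-response (pick′ J ∣J∣≡k l) (pick′ I ∣I∣≡k i) ⟩
        L (pick′ I ∣I∣≡k i) (pick′ J ∣J∣≡k l) ∎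

      Φ-minor : Φ-valid * minor L I J ∣I∣≡k ∣J∣≡k ≈ sumSubsets λ F → weight F * borderDet F EI EJ
      Φ-minor = begin
        Φ-valid * minor L I J ∣I∣≡k ∣J∣≡k
          ≈⟨ *-cong (sym Det-M) (trans (reflexive (≡.sym (Det-def (fins k) (fins k) _)))
               (Det-cong (fins k) (fins k) λ i l → sym (σ-minor i l))) ⟩
        Det eVert eVert M * Det (fins k) (fins k) (λ i l → - mul eVert (beside EI) σ i l)
          ≈⟨ Det-schur eVert (fins k) M (below EJ) (beside EI) σ M-σ ⟨
        Det eΩ eΩ (W EI EJ)
          ≈⟨ Det-W EI EJ ⟩
        sumSubsets (λ F → weight F * borderDet F EI EJ) ∎

-- Order properties of the real numbers.

module RealFacts {a ℓ₁ ℓ₂ ℓ₃} (ℝ : RealNumbers a ℓ₁ ℓ₂ ℓ₃) where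
  open RealNumbers ℝ hiding (zero)
  open CommutativeRing commutativeRing using (ring)
  open HeytingProperties heytingCommutativeRing using (1#0; x-0≈x)
  open IsStrictPartialOrder isStrictPartialOrder using (<-resp-≈) renaming (trans to <-trans; irrefl to <-irrefl)
  open RingProperties ring using (-0#≈0#; -‿involutive)
  open LinearAlgebra commutativeRing using (sumSubsets; product)
  open Determinants commutativeRing using (-1*-1≈1)
  open IntegerMultiples commutativeRing using (φ)

  <-respʳ : ∀ {x y z} → y ≈ z → x < y → x < z
  <-respʳ = proj₁ <-resp-≈

  <-respˡ : ∀ {x y z} → x ≈ y → x < z → y < z
  <-respˡ = proj₂ <-resp-≈

  0<1 : 0# < 1#
  0<1 with #⇒<⊎> 1#0
  ... | inj₂ 0<1 = 0<1
  -- If 1 were negative, -1 would be positive and so would its square, which is 1 again; this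
  -- already is the claim.
  ... | inj₁ 1<0 = <-respʳ -1*-1≈1 (*-pos 0<-1 0<-1)
    where
    0<-1 : 0# < - 1#
    0<-1 = <-respˡ (-‿inverseʳ 1#) (<-respʳ (+-identityˡ _) (+-monoˡ-< (- 1#) 1<0))

  +-pos : ∀ {x y} → 0# < x → 0# < y → 0# < x + y
  +-pos {x} {y} 0<x 0<y = <-trans 0<y (<-respˡ (+-identityˡ y) (+-monoˡ-< y 0<x))

  multiples-pos : ∀ k → 0# < φ (+ suc k)
  multiples-pos zero    = <-respʳ (sym (+-identityʳ 1#)) 0<1
  multiples-pos (suc k) = +-pos 0<1 (multiples-pos k)

  φ-injective : ∀ i → φ i ≈ 0# → i ≡ + 0
  φ-injective (+ zero)  _   = ≡.refl
  φ-injective (+ suc k) φ≈0 = contradiction (multiples-pos k) (<-irrefl (sym φ≈0))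
  φ-injective -[1+ k ]  φ≈0 = contradiction (multiples-pos k)
    (<-irrefl (sym (trans (sym (-‿involutive _)) (trans (-‿cong φ≈0) -0#≈0#))))

  -- Stronger than the negation of being negative. It is attainable here because every summand is a
  -- weight or 0 according to a decidable property.
  NonNegative : Carrier → Set _
  NonNegative x = x ≈ 0# ⊎ 0# < x

  nonNegative-+-pos : ∀ {x y} → NonNegative x → 0# < y → 0# < x + y
  nonNegative-+-pos (inj₁ x≈0) 0<y = <-respʳ (sym (trans (+-congʳ x≈0) (+-identityˡ _))) 0<y
  nonNegative-+-pos (inj₂ 0<x) 0<y = +-pos 0<x 0<y

  pos-+-nonNegative : ∀ {x y} → 0# < x → NonNegative y → 0# < x + y
  pos-+-nonNegative 0<x (inj₁ y≈0) = <-respʳ (sym (trans (+-congˡ y≈0) (+-identityʳ _))) 0<x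
  pos-+-nonNegative 0<x (inj₂ 0<y) = +-pos 0<x 0<y

  sumSubsets-nonNegative : ∀ {m} (f : Subset m → Carrier) → (∀ F → NonNegative (f F)) → NonNegative (sumSubsets f)
  sumSubsets-nonNegative {zero}  f f≥0 = f≥0 []
  sumSubsets-nonNegative {suc m} f f≥0
    with sumSubsets-nonNegative {m} (f ∘ (outside ∷_)) (λ F → f≥0 (outside ∷ F))
       | sumSubsets-nonNegative {m} (f ∘ (inside ∷_)) (λ F → f≥0 (inside ∷ F))
  ... | s≥0      | inj₂ 0<t = inj₂ (nonNegative-+-pos s≥0 0<t)
  ... | inj₂ 0<s | t≥0      = inj₂ (pos-+-nonNegative 0<s t≥0)
  ... | inj₁ s≈0 | inj₁ t≈0 = inj₁ (trans (+-cong s≈0 t≈0) (+-identityˡ 0#))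

  sumSubsets-pos : ∀ {m} (f : Subset m → Carrier) → (∀ F → NonNegative (f F)) → ∀ F → 0# < f F → 0# < sumSubsets f
  sumSubsets-pos f f≥0 [] 0<fF = 0<fF
  sumSubsets-pos {suc m} f f≥0 (outside ∷ F) 0<fF = pos-+-nonNegative
    (sumSubsets-pos {m} _ (λ F → f≥0 (outside ∷ F)) F 0<fF) (sumSubsets-nonNegative {m} _ λ F → f≥0 (inside ∷ F))
  sumSubsets-pos {suc m} f f≥0 (inside ∷ F) 0<fF = nonNegative-+-pos
    (sumSubsets-nonNegative {m} _ λ F → f≥0 (outside ∷ F)) (sumSubsets-pos {m} _ (λ F → f≥0 (inside ∷ F)) F 0<fF)

  product-pos : ∀ {k} (f : Vector Carrier k) → (∀ i → 0# < f i) → 0# < product f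
  product-pos {zero}  f 0<f = 0<1
  product-pos {suc k} f 0<f = *-pos (0<f zero) (product-pos (tail f) (λ i → 0<f (suc i)))

  recip-inverseˡ : ∀ x (x#0 : x # 0#) → recip x x#0 * x ≈ 1#
  recip-inverseˡ x x#0 = trans (*-congˡ (sym (x-0≈x x))) (proj₁ (proj₂ (#⇒invertible x#0)))

-- Positivity of Φ, the minor formula and the coefficients.

module _ {a ℓ₁ ℓ₂ ℓ₃} (ℝ : RealNumbers a ℓ₁ ℓ₂ ℓ₃) where
  open RealNumbers ℝ hiding (zero)
  open RealFacts ℝ
  open Determinants commutativeRing using (-1*-1≈1)
  open IntegralMatrices commutativeRing φ-injective using (IsUnit; unit-square)
  open SetoidReasoning setoid

  -- Apartness from 0 is obtained from invertibility: 1 and -1 are their own inverses.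
  unit-#0 : ∀ {x} → IsUnit x → x # 0#
  unit-#0 {x} ux = invertible⇒#
    (x , trans (*-congˡ (x-0≈x x)) (unit-square ux) , trans (*-congʳ (x-0≈x x)) (unit-square ux))
    where open HeytingProperties heytingCommutativeRing using (x-0≈x)

  unit-* : ∀ {x y} → IsUnit x → IsUnit y → IsUnit (x * y)
  unit-* (inj₁ x≈1)  (inj₁ y≈1)  = inj₁ (trans (*-cong x≈1 y≈1) (*-identityˡ 1#))
  unit-* (inj₁ x≈1)  (inj₂ y≈-1) = inj₂ (trans (*-cong x≈1 y≈-1) (*-identityˡ _))
  unit-* (inj₂ x≈-1) (inj₁ y≈1)  = inj₂ (trans (*-cong x≈-1 y≈1) (*-identityʳ _))
  unit-* (inj₂ x≈-1) (inj₂ y≈-1) = inj₁ (trans (*-cong x≈-1 y≈-1) -1*-1≈1)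

  module _ {n m q} (G : SimpleGraph (suc n) m) (connected : SimpleGraph.Connected G)
           (c : Fin m → Carrier) (0<c : ∀ e → 0# < c e) (S : Superports (suc n) q) where
    open PortNetwork commutativeRing G c S
    open NetworkDeterminants commutativeRing φ-injective G c S

    weight-pos : ∀ F → 0# < weight F
    weight-pos F = product-pos (λ e → if does (e ∈? F) then c e else 1#) λ e → factor e (e ∈? F)
      where
      factor : ∀ e (e∈? : Dec (e ∈ F)) → 0# < (if does e∈? then c e else 1#)
      factor e (yes _) = 0<c e
      factor e (no _)  = 0<1

    Φ-pos : 0# < Φ-valid
    Φ-pos with valid-forest connected
    ... | F , valid = <-respʳ
        (sym (sumOver-sumSubsets valid? (λ F valid → mask-yes (valid? F) valid) (λ F ¬valid → mask-no (valid? F) ¬valid)))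
        (sumSubsets-pos (λ F → mask (valid? F) (weight F)) (λ F → mask-nonNegative (valid? F) (weight-pos F)) F
          (<-respʳ (mask-yes (valid? F) valid) (weight-pos F)))
      where
      mask : ∀ {P : Set} → Dec P → Carrier → Carrier
      mask P? x = if does P? then x else 0#
      mask-yes : ∀ {P : Set} (P? : Dec P) {x} → P → x ≈ mask P? x
      mask-yes (yes _) p = refl
      mask-yes (no ¬p) p = contradiction p ¬p
      mask-no : ∀ {P : Set} (P? : Dec P) {x} → ¬ P → 0# ≈ mask P? x
      mask-no (yes p) ¬p = contradiction p ¬p
      mask-no (no _)  ¬p = refl
      mask-nonNegative : ∀ {P : Set} (P? : Dec P) {x} → 0# < x → NonNegative (mask P? x)
      mask-nonNegative (yes _) 0<x = inj₂ 0<x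
      mask-nonNegative (no _)  0<x = inj₁ refl

    Φ#0 : Φ-valid # 0#
    Φ#0 = #-sym (<⇒# Φ-pos)

    minor-formula : (L : Matrix q q) → IsResponse L → ∀ {r k} (r+k≡q : r ℕ.+ k ≡ q) →
      (I J : Subset q) (∣I∣≡k : ∣ I ∣ ≡ k) (∣J∣≡k : ∣ J ∣ ≡ k) (order : ∀ F → 𝓕 (suc r) F → ComponentOrder F r) →
      minor L I J ∣I∣≡k ∣J∣≡k ≈ recip Φ-valid Φ#0 *
        sumOver (𝓕? (suc r)) λ F F∈𝓕 → α (order F F∈𝓕) r+k≡q I J ∣I∣≡k ∣J∣≡k * weight F
    minor-formula L response r+k≡q I J ∣I∣≡k ∣J∣≡k order = begin
      minor L I J ∣I∣≡k ∣J∣≡k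
        ≈⟨ trans (*-congʳ ρΦ≈1) (*-identityˡ _) ⟨
      ρ * Φ-valid * minor L I J ∣I∣≡k ∣J∣≡k
        ≈⟨ *-assoc _ _ _ ⟩
      ρ * (Φ-valid * minor L I J ∣I∣≡k ∣J∣≡k)
        ≈⟨ *-congˡ (trans (Φ-minor L response ρ (trans (*-comm _ _) ρΦ≈1) I J ∣I∣≡k ∣J∣≡k)
                          (sym (forest-sum r+k≡q I J ∣I∣≡k ∣J∣≡k order))) ⟩
      ρ * sumOver (𝓕? _) (λ F F∈𝓕 → α (order F F∈𝓕) r+k≡q I J ∣I∣≡k ∣J∣≡k * weight F) ∎
      where
      ρ = recip Φ-valid Φ#0
      ρΦ≈1 : ρ * Φ-valid ≈ 1#
      ρΦ≈1 = recip-inverseˡ Φ-valid Φ#0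

    α-sign : ∀ {F r k} (o : ComponentOrder F r) (r+k≡q : r ℕ.+ k ≡ q)
      (I J : Subset q) (∣I∣≡k : ∣ I ∣ ≡ k) (∣J∣≡k : ∣ J ∣ ≡ k) →
      (α o r+k≡q I J ∣I∣≡k ∣J∣≡k ≈ 0# ⊎ IsUnit (α o r+k≡q I J ∣I∣≡k ∣J∣≡k)) ×
      (α o r+k≡q I J ∣I∣≡k ∣J∣≡k # 0# ⇔
        (IsSpanningTree (portGraph o) (∁ I) × IsSpanningTree (portGraph o) (∁ J)))
    α-sign o r+k≡q I J ∣I∣≡k ∣J∣≡k
      with χ-spanning-tree o r+k≡q I ∣I∣≡k | χ-spanning-tree o r+k≡q J ∣J∣≡k
    ... | inj₁ (treeI , unitI) | inj₁ (treeJ , unitJ) =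
      inj₂ (unit-* unitI unitJ) , mk⇔ (λ _ → treeI , treeJ) (λ _ → unit-#0 (unit-* unitI unitJ))
    ... | inj₂ (¬tree , χI≈0) | _ =
      inj₁ α≈0 , mk⇔ (λ α#0 → contradiction α#0 (#-irrefl α≈0)) (λ (tree , _) → contradiction tree ¬tree)
      where α≈0 = trans (*-congʳ χI≈0) (zeroˡ _)
    ... | inj₁ _ | inj₂ (¬tree , χJ≈0) =
      inj₁ α≈0 , mk⇔ (λ α#0 → contradiction α#0 (#-irrefl α≈0)) (λ (_ , tree) → contradiction tree ¬tree)
      where α≈0 = trans (*-congˡ χJ≈0) (zeroʳ _)

theorem5p2 : ∀ {a ℓ₁ ℓ₂ ℓ₃} (ℝ : RealNumbers a ℓ₁ ℓ₂ ℓ₃) →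
    let open RealNumbers ℝ in
    ∀ {n m q} (G : SimpleGraph (suc n) m) → SimpleGraph.Connected G →
    (c : Fin m → Carrier) → (∀ e → 0# < c e) →
    (S : Superports (suc n) q) →
    let open PortNetwork commutativeRing G c S in
    (L : Matrix q q) → IsResponse L →
    ∀ {r k} (r+k≡q : r ℕ.+ k ≡ q) →
    (I J : Subset q) (∣I∣≡k : ∣ I ∣ ≡ k) (∣J∣≡k : ∣ J ∣ ≡ k) →
    ((order : ∀ F → 𝓕 (suc r) F → ComponentOrder F r) →
    Σ[ Φ#0 ∈ Φ-valid # 0# ]
    (minor L I J ∣I∣≡k ∣J∣≡k ≈
    recip Φ-valid Φ#0 *
    sumOver (𝓕? (suc r)) λ F F∈𝓕 →
    α (order F F∈𝓕) r+k≡q I J ∣I∣≡k ∣J∣≡k * weight F))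
    ×
    (∀ F → 𝓕 (suc r) F → (o : ComponentOrder F r) →
    (α o r+k≡q I J ∣I∣≡k ∣J∣≡k ≈ 0#
    ⊎ α o r+k≡q I J ∣I∣≡k ∣J∣≡k ≈ 1#
    ⊎ α o r+k≡q I J ∣I∣≡k ∣J∣≡k ≈ - 1#)
    ×
    (α o r+k≡q I J ∣I∣≡k ∣J∣≡k # 0#
    ⇔ (IsSpanningTree (portGraph o) (∁ I) × IsSpanningTree (portGraph o) (∁ J))))
theorem5p2 ℝ G connected c 0<c S L response r+k≡q I J ∣I∣≡k ∣J∣≡k =
  (λ order → Φ#0 ℝ G connected c 0<c S ,
             minor-formula ℝ G connected c 0<c S L response r+k≡q I J ∣I∣≡k ∣J∣≡k order) ,
  (λ F _ o → α-sign ℝ G connected c 0<c S o r+k≡q I J ∣I∣≡k ∣J∣≡k)
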